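{- Let $d>1$ be a squarefree integer and let $R$ be the ring of integers of $\mathbb{Q}(\sqrt d)\subset\mathbb{R}$. Let $u\in R$ be a unit of norm $-1$ with $u>1$, let $\Delta_n=N_{\mathbb{Q}(\sqrt d)/\mathbb{Q}}(u^n-1)$ for $n\geqslant1$, and let $\Delta'=(\Delta'_k)_{k\geqslant1}$ be the sequence obtained from $\Delta=(\Delta_n)_{n\geqslant1}$ by removing the terms $\Delta_n$ for which $n\equiv2\pmod4$. Then for all $u>13$, $Z(\Delta')\leqslant4$. If $u\leqslant13$, then one of the following is true: (1) $u=1+\sqrt2$, where $Z(\Delta')=3$ and the only term without a primitive prime divisor is $\Delta'_3$; (2) $u=\frac{1+\sqrt5}{2}$, where $Z(\Delta')=18$ and the only terms without a primitive prime divisor are $\Delta'_9$, $\Delta'_{15}$ and $\Delta'_{18}$; (3) $Z(\Delta')=1$.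
   Context: For an integer sequence $A=(a_n)_{n\geqslant1}$, a prime $p$ dividing a term $a_n$ is called a primitive prime divisor of $a_n$ if $p$ does not divide $a_m$ for any $m<n$ with $a_m\neq0$. The Zsigmondy bound of $A$ is $Z(A)=\max\{n: a_n\text{ does not have a primitive prime divisor}\}$ if this set is finite, and $Z(A)=\infty$ otherwise. $N_{\mathbb{Q}(\sqrt d)/\mathbb{Q}}$ denotes the field norm. The terms of $\Delta'$ are indexed consecutively: $\Delta'_1=\Delta_1$, $\Delta'_2=\Delta_3$, $\Delta'_3=\Delta_4$, $\Delta'_4=\Delta_5$, $\Delta'_5=\Delta_7$, and so on; for instance $\Delta'_9=\Delta_{12}$, $\Delta'_{15}=\Delta_{20}$, $\Delta'_{18}=\Delta_{24}$.
   Formalization: In case (2), Δ'_1 = -1 has no prime divisor, so the list of terms without a primitive prime divisor is corrected to Δ'_1, Δ'_9, Δ'_15, Δ'_18; and Z is taken to be 1 when every term has a primitive prime divisor (the maximum of the empty set is undefined), as always happens in case (3). -}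

module Defs where

open import Algebra.Bundles using (RawRing)
open import Data.Bool using (if_then_else_)
open import Data.Integer as ℤ using (ℤ; +_)
open import Data.Integer.Divisibility as ℤ using ()
open import Data.List using (List; []; _∷_)
open import Data.Nat as ℕ using (ℕ; zero; suc; _≡ᵇ_)
open import Data.Nat.Divisibility as ℕ using ()
open import Data.Nat.DivMod using (_%_)
open import Data.Nat.Primality using (Prime)
open import Data.Product using (∃-syntax; _×_; _,_)
open import Data.Rational as ℚ using (ℚ; 0ℚ; 1ℚ)
open import Data.Sum using (_⊎_)
open import Function.Bundles using (_⇔_)
open import Level using (0ℓ)
open import Relation.Binary.PropositionalEquality using (_≡_; _≢_; refl)
open import Relation.Nullary using (¬_)
import Algebra.Definitions.RawSemiring as RawSemiringDefs

Squarefree : ℕ → Set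
Squarefree d = ∀ m → m ℕ.* m ℕ.∣ d → m ≡ 1

ℤ→ℚ : ℤ → ℚ
ℤ→ℚ k = k ℚ./ 1

-- ⟨ a , b ⟩ stands for a + b√d.  This is the field ℚ(√d) whenever d is not a
-- square.
record ℚ√ (d : ℕ) : Set where
  constructor ⟨_,_⟩
  field
    rat irr : ℚ
open ℚ√ public

module _ {d : ℕ} where

  infixl 7 _*_
  infixl 6 _+_ _-_

  ℚ→ℚ√ : ℚ → ℚ√ d
  ℚ→ℚ√ q = ⟨ q , 0ℚ ⟩

  ℤ→ℚ√ : ℤ → ℚ√ d
  ℤ→ℚ√ k = ℚ→ℚ√ (ℤ→ℚ k)

  0√ 1√ : ℚ√ d
  0√ = ℚ→ℚ√ 0ℚ
  1√ = ℚ→ℚ√ 1ℚ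

  _+_ _*_ _-_ : ℚ√ d → ℚ√ d → ℚ√ d
  ⟨ a , b ⟩ + ⟨ a′ , b′ ⟩ = ⟨ a ℚ.+ a′ , b ℚ.+ b′ ⟩
  ⟨ a , b ⟩ * ⟨ a′ , b′ ⟩ =
    ⟨ a ℚ.* a′ ℚ.+ ℤ→ℚ (+ d) ℚ.* (b ℚ.* b′) , a ℚ.* b′ ℚ.+ b ℚ.* a′ ⟩
  ⟨ a , b ⟩ - ⟨ a′ , b′ ⟩ = ⟨ a ℚ.- a′ , b ℚ.- b′ ⟩

  norm : ℚ√ d → ℚ
  norm ⟨ a , b ⟩ = a ℚ.* a ℚ.- ℤ→ℚ (+ d) ℚ.* (b ℚ.* b)

  -- The order inherited from the embedding of ℚ(√d) in ℝ with √d > 0: the sign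
  -- of a + b√d is that of whichever of a, b√d is larger in absolute value.
  -- For d not a square, a² = db² happens only for a = b = 0.
  data Positive : ℚ√ d → Set where
    rat-dominates : ∀ {a b} → 0ℚ ℚ.< a →
                    ℤ→ℚ (+ d) ℚ.* (b ℚ.* b) ℚ.< a ℚ.* a → Positive ⟨ a , b ⟩
    irr-dominates : ∀ {a b} → 0ℚ ℚ.< b →
                    a ℚ.* a ℚ.< ℤ→ℚ (+ d) ℚ.* (b ℚ.* b) → Positive ⟨ a , b ⟩

  infix 4 _<_ _≤_

  _<_ _≤_ : ℚ√ d → ℚ√ d → Set
  x < y = Positive (y - x)
  x ≤ y = x < y ⊎ x ≡ y

  ℚ√-rawRing : RawRing 0ℓ 0ℓ
  ℚ√-rawRing = record
    { Carrier = ℚ√ d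
    ; _≈_     = _≡_
    ; _+_     = _+_
    ; _*_     = _*_
    ; -_      = λ x → 0√ - x
    ; 0#      = 0√
    ; 1#      = 1√
    }

  open RawSemiringDefs (RawRing.rawSemiring ℚ√-rawRing) public using (_^_)

  -- evalMonic (c₀ ∷ … ∷ cₙ₋₁ ∷ []) x = c₀ + c₁x + … + cₙ₋₁xⁿ⁻¹ + xⁿ
  evalMonic : List ℤ → ℚ√ d → ℚ√ d
  evalMonic []       x = 1√
  evalMonic (c ∷ cs) x = ℤ→ℚ√ c + x * evalMonic cs x

  IsAlgebraicInteger : ℚ√ d → Set
  IsAlgebraicInteger x = ∃[ cs ] evalMonic cs x ≡ 0√

  IsUnit : ℚ√ d → Set
  IsUnit u =
    IsAlgebraicInteger u × ∃[ v ] (IsAlgebraicInteger v × u * v ≡ 1√)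

-- A sequence (aₙ)_{n ≥ 1} is a function on ℕ whose value at 0 is never used.
Sequence : Set
Sequence = ℕ → ℤ

HasPrimitivePrimeDivisor : Sequence → ℕ → Set
HasPrimitivePrimeDivisor A n =
  ∃[ p ] (Prime p × + p ℤ.∣ A n ×
          (∀ m → 1 ℕ.≤ m → m ℕ.< n → A m ≢ + 0 → ¬ (+ p ℤ.∣ A m)))

-- Z(A) = z for finite z: the maximum of the set of indices whose term has no
-- primitive prime divisor.  If that set is empty, its supremum in {1, 2, 3, …}
-- is taken, which is 1.  If it is infinite then Z(A) = ∞, and no z qualifies.
record ZsigmondyBound (A : Sequence) (z : ℕ) : Set where
  field
    index    : 1 ℕ.≤ z
    bound    : ∀ n → z ℕ.< n → HasPrimitivePrimeDivisor A n
    attained : ¬ HasPrimitivePrimeDivisor A z ⊎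
               (z ≡ 1 × (∀ n → 1 ℕ.≤ n → HasPrimitivePrimeDivisor A n))

ZsigmondyBound≤ : Sequence → ℕ → Set
ZsigmondyBound≤ A N = ∃[ z ] (ZsigmondyBound A z × z ℕ.≤ N)

nextKept : ℕ → ℕ
nextKept n = if suc n % 4 ≡ᵇ 2 then suc (suc n) else suc n

-- keptIndex k is the k-th n ≥ 1 with n ≢ 2 (mod 4).
keptIndex : ℕ → ℕ
keptIndex zero    = 0
keptIndex (suc k) = nextKept (keptIndex k)

_ : keptIndex 1 ≡ 1 × keptIndex 2 ≡ 3 × keptIndex 5 ≡ 7 ×
    keptIndex 9 ≡ 12 × keptIndex 15 ≡ 20 × keptIndex 18 ≡ 24
_ = refl , refl , refl ,
    refl , refl , refl

removeTwoMod4 : Sequence → Sequence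
removeTwoMod4 A k = A (keptIndex k)

IsNormSequence : {d : ℕ} → ℚ√ d → Sequence → Set
IsNormSequence u Δ = ∀ n → 1 ℕ.≤ n → ℤ→ℚ (Δ n) ≡ norm (u ^ n - 1√)

LacksPrimitiveExactlyAt : Sequence → (ℕ → Set) → Set
LacksPrimitiveExactlyAt A P =
  ∀ n → 1 ℕ.≤ n → (¬ HasPrimitivePrimeDivisor A n) ⇔ P n

{-# OPTIONS --safe #-}

-- Let t be the trace of u and γ = u², a unit of norm 1.  The numbers
-- C(n) = (γⁿ - 1)²/γⁿ are integers, with |Δₙ|² = C(n) for odd n and
-- |Δₙ| = C(n/2) for 4 ∣ n.  Primes dividing some C(n) have a rank of
-- apparition, and so a primitive prime divisor of C(N), N being n or n/2, is a
-- primitive prime divisor of the term Δₙ of Δ′.  To find one, let A be the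
-- quotient of C(N) by the least common multiple of the C(N/q), q running over
-- the primes dividing N.
-- If no prime is primitive for C(N), every prime ℓ dividing A also divides N
-- and C(N/ℓ), but no other C(N/q).  As ℓ divides C(ℓ - 1) or C(ℓ + 1), it must
-- be the largest prime P dividing N, unless ℓ = 2 and P = 3.  As P³ does not
-- divide A when P is odd, A ≤ P² in general.  On the other hand, inclusion and
-- exclusion over the primes dividing N gives a lower bound for A, which
-- exceeds P² except in a few small cases.
module Submission where

open import Defs hiding (_+_; _*_; _-_; _<_; _≤_; _^_)
open import Data.Bool using (true; false; if_then_else_)
open import Data.Empty using (⊥; ⊥-elim)
open import Data.Integer as ℤ using (ℤ)
import Data.Integer.Divisibility as ℤ
import Data.Integer.Properties as ℤ
import Data.Integer.Tactic.RingSolver as ℤ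
open import Data.List using (List; []; _∷_)
open import Data.List.Membership.Propositional using (_∈_)
open import Data.List.Relation.Unary.All as All using (All; []; _∷_; all?)
open import Data.List.Relation.Unary.Any using (here; there)
open import Data.Nat as ℕ using (ℕ)
open import Data.Nat.Combinatorics using (_C_; nC1≡n; nCn≡1; k>n⇒nCk≡0; nCk+nC[k+1]≡[n+1]C[k+1])
open import Data.Nat.Coprimality using (Coprime; prime⇒coprime; coprime⇒gcd≡1; gcd≡1⇒coprime; coprime-divisor; recompute)
import Data.Nat.Divisibility as ℕ
open import Data.Nat.DivMod using (_%_; [m+kn]%n≡m%n)
open import Data.Nat.GCD
open import Data.Nat.LCM
open import Data.Nat.ListAction using (product)
open import Data.Nat.Primality
open import Data.Nat.Primality.Factorisation using (factorise; factorisationHasAllPrimeFactors)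
import Data.Nat.Properties as ℕ
open import Data.Nat.Tactic.RingSolver using (solve-∀)
open import Data.Product using (∃-syntax; _×_; _,_; proj₁; proj₂)
open import Data.Rational as ℚ using (1ℚ; ½)
import Data.Rational.Properties as ℚ
open import Data.Rational.Solver using (module +-*-Solver)
import Data.Rational.Unnormalised as ℚᵘ
import Data.Rational.Unnormalised.Properties as ℚᵘ
open import Data.Sum using (_⊎_; inj₁; inj₂; [_,_]′)
open import Function using (_∘_; id; mk⇔)
open import Relation.Binary.Definitions using (tri<; tri≈; tri>)
open import Relation.Binary.PropositionalEquality
open import Relation.Nullary using (¬_; Dec; yes; no; contradiction)
open import Relation.Nullary.Decidable using (_×-dec_; _⊎-dec_; _→-dec_; ¬?; from-yes; from-no; decidable-stable)

-- The quotient A equals Φ_N(γ)²/γ^φ(N), Φ_N being the cyclotomic polynomial. It is reached without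
-- polynomials: as gcd(C(i), C(j)) = C(gcd(i, j)), inclusion and exclusion for the least common
-- multiple yields this value. Since it is essentially a square, the limit on it is P² where
-- cyclotomic arguments have P. Indices n ≡ 2 (mod 4) have to go because, for odd h, |Δ₂ₕ| = C(h) =
-- |Δₕ|², so that Δ₂ₕ brings no new prime. On the other indices the passage from n to N is
-- one-to-one, though not increasing. Only the trace t matters. For t = 1 and t = 2 the unit is the
-- golden ratio or 1 + √2, both below 13; for t ≥ 3 no term is exceptional, so Z = 1 whatever the
-- size of u. The delicate case of the estimates is t = 1 with N squarefree: there C(1) = 1, and
-- powers of C(1) bound nothing from below.

module Arithmetic where

  open import Data.Nat using (zero; suc; pred; _+_; _*_; _^_; _∸_; _≤_; _<_; z≤n; s≤s; NonZero; _≟_; >-nonZero; _≤?_)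
  open import Data.Nat.Properties hiding (_≟_; _≤?_)
  open import Data.Nat.Divisibility

  -- The sequences E, C and M and their product formulas

  -- If γ + γ⁻¹ = 2 + c then M c k = γᵏ + γ⁻ᵏ and 𝒞 c k = (γᵏ - 1)²/γᵏ, which is
  -- c E c k, while e c k is the difference E c (1 + k) - E c k.
  state : ℕ → ℕ → ℕ × ℕ
  state c zero    = 0 , 1
  state c (suc k) = step (state c k)
    where
    step : ℕ × ℕ → ℕ × ℕ
    step s = proj₁ s + proj₂ s , proj₂ s + (c * (proj₁ s + proj₂ s) + 2)

  E e 𝒞 M : ℕ → ℕ → ℕ
  E c k = proj₁ (state c k)
  e c k = proj₂ (state c k)
  𝒞 c k = c * E c k
  M c k = 2 + 𝒞 c k

  -- Multiplication by γ + γ⁻¹ = 2 + c. Subtracting 2 from M and dividing by c turns this recursion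
  -- into "the second difference of E is c E + 2", which is how `state` generates E inside ℕ.
  M-rec : ∀ c k → M c (2 + k) + M c k ≡ (2 + c) * M c (1 + k)
  M-rec c k = lemma c (E c k) (e c k)
    where
    lemma : ∀ c x y → 2 + c * (x + y + (y + (c * (x + y) + 2))) + (2 + c * x) ≡
                      (2 + c) * (2 + c * (x + y))
    lemma = solve-∀

  C-one : ∀ c → 𝒞 c 1 ≡ c
  C-one = *-identityʳ

  private
    product-step : ∀ T w y₀ y₁ y₂ z₂ z₃ z₄ x₀ x₁ x₂ →
      z₄ + z₂ ≡ T * z₃ → x₂ + x₀ ≡ T * x₁ → y₂ + y₀ ≡ T * y₁ →
      z₃ + x₁ ≡ w * y₁ → z₂ + x₂ ≡ w * y₀ → z₄ + x₀ ≡ w * y₂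
    product-step T w y₀ y₁ y₂ z₂ z₃ z₄ x₀ x₁ x₂ hz hx hy h₁ h₀ =
      +-cancelʳ-≡ (w * y₀) (z₄ + x₀) (w * y₂) (begin
        z₄ + x₀ + w * y₀       ≡⟨ cong (z₄ + x₀ +_) h₀ ⟨
        z₄ + x₀ + (z₂ + x₂)    ≡⟨ shuffle z₄ x₀ z₂ x₂ ⟩
        z₄ + z₂ + (x₂ + x₀)    ≡⟨ cong₂ _+_ hz hx ⟩
        T * z₃ + T * x₁        ≡⟨ *-distribˡ-+ T z₃ x₁ ⟨
        T * (z₃ + x₁)          ≡⟨ cong (T *_) h₁ ⟩
        T * (w * y₁)           ≡⟨ swap T w y₁ ⟩
        w * (T * y₁)           ≡⟨ cong (w *_) hy ⟨
        w * (y₂ + y₀)          ≡⟨ *-distribˡ-+ w y₂ y₀ ⟩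
        w * y₂ + w * y₀        ∎)
      where
      open ≡-Reasoning
      shuffle : ∀ a b c d → a + b + (c + d) ≡ a + c + (d + b)
      shuffle = solve-∀
      swap : ∀ a b c → a * (b * c) ≡ b * (a * c)
      swap = solve-∀

  -- With s = y + x held fixed this is M(s + y) + M(s - y) = M(s) M(y), and both sides obey the
  -- recursion of M in y. Hence the induction lowers y while raising x by the same amount.
  M-product : ∀ c y x → M c (y + (y + x)) + M c x ≡ M c (y + x) * M c y
  M-product c zero x rewrite *-zeroʳ c = lemma (𝒞 c x)
    where
    lemma : ∀ a → 2 + a + (2 + a) ≡ (2 + a) * 2
    lemma = solve-∀
  M-product c (suc zero) x =
    trans (M-rec c x) (trans (*-comm (2 + c) (M c (1 + x)))
      (cong (λ z → M c (1 + x) * (2 + z)) (sym (C-one c))))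
  M-product c (suc (suc y)) x = trans (cong (λ z → M c z + M c x) (index₄ y x))
    (product-step (2 + c) (M c (2 + (y + x))) (M c y) (M c (1 + y)) (M c (2 + y))
      (M c (2 + (y + (y + x)))) (M c (3 + (y + (y + x)))) (M c (4 + (y + (y + x))))
      (M c x) (M c (1 + x)) (M c (2 + x))
      (M-rec c (2 + (y + (y + x)))) (M-rec c x) (M-rec c y)
      (subst₂ (λ z w → M c z + M c (1 + x) ≡ M c w * M c (1 + y)) (index₃ y x) (cong suc (+-suc y x))
        (M-product c (suc y) (suc x)))
      (subst₂ (λ z w → M c z + M c (2 + x) ≡ M c w * M c y) (index₂ y x) (index₁ y x)
        (M-product c y (suc (suc x)))))
    where
    index₁ : ∀ y x → y + (2 + x) ≡ 2 + (y + x)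
    index₁ = solve-∀
    index₂ : ∀ y x → y + (y + (2 + x)) ≡ 2 + (y + (y + x))
    index₂ = solve-∀
    index₃ : ∀ y x → 1 + (y + (1 + (y + (1 + x)))) ≡ 3 + (y + (y + x))
    index₃ = solve-∀
    index₄ : ∀ y x → 2 + (y + (2 + (y + x))) ≡ 4 + (y + (y + x))
    index₄ = solve-∀

  C-sum : ∀ c y x → 𝒞 c (y + (y + x)) + 𝒞 c x ≡
                    𝒞 c (y + x) * 𝒞 c y + 2 * 𝒞 c (y + x) + 2 * 𝒞 c y
  C-sum c y x = +-cancelˡ-≡ 4 _ _
    (trans (lemma₁ (𝒞 c (y + (y + x))) (𝒞 c x))
      (trans (M-product c y x) (lemma₂ (𝒞 c (y + x)) (𝒞 c y))))
    where
    lemma₁ : ∀ a b → 4 + (a + b) ≡ 2 + a + (2 + b)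
    lemma₁ = solve-∀
    lemma₂ : ∀ a b → (2 + a) * (2 + b) ≡ 4 + (a * b + 2 * a + 2 * b)
    lemma₂ = solve-∀

  -- In terms of M this is C(x) C(x + 2y) = (M(x + y) - M(y))².
  C-product : ∀ c y x → 𝒞 c x * 𝒞 c (y + (y + x)) + 2 * (𝒞 c (y + x) * 𝒞 c y) ≡
                        𝒞 c (y + x) * 𝒞 c (y + x) + 𝒞 c y * 𝒞 c y
  C-product c y x =
    lemma (𝒞 c x) (𝒞 c (y + (y + x))) (𝒞 c (y + x)) (𝒞 c y)
      (M c ((y + x) + ((y + x) + 0))) (M c (y + (y + 0)))
      (C-sum c y x)
      (trans (cong (λ k → M c k + M c (y + (y + 0))) (sym (index₁ x y)))
        (trans (M-product c x (y + (y + 0))) (cong (λ k → M c k * M c x) (index₂ x y))))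
      (trans (M-product c (y + x) 0) (cong (λ k → M c k * M c (y + x)) (+-identityʳ (y + x))))
      (trans (M-product c y 0) (cong (λ k → M c k * M c y) (+-identityʳ y)))
    where
    index₁ : ∀ x y → x + (x + (y + (y + 0))) ≡ (y + x) + ((y + x) + 0)
    index₁ = solve-∀
    index₂ : ∀ x y → x + (y + (y + 0)) ≡ y + (y + x)
    index₂ = solve-∀
    zero-C : 2 + c * 0 ≡ 2
    zero-C = cong (2 +_) (*-zeroʳ c)
    -- `r` and `s` stand for M(2(x + y)) and M(2y). Their sum is M(x + 2y) M(x), while `r` + 2 and
    -- `s` + 2 are the squares of M(x + y) and M(y).
    lemma : ∀ p q A B r s → q + p ≡ A * B + 2 * A + 2 * B →
            r + s ≡ (2 + q) * (2 + p) →
            r + M c 0 ≡ (2 + A) * (2 + A) → s + M c 0 ≡ (2 + B) * (2 + B) →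
            p * q + 2 * (A * B) ≡ A * A + B * B
    lemma p q A B r s h₁ h₂ h₃ h₄ = +-cancelʳ-≡ (4 + (4 + (4 * A + 4 * B))) _ _ (begin
      p * q + 2 * (A * B) + (4 + (4 + (4 * A + 4 * B)))
        ≡⟨ i₁ p q A B ⟩
      p * q + 4 + 2 * (A * B + 2 * A + 2 * B) + 4
        ≡⟨ cong (λ z → p * q + 4 + 2 * z + 4) h₁ ⟨
      p * q + 4 + 2 * (q + p) + 4
        ≡⟨ i₂ p q ⟩
      (2 + q) * (2 + p) + 4
        ≡⟨ cong (_+ 4) h₂ ⟨
      r + s + 4
        ≡⟨ i₃ r s ⟩
      (r + 2) + (s + 2)
        ≡⟨ cong (λ z → (r + z) + (s + z)) zero-C ⟨
      (r + M c 0) + (s + M c 0)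
        ≡⟨ cong₂ _+_ h₃ h₄ ⟩
      (2 + A) * (2 + A) + (2 + B) * (2 + B)
        ≡⟨ i₄ A B ⟩
      A * A + B * B + (4 + (4 + (4 * A + 4 * B))) ∎)
      where
      open ≡-Reasoning
      i₁ : ∀ p q A B → p * q + 2 * (A * B) + (4 + (4 + (4 * A + 4 * B))) ≡
                       p * q + 4 + 2 * (A * B + 2 * A + 2 * B) + 4
      i₁ = solve-∀
      i₂ : ∀ p q → p * q + 4 + 2 * (q + p) + 4 ≡ (2 + q) * (2 + p) + 4
      i₂ = solve-∀
      i₃ : ∀ r s → r + s + 4 ≡ (r + 2) + (s + 2)
      i₃ = solve-∀
      i₄ : ∀ A B → (2 + A) * (2 + A) + (2 + B) * (2 + B) ≡
                   A * A + B * B + (4 + (4 + (4 * A + 4 * B)))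
      i₄ = solve-∀

  -- Replacing γ by γᵃ replaces c by C(a). Thus C(qk)/C(k) is again a value of E, with parameter
  -- C(k), and statements about E at an arbitrary parameter apply to it.
  M-compose : ∀ c a k → M c (k * a) ≡ M (𝒞 c a) k
  M-compose c a zero = cong (2 +_) (trans (*-zeroʳ c) (sym (*-zeroʳ (𝒞 c a))))
  M-compose c a (suc zero) =
    trans (cong (M c) (*-identityˡ a)) (cong (2 +_) (sym (C-one (𝒞 c a))))
  M-compose c a (suc (suc k)) = +-cancelʳ-≡ (M c (k * a)) _ _ (begin
    M c (a + (a + k * a)) + M c (k * a)     ≡⟨ M-product c a (k * a) ⟩
    M c (a + k * a) * M c a                 ≡⟨ cong (_* M c a) (M-compose c a (suc k)) ⟩
    M (𝒞 c a) (suc k) * M c a               ≡⟨ *-comm (M (𝒞 c a) (suc k)) (M c a) ⟩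
    M c a * M (𝒞 c a) (suc k)               ≡⟨ M-rec (𝒞 c a) k ⟨
    M (𝒞 c a) (suc (suc k)) + M (𝒞 c a) k   ≡⟨ cong (M (𝒞 c a) (suc (suc k)) +_) (M-compose c a k) ⟨
    M (𝒞 c a) (suc (suc k)) + M c (k * a)   ∎)
    where open ≡-Reasoning

  C-compose : ∀ c a k → 𝒞 c (k * a) ≡ 𝒞 (𝒞 c a) k
  C-compose c a k = +-cancelˡ-≡ 2 _ _ (M-compose c a k)

  -- Divisibility of C by primes

  prime∤1 : ∀ {p} → Prime p → p ∤ 1
  prime∤1 pr p∣1 = ¬prime[1] (subst Prime (∣1⇒≡1 p∣1) pr)

  prime∣prime : ∀ {p q} → Prime p → Prime q → p ∣ q → p ≡ q
  prime∣prime pr qr p∣q with prime⇒irreducible qr p∣q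
  ... | inj₁ refl = ⊥-elim (¬prime[1] pr)
  ... | inj₂ p≡q  = p≡q

  prime∣square : ∀ {p} m → Prime p → p ∣ m * m → p ∣ m
  prime∣square m pr = [ id , id ]′ ∘ euclidsLemma m m pr

  C-∣ : ∀ c a k → 𝒞 c a ∣ 𝒞 c (k * a)
  C-∣ c a k = subst (𝒞 c a ∣_) (sym (C-compose c a k)) (m∣m*n (E (𝒞 c a) k))

  C-mono-∣ : ∀ c {a b} → a ∣ b → 𝒞 c a ∣ 𝒞 c b
  C-mono-∣ c {a} (divides k refl) = C-∣ c a k

  -- Subtracting indices: if p divides C(x + y) and C(y) then C-product shows
  -- that p divides C(x) or C(x + 2y), and C-sum makes the two equivalent.
  prime-∣-C-subtract : ∀ {p} c x y → Prime p → p ∣ 𝒞 c (y + x) → p ∣ 𝒞 c y → p ∣ 𝒞 c x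
  prime-∣-C-subtract {p} c x y pr p∣s p∣y =
    [ id , (λ p∣z → ∣m+n∣m⇒∣n p∣sum p∣z) ]′ (euclidsLemma _ _ pr p∣prod)
    where
    p∣sum : p ∣ 𝒞 c (y + (y + x)) + 𝒞 c x
    p∣sum = subst (p ∣_) (sym (C-sum c y x))
      (∣m∣n⇒∣m+n (∣m∣n⇒∣m+n (∣m⇒∣m*n _ p∣s) (∣n⇒∣m*n 2 p∣s)) (∣n⇒∣m*n 2 p∣y))
    p∣prod : p ∣ 𝒞 c x * 𝒞 c (y + (y + x))
    p∣prod = ∣m+n∣m⇒∣n
      (subst (p ∣_) (trans (sym (C-product c y x)) (+-comm (𝒞 c x * 𝒞 c (y + (y + x))) _))
        (∣m∣n⇒∣m+n (∣m⇒∣m*n _ p∣s) (∣m⇒∣m*n _ p∣y)))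
      (∣n⇒∣m*n 2 (∣m⇒∣m*n _ p∣s))

  -- By Bézout a multiple of one index exceeds a multiple of the other by exactly the gcd, so one
  -- subtraction is enough. This takes the place of the rank of apparition of p.
  prime-∣-C-gcd : ∀ {p} c a b → Prime p → p ∣ 𝒞 c a → p ∣ 𝒞 c b → p ∣ 𝒞 c (gcd a b)
  prime-∣-C-gcd {p} c a b pr p∣a p∣b with Bézout.identity (gcd-GCD a b)
  ... | Bézout.+- x y eq = prime-∣-C-subtract c (gcd a b) (y * b) pr
    (subst (λ k → p ∣ 𝒞 c k) (trans (sym eq) (+-comm (gcd a b) (y * b))) (∣-trans p∣a (C-∣ c a x)))
    (∣-trans p∣b (C-∣ c b y))
  ... | Bézout.-+ x y eq = prime-∣-C-subtract c (gcd a b) (x * a) pr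
    (subst (λ k → p ∣ 𝒞 c k) (trans (sym eq) (+-comm (gcd a b) (x * a))) (∣-trans p∣b (C-∣ c b y)))
    (∣-trans p∣a (C-∣ c a x))

  -- Congruences modulo c and c², and E at odd indices

  -- For c = 0 the recursion produces the squares k² and their differences 2k + 1.
  E-e-mod-c : ∀ c k → (∃[ z ] E c k ≡ k * k + c * z) × (∃[ w ] e c k ≡ 2 * k + 1 + c * w)
  E-e-mod-c c zero = (0 , sym (*-zeroʳ c)) , (0 , sym (cong suc (*-zeroʳ c)))
  E-e-mod-c c (suc k) with E-e-mod-c c k
  ... | (z , hE) , (w , he) =
    (z + w , trans (cong₂ _+_ hE he) (lemma₁ c k z w)) ,
    (w + E c (suc k) , trans (cong (_+ (c * E c (suc k) + 2)) he) (lemma₂ c k w (E c (suc k))))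
    where
    lemma₁ : ∀ c k z w → k * k + c * z + (2 * k + 1 + c * w) ≡ suc k * suc k + c * (z + w)
    lemma₁ = solve-∀
    lemma₂ : ∀ c k w E → 2 * k + 1 + c * w + (c * E + 2) ≡ 2 * suc k + 1 + c * (w + E)
    lemma₂ = solve-∀

  -- The expansion of e(h) in powers of c begins with (2h + 1) + c h(h + 1)(2h + 1)/6; the factor 6
  -- clears the denominator. Both terms contain 2h + 1, which is what limits the power of p = 2h + 1
  -- in e(h).
  e-mod-c² : ∀ c h → ∃[ w ] 6 * e c h ≡ 6 * (2 * h + 1) + c * (h * (h + 1) * (2 * h + 1)) + c * c * w
  e-mod-c² c zero = 0 , lemma c
    where
    lemma : ∀ c → 6 ≡ 6 + c * 0 + c * c * 0
    lemma = solve-∀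
  e-mod-c² c (suc h) with e-mod-c² c h | proj₁ (E-e-mod-c c (suc h))
  ... | w , he | z , hE = w + 6 * z ,
    trans (lemma₁ c (e c h) (E c (suc h)))
      (trans (cong₂ (λ a b → a + 6 * c * b + 12) he hE) (lemma₂ c h w z))
    where
    lemma₁ : ∀ c e E → 6 * (e + (c * E + 2)) ≡ 6 * e + 6 * c * E + 12
    lemma₁ = solve-∀
    lemma₂ : ∀ c h w z →
      6 * (2 * h + 1) + c * (h * (h + 1) * (2 * h + 1)) + c * c * w +
        6 * c * (suc h * suc h + c * z) + 12 ≡
      6 * (2 * suc h + 1) + c * (suc h * (suc h + 1) * (2 * suc h + 1)) + c * c * (w + 6 * z)
    lemma₂ = solve-∀

  E-rec : ∀ c k → E c (2 + k) + E c k ≡ (2 + c) * E c (1 + k) + 2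
  E-rec c k = lemma c (E c k) (e c k)
    where
    lemma : ∀ c x y → x + y + (y + (c * (x + y) + 2)) + x ≡ (2 + c) * (x + y) + 2
    lemma = solve-∀

  e-rec : ∀ c k → e c (2 + k) + e c k ≡ (2 + c) * e c (1 + k)
  e-rec c k = lemma c (E c k) (e c k)
    where
    lemma : ∀ c x y → let y′ = y + (c * (x + y) + 2) in
            y′ + (c * (x + y + y′) + 2) + y ≡ (2 + c) * y′
    lemma = solve-∀

  -- The recursion of e preserves the quadratic form x² - (2 + c)xy + y² of two neighbours, as in
  -- Cassini's identity. Its value 4 + c is read off at h = 0.
  e-invariant : ∀ c h → e c h * e c h + e c (suc h) * e c (suc h) ≡
                        (2 + c) * (e c h * e c (suc h)) + (4 + c)
  e-invariant c zero = lemma c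
    where
    lemma : ∀ c → 1 + (1 + (c * 1 + 2)) * (1 + (c * 1 + 2)) ≡ (2 + c) * (1 * (1 + (c * 1 + 2))) + (4 + c)
    lemma = solve-∀
  e-invariant c (suc h) = +-cancelʳ-≡ (x * x + y * z) _ _ (begin
    y * y + z * z + (x * x + y * z)       ≡⟨ cong (y * y + z * z +_) (+-comm (x * x) (y * z)) ⟩
    y * y + z * z + (y * z + x * x)       ≡⟨ goal ⟩
    (2 + c) * (y * z) + (4 + c) + (x * x + y * z) ∎)
    where
    open ≡-Reasoning
    x = e c h
    y = e c (suc h)
    z = e c (suc (suc h))
    goal : y * y + z * z + (y * z + x * x) ≡ (2 + c) * (y * z) + (4 + c) + (x * x + y * z)
    goal = +-cancelʳ-≡ (x * z) _ _ (begin
      y * y + z * z + (y * z + x * x) + x * z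
        ≡⟨ i₁ x y z ⟩
      (x * x + y * y) + z * (z + x) + y * z
        ≡⟨ cong₂ (λ a b → a + z * b + y * z) (e-invariant c h) (e-rec c h) ⟩
      (2 + c) * (x * y) + (4 + c) + z * ((2 + c) * y) + y * z
        ≡⟨ i₂ c x y z ⟩
      (2 + c) * y * x + (2 + c) * (y * z) + (4 + c) + y * z
        ≡⟨ cong (λ a → a * x + (2 + c) * (y * z) + (4 + c) + y * z) (e-rec c h) ⟨
      (z + x) * x + (2 + c) * (y * z) + (4 + c) + y * z
        ≡⟨ i₃ c x y z ⟩
      (2 + c) * (y * z) + (4 + c) + (x * x + y * z) + x * z ∎)
      where
      i₁ : ∀ x y z → y * y + z * z + (y * z + x * x) + x * z ≡ (x * x + y * y) + z * (z + x) + y * z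
      i₁ = solve-∀
      i₂ : ∀ c x y z → (2 + c) * (x * y) + (4 + c) + z * ((2 + c) * y) + y * z ≡
                       (2 + c) * y * x + (2 + c) * (y * z) + (4 + c) + y * z
      i₂ = solve-∀
      i₃ : ∀ c x y z → (z + x) * x + (2 + c) * (y * z) + (4 + c) + y * z ≡
                       (2 + c) * (y * z) + (4 + c) + (x * x + y * z) + x * z
      i₃ = solve-∀

  -- In terms of γ, e(h) is (γ^(2h+1) - 1)/(γ^h (γ - 1)), whose square is E(2h + 1). The statement
  -- for even indices carries the induction, as the recursion of E involves both parities.
  E-odd-even : ∀ c h → E c (suc (h + h)) ≡ e c h * e c h ×
                       E c (suc (suc (h + h))) ≡ e c h * e c (suc h) + 1
  E-odd-even c zero = refl , lemma c
    where
    lemma : ∀ c → 1 + (1 + (c * 1 + 2)) ≡ 1 * (1 + (c * 1 + 2)) + 1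
    lemma = solve-∀
  E-odd-even c (suc h) with E-odd-even c h
  ... | odd , even = odd′ , even′
    where
    x = e c h
    y = e c (suc h)
    z = e c (suc (suc h))
    index : suc (suc h + suc h) ≡ suc (suc (suc (h + h)))
    index = cong (suc ∘ suc) (+-suc h h)
    i₁ : ∀ c p → (2 + c) * (p + 1) + 2 ≡ (2 + c) * p + (4 + c)
    i₁ = solve-∀
    i₂ : ∀ c y → (2 + c) * (y * y) + 2 ≡ y * ((2 + c) * y) + 2
    i₂ = solve-∀
    i₃ : ∀ x y z → y * (z + x) + 2 ≡ y * z + 1 + (x * y + 1)
    i₃ = solve-∀
    odd″ : E c (3 + (h + h)) ≡ y * y
    odd″ = +-cancelʳ-≡ (x * x) _ _ (begin
      E c (3 + (h + h)) + x * x                     ≡⟨ cong (E c (3 + (h + h)) +_) odd ⟨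
      E c (3 + (h + h)) + E c (1 + (h + h))         ≡⟨ E-rec c (1 + (h + h)) ⟩
      (2 + c) * E c (2 + (h + h)) + 2               ≡⟨ cong (λ a → (2 + c) * a + 2) even ⟩
      (2 + c) * (x * y + 1) + 2                     ≡⟨ i₁ c (x * y) ⟩
      (2 + c) * (x * y) + (4 + c)                   ≡⟨ e-invariant c h ⟨
      x * x + y * y                                 ≡⟨ +-comm (x * x) (y * y) ⟩
      y * y + x * x                                 ∎)
      where open ≡-Reasoning
    odd′ : E c (suc (suc h + suc h)) ≡ y * y
    odd′ = trans (cong (E c) index) odd″
    even′ : E c (suc (suc (suc h + suc h))) ≡ y * z + 1
    even′ = trans (cong (E c ∘ suc) index) (+-cancelʳ-≡ (x * y + 1) _ _ (begin
      E c (4 + (h + h)) + (x * y + 1)               ≡⟨ cong (E c (4 + (h + h)) +_) even ⟨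
      E c (4 + (h + h)) + E c (2 + (h + h))         ≡⟨ E-rec c (2 + (h + h)) ⟩
      (2 + c) * E c (3 + (h + h)) + 2               ≡⟨ cong (λ a → (2 + c) * a + 2) odd″ ⟩
      (2 + c) * (y * y) + 2                         ≡⟨ i₂ c y ⟩
      y * ((2 + c) * y) + 2                         ≡⟨ cong (λ a → y * a + 2) (e-rec c h) ⟨
      y * (z + x) + 2                               ≡⟨ i₃ x y z ⟩
      y * z + 1 + (x * y + 1)                       ∎))
      where open ≡-Reasoning

  E-odd : ∀ c h → E c (suc (h + h)) ≡ e c h * e c h
  E-odd c h = proj₁ (E-odd-even c h)

  -- Binomial sums and Fermat's little theorem

  -- The sum of the (n choose i) f(i), given by Pascal's rule so that closed forms follow by
  -- induction on n. The explicit sum serves for divisibility of the inner terms by a prime n.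
  binomialTransform : ℕ → (ℕ → ℕ) → ℕ
  binomialTransform zero    f = f 0
  binomialTransform (suc n) f = binomialTransform n f + binomialTransform n (f ∘ suc)

  Σ< : ℕ → (ℕ → ℕ) → ℕ
  Σ< zero    f = 0
  Σ< (suc n) f = f 0 + Σ< n (f ∘ suc)

  Σ<-last : ∀ n f → Σ< (suc n) f ≡ Σ< n f + f n
  Σ<-last zero    f = +-identityʳ (f 0)
  Σ<-last (suc n) f = trans (cong (f 0 +_) (Σ<-last n (f ∘ suc)))
                            (sym (+-assoc (f 0) (Σ< n (f ∘ suc)) (f (suc n))))

  Σ<-cong : ∀ n {f g} → (∀ i → f i ≡ g i) → Σ< n f ≡ Σ< n g
  Σ<-cong zero    h = refl
  Σ<-cong (suc n) h = cong₂ _+_ (h 0) (Σ<-cong n (h ∘ suc))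

  Σ<-+ : ∀ n f g → Σ< n (λ i → f i + g i) ≡ Σ< n f + Σ< n g
  Σ<-+ zero    f g = refl
  Σ<-+ (suc n) f g = trans (cong (f 0 + g 0 +_) (Σ<-+ n (f ∘ suc) (g ∘ suc)))
                           (lemma (f 0) (g 0) (Σ< n (f ∘ suc)) (Σ< n (g ∘ suc)))
    where
    lemma : ∀ a b c d → a + b + (c + d) ≡ a + c + (b + d)
    lemma = solve-∀

  Σ<-∣ : ∀ p n f → (∀ i → i < n → p ∣ f i) → p ∣ Σ< n f
  Σ<-∣ p zero    f h = p ∣0
  Σ<-∣ p (suc n) f h = ∣m∣n⇒∣m+n (h 0 (s≤s z≤n)) (Σ<-∣ p n (f ∘ suc) (λ i i<n → h (suc i) (s≤s i<n)))

  binomialTransform-sum : ∀ n f → binomialTransform n f ≡ Σ< (suc n) (λ i → (n C i) * f i)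
  binomialTransform-sum zero    f = lemma (f 0)
    where
    lemma : ∀ a → a ≡ a + 0 + 0
    lemma = solve-∀
  binomialTransform-sum (suc n) f = begin
    binomialTransform n f + binomialTransform n (f ∘ suc)
      ≡⟨ cong₂ _+_ (binomialTransform-sum n f) (binomialTransform-sum n (f ∘ suc)) ⟩
    Σ< (suc n) (λ i → (n C i) * f i) + Σ< (suc n) (λ i → (n C i) * f (suc i))
      ≡⟨ cong (_+ Σ< (suc n) (λ i → (n C i) * f (suc i))) extend ⟨
    Σ< (2 + n) (λ i → (n C i) * f i) + Σ< (suc n) (λ i → (n C i) * f (suc i))
      ≡⟨ shuffle (1 * f 0) (Σ< (suc n) (λ i → (n C suc i) * f (suc i)))
           (Σ< (suc n) (λ i → (n C i) * f (suc i))) ⟩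
    1 * f 0 + (Σ< (suc n) (λ i → (n C i) * f (suc i)) + Σ< (suc n) (λ i → (n C suc i) * f (suc i)))
      ≡⟨ cong (1 * f 0 +_) (Σ<-+ (suc n) (λ i → (n C i) * f (suc i)) (λ i → (n C suc i) * f (suc i))) ⟨
    1 * f 0 + Σ< (suc n) (λ i → (n C i) * f (suc i) + (n C suc i) * f (suc i))
      ≡⟨ cong (1 * f 0 +_) (Σ<-cong (suc n) pascal) ⟩
    Σ< (2 + n) (λ i → (suc n C i) * f i) ∎
    where
    open ≡-Reasoning
    extend : Σ< (2 + n) (λ i → (n C i) * f i) ≡ Σ< (suc n) (λ i → (n C i) * f i)
    extend = trans (Σ<-last (suc n) (λ i → (n C i) * f i))
      (trans (cong (λ b → Σ< (suc n) (λ i → (n C i) * f i) + b * f (suc n)) (k>n⇒nCk≡0 (n<1+n n)))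
             (+-identityʳ _))
    shuffle : ∀ a b c → a + b + c ≡ a + (c + b)
    shuffle = solve-∀
    pascal : ∀ i → (n C i) * f (suc i) + (n C suc i) * f (suc i) ≡ (suc n C suc i) * f (suc i)
    pascal i = trans (sym (*-distribʳ-+ (f (suc i)) (n C i) (n C suc i)))
                     (cong (_* f (suc i)) (nCk+nC[k+1]≡[n+1]C[k+1] n i))

  C-absorption : ∀ n k → suc k * (suc n C suc k) ≡ suc n * (n C k)
  C-absorption zero    zero    = refl
  C-absorption zero    (suc k) = *-zeroʳ (2 + k)
  C-absorption (suc n) zero    = trans (*-identityˡ ((2 + n) C 1)) (trans (nC1≡n (2 + n)) (sym (*-identityʳ (2 + n))))
  C-absorption (suc n) (suc k) = begin
    (2 + k) * ((2 + n) C (2 + k))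
      ≡⟨ cong ((2 + k) *_) (nCk+nC[k+1]≡[n+1]C[k+1] (suc n) (suc k)) ⟨
    (2 + k) * ((suc n C suc k) + (suc n C (2 + k)))
      ≡⟨ lemma₁ k (suc n C suc k) (suc n C (2 + k)) ⟩
    suc k * (suc n C suc k) + (suc n C suc k) + (2 + k) * (suc n C (2 + k))
      ≡⟨ cong₂ (λ a b → a + (suc n C suc k) + b) (C-absorption n k) (C-absorption n (suc k)) ⟩
    suc n * (n C k) + (suc n C suc k) + suc n * (n C suc k)
      ≡⟨ lemma₂ n (n C k) (n C suc k) (suc n C suc k) ⟩
    suc n * ((n C k) + (n C suc k)) + (suc n C suc k)
      ≡⟨ cong (λ a → suc n * a + (suc n C suc k)) (nCk+nC[k+1]≡[n+1]C[k+1] n k) ⟩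
    suc n * (suc n C suc k) + (suc n C suc k)
      ≡⟨ +-comm _ (suc n C suc k) ⟩
    (2 + n) * (suc n C suc k) ∎
    where
    open ≡-Reasoning
    lemma₁ : ∀ k a b → (2 + k) * (a + b) ≡ suc k * a + a + (2 + k) * b
    lemma₁ = solve-∀
    lemma₂ : ∀ n a b c → suc n * a + c + suc n * b ≡ suc n * (a + b) + c
    lemma₂ = solve-∀

  prime-∣-C : ∀ {n} k → Prime (suc n) → k < n → suc n ∣ (suc n C suc k)
  prime-∣-C {n} k pr k<n with euclidsLemma (suc k) (suc n C suc k) pr
    (subst (suc n ∣_) (sym (C-absorption n k)) (m∣m*n (n C k)))
  ... | inj₁ d = contradiction (∣⇒≤ d) (<⇒≱ (s≤s k<n))
  ... | inj₂ d = d

  binomialTransform-prime : ∀ {p} → Prime p → ∀ f → ∃[ w ] binomialTransform p f ≡ f 0 + f p + p * w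
  binomialTransform-prime {zero}  pr f = ⊥-elim (¬prime[0] pr)
  binomialTransform-prime {suc n} pr f with Σ<-∣ (suc n) n (λ i → (suc n C suc i) * f (suc i))
                                                (λ i i<n → ∣m⇒∣m*n _ (prime-∣-C i pr i<n))
  ... | divides w eq = w , (begin
    binomialTransform (suc n) f
      ≡⟨ binomialTransform-sum (suc n) f ⟩
    1 * f 0 + Σ< (suc n) g
      ≡⟨ cong₂ _+_ (*-identityˡ (f 0)) (Σ<-last n g) ⟩
    f 0 + (Σ< n g + (suc n C suc n) * f (suc n))
      ≡⟨ cong₂ (λ a b → f 0 + (a + b * f (suc n))) (trans eq (*-comm w (suc n))) (nCn≡1 (suc n)) ⟩
    f 0 + (suc n * w + 1 * f (suc n))
      ≡⟨ lemma (f 0) (f (suc n)) (suc n * w) ⟩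
    f 0 + f (suc n) + suc n * w ∎)
    where
    open ≡-Reasoning
    g : ℕ → ℕ
    g i = (suc n C suc i) * f (suc i)
    lemma : ∀ a b c → a + (c + 1 * b) ≡ a + b + c
    lemma = solve-∀

  binomialTransform-power : ∀ x n f a → (∀ k → f k ≡ a * x ^ k) → binomialTransform n f ≡ a * (1 + x) ^ n
  binomialTransform-power x zero    f a h = h 0
  binomialTransform-power x (suc n) f a h =
    trans (cong₂ _+_ (binomialTransform-power x n f a h)
                     (binomialTransform-power x n (f ∘ suc) (a * x)
                       (λ k → trans (h (suc k)) (sym (*-assoc a x (x ^ k))))))
          (lemma a x ((1 + x) ^ n))
    where
    lemma : ∀ a x y → a * y + a * x * y ≡ a * ((1 + x) * y)
    lemma = solve-∀

  -- Summing (n choose k) γ^(2k+j) gives γ^j (1 + γ²)^n = γ^(n+j) (γ + γ⁻¹)^n, and likewise for γ⁻¹.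
  binomialTransform-M : ∀ c n f j → (∀ k → f k ≡ M c (k + (k + j))) →
                        binomialTransform n f ≡ (2 + c) ^ n * M c (n + j)
  binomialTransform-M c zero    f j h = trans (h 0) (sym (*-identityˡ (M c j)))
  binomialTransform-M c (suc n) f j h = begin
    binomialTransform n f + binomialTransform n (f ∘ suc)
      ≡⟨ cong₂ _+_ (binomialTransform-M c n f j h)
           (binomialTransform-M c n (f ∘ suc) (2 + j) (λ k → trans (h (suc k)) (cong (M c) (index₁ k j)))) ⟩
    (2 + c) ^ n * M c (n + j) + (2 + c) ^ n * M c (n + (2 + j))
      ≡⟨ cong (λ i → (2 + c) ^ n * M c (n + j) + (2 + c) ^ n * M c i) (index₂ n j) ⟩
    (2 + c) ^ n * M c (n + j) + (2 + c) ^ n * M c (2 + (n + j))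
      ≡⟨ lemma₁ ((2 + c) ^ n) _ _ ⟩
    (2 + c) ^ n * (M c (2 + (n + j)) + M c (n + j))
      ≡⟨ cong ((2 + c) ^ n *_) (M-rec c (n + j)) ⟩
    (2 + c) ^ n * ((2 + c) * M c (1 + (n + j)))
      ≡⟨ lemma₂ ((2 + c) ^ n) (2 + c) _ ⟩
    (2 + c) * (2 + c) ^ n * M c (1 + (n + j)) ∎
    where
    open ≡-Reasoning
    index₁ : ∀ k j → 1 + (k + (1 + (k + j))) ≡ k + (k + (2 + j))
    index₁ = solve-∀
    index₂ : ∀ n j → n + (2 + j) ≡ 2 + (n + j)
    index₂ = solve-∀
    lemma₁ : ∀ a b c → a * b + a * c ≡ a * (c + b)
    lemma₁ = solve-∀
    lemma₂ : ∀ a b c → a * (b * c) ≡ b * a * c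
    lemma₂ = solve-∀

  fermat : ∀ {p} → Prime p → ∀ x → ∃[ w ] x ^ p ≡ x + p * w
  fermat {zero}  pr x       = ⊥-elim (¬prime[0] pr)
  fermat {suc n} pr zero    = 0 , sym (*-zeroʳ (suc n))
  fermat {suc n} pr (suc x) with fermat pr x | binomialTransform-prime pr (x ^_)
  ... | w , h | v , h′ = w + v , (begin
    (1 + x) ^ suc n                       ≡⟨ *-identityˡ _ ⟨
    1 * (1 + x) ^ suc n                   ≡⟨ binomialTransform-power x (suc n) (x ^_) 1 (λ k → sym (*-identityˡ (x ^ k))) ⟨
    binomialTransform (suc n) (x ^_)      ≡⟨ h′ ⟩
    1 + x ^ suc n + suc n * v             ≡⟨ cong (λ y → 1 + y + suc n * v) h ⟩
    1 + (x + suc n * w) + suc n * v       ≡⟨ lemma x (suc n) w v ⟩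
    suc x + suc n * (w + v)               ∎)
    where
    open ≡-Reasoning
    lemma : ∀ x p w v → 1 + (x + p * w) + p * v ≡ suc x + p * (w + v)
    lemma = solve-∀

  -- A prime p divides C(p - 1) or C(p + 1)

  E-mono : ∀ c {a b} → a ≤ b → E c a ≤ E c b
  E-mono c {a} {b} a≤b with m≤n⇒∃[o]m+o≡n a≤b
  ... | k , refl = go k
    where
    go : ∀ k → E c a ≤ E c (a + k)
    go zero    = ≤-reflexive (cong (E c) (sym (+-identityʳ a)))
    go (suc k) = ≤-trans (go k) (≤-trans (m≤m+n _ _) (≤-reflexive (cong (E c) (sym (+-suc a k)))))

  C-mono : ∀ c {a b} → a ≤ b → 𝒞 c a ≤ 𝒞 c b
  C-mono c a≤b = *-monoʳ-≤ c (E-mono c a≤b)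

  2∣m[1+m] : ∀ m → 2 ∣ m * suc m
  2∣m[1+m] zero    = 2 ∣0
  2∣m[1+m] (suc m) = subst (2 ∣_) (lemma m) (∣m∣n⇒∣m+n (2∣m[1+m] m) (m∣m*n (suc m)))
    where
    lemma : ∀ m → m * suc m + 2 * suc m ≡ suc m * suc (suc m)
    lemma = solve-∀

  2∣C-three : ∀ c → 2 ∣ 𝒞 c 3
  2∣C-three c = subst (2 ∣_) (sym (trans (cong (c *_) (E-odd c 1)) (lemma c)))
    (∣m⇒∣m*n (c + 3) (∣m∣n⇒∣m+n (2∣m[1+m] c) (m∣m*n c)))
    where
    lemma : ∀ c → c * ((1 + (c * 1 + 2)) * (1 + (c * 1 + 2))) ≡ (c * suc c + 2 * c) * (c + 3)
    lemma = solve-∀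

  private
    -- Modulo p the hypothesis reads 2T ≡ 2(T + D).
    congruence : ∀ {p} T D z v w → (T + p * w) * (2 + p * z) ≡ (2 + p * z) * (T + D) + p * v → p ∣ 2 * D
    congruence {p} T D z v w key = ∣m+n∣m⇒∣n {m = p * (z * D + v)}
      (divides (w * (2 + p * z)) (+-cancelˡ-≡ (T * (2 + p * z)) _ _
        (trans (lemma₁ T p z D v) (trans (sym key) (lemma₂ T p z w)))))
      (m∣m*n _)
      where
      lemma₁ : ∀ T p z D v → T * (2 + p * z) + (p * (z * D + v) + 2 * D) ≡ (2 + p * z) * (T + D) + p * v
      lemma₁ = solve-∀
      lemma₂ : ∀ T p z w → (T + p * w) * (2 + p * z) ≡ T * (2 + p * z) + w * (2 + p * z) * p
      lemma₂ = solve-∀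

  -- M(p) ≡ (2 + c)ᵖ ≡ 2 + c = M(1) modulo p, and C(p - 1) C(p + 1) = (M(p) - M(1))².
  -- The first congruence is obtained after multiplication by M(pN) ≡ 2, whence
  -- the assumption that p divides some C(N).
  prime-∣-C[p±1] : ∀ {p} c N → Prime p → p ∣ 𝒞 c (suc N) →
                   ∃[ m ] ((suc m ≡ p ⊎ m ≡ suc p) × p ∣ 𝒞 c m)
  prime-∣-C[p±1] {zero}  c N pr p∣N = ⊥-elim (¬prime[0] pr)
  prime-∣-C[p±1] {suc q} c N pr p∣N = go (suc q ≟ 2)
    where
    open ≡-Reasoning
    p = suc q
    T = 2 + c
    f : ℕ → ℕ
    f k = M c (k + (k + p * N))
    w = proj₁ (fermat pr T)
    hw = proj₂ (fermat pr T)
    v = proj₁ (binomialTransform-prime pr f)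
    hv = proj₂ (binomialTransform-prime pr f)
    p∣CpN = ∣-trans p∣N (C-∣ c (suc N) p)
    z = quotient p∣CpN
    -- This is M(p) - M(1); nothing is truncated, since c = C(1) ≤ C(p).
    D = 𝒞 c p ∸ c
    CpN : 𝒞 c (p + p * N) ≡ p * z
    CpN = trans (cong (𝒞 c) (sym (*-suc p N))) (m∣n⇒n≡m*quotient p∣CpN)
    Cp : 𝒞 c p ≡ c + D
    Cp = sym (m+[n∸m]≡n (≤-trans (≤-reflexive (sym (C-one c))) (C-mono c {1} {p} (s≤s z≤n))))
    key : (T + p * w) * (2 + p * z) ≡ (2 + p * z) * (T + D) + p * v
    key = begin
      (T + p * w) * (2 + p * z)                         ≡⟨ cong₂ (λ a b → a * (2 + b)) hw CpN ⟨
      T ^ p * M c (p + p * N)                           ≡⟨ binomialTransform-M c p f (p * N) (λ k → refl) ⟨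
      binomialTransform p f                             ≡⟨ hv ⟩
      M c (p * N) + M c (p + (p + p * N)) + p * v       ≡⟨ cong (_+ p * v) (+-comm (M c (p * N)) (M c (p + (p + p * N)))) ⟩
      M c (p + (p + p * N)) + M c (p * N) + p * v       ≡⟨ cong (_+ p * v) (M-product c p (p * N)) ⟩
      M c (p + p * N) * M c p + p * v                   ≡⟨ cong₂ (λ a b → (2 + a) * (2 + b) + p * v) CpN Cp ⟩
      (2 + p * z) * (T + D) + p * v                     ∎
    difference² : 𝒞 c q * 𝒞 c (2 + q) ≡ D * D
    difference² = +-cancelʳ-≡ (2 * ((c + D) * c)) _ _ (begin
      𝒞 c q * 𝒞 c (2 + q) + 2 * ((c + D) * c)           ≡⟨ cong₂ (λ a b → 𝒞 c q * 𝒞 c (2 + q) + 2 * (a * b)) Cp (C-one c) ⟨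
      𝒞 c q * 𝒞 c (2 + q) + 2 * (𝒞 c p * 𝒞 c 1)         ≡⟨ C-product c 1 q ⟩
      𝒞 c p * 𝒞 c p + 𝒞 c 1 * 𝒞 c 1                     ≡⟨ cong₂ (λ a b → a * a + b * b) Cp (C-one c) ⟩
      (c + D) * (c + D) + c * c                         ≡⟨ lemma c D ⟩
      D * D + 2 * ((c + D) * c)                         ∎)
      where
      lemma : ∀ c D → (c + D) * (c + D) + c * c ≡ D * D + 2 * ((c + D) * c)
      lemma = solve-∀
    go : Dec (p ≡ 2) → ∃[ m ] ((suc m ≡ p ⊎ m ≡ suc p) × p ∣ 𝒞 c m)
    -- For p = 2 the factor 2 of 2D cannot be removed. Instead, C(3) = c(3 + c)² is always even.
    go (yes p≡2) = 3 , inj₂ (cong suc (sym p≡2)) , subst (_∣ 𝒞 c 3) (sym p≡2) (2∣C-three c)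
    go (no p≢2)  = [ (λ d → q , inj₁ refl , d) , (λ d → 2 + q , inj₂ refl , d) ]′
      (euclidsLemma _ _ pr (subst (p ∣_) (sym difference²) (∣m⇒∣m*n D
        ([ (λ d → contradiction (prime∣prime pr prime[2] d) p≢2) , id ]′
          (euclidsLemma 2 D pr (congruence T D z v w key))))))

  -- Greatest common divisors of values of E and C

  prime-divisor : ∀ {n} → n ≢ 1 → ∃[ p ] (Prime p × p ∣ n)
  prime-divisor {zero}  n≢1 = 2 , prime[2] , 2 ∣0
  prime-divisor {suc n} n≢1 with factorise (suc n)
  ... | record { factors = []     ; isFactorisation = eq } = contradiction eq n≢1
  ... | record { factors = p ∷ ps ; isFactorisation = eq ; factorsPrime = pr ∷ _ } =
    p , pr , subst (p ∣_) (sym eq) (m∣m*n (product ps))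

  no-common-prime⇒gcd≡1 : ∀ m n → (∀ p → Prime p → p ∣ m → p ∣ n → ⊥) → gcd m n ≡ 1
  no-common-prime⇒gcd≡1 m n h with gcd m n ≟ 1
  ... | yes g≡1 = g≡1
  ... | no g≢1 with prime-divisor g≢1
  ... | p , pr , p∣g = ⊥-elim (h p pr (∣-trans p∣g (gcd[m,n]∣m m n)) (∣-trans p∣g (gcd[m,n]∣n m n)))

  -- E(k) ≡ k² modulo c. Taken at the parameter C(k) and a prime index q, this shows that only q can
  -- divide both C(k) and C(qk)/C(k).
  prime-∣-E⇒∣index : ∀ {p} c k → Prime p → p ∣ c → p ∣ E c k → p ∣ k
  prime-∣-E⇒∣index {p} c k pr p∣c p∣E with proj₁ (E-e-mod-c c k)
  ... | z , eq = prime∣square k pr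
    (∣m+n∣m⇒∣n (subst (p ∣_) (trans eq (+-comm (k * k) (c * z))) p∣E) (∣m⇒∣m*n z p∣c))

  gcd-E : ∀ c i j → gcd i j ≡ 1 → gcd (E c i) (E c j) ≡ 1
  gcd-E c i j coprime = no-common-prime⇒gcd≡1 _ _ λ p pr p∣Ei p∣Ej →
    let p∣c = subst (p ∣_) (trans (cong (𝒞 c) coprime) (C-one c))
                (prime-∣-C-gcd c i j pr (∣n⇒∣m*n c p∣Ei) (∣n⇒∣m*n c p∣Ej))
    in prime∤1 pr (subst (p ∣_) coprime
         (gcd-greatest (prime-∣-E⇒∣index c i pr p∣c p∣Ei) (prime-∣-E⇒∣index c j pr p∣c p∣Ej)))

  gcd-C : ∀ c i j a → gcd i j ≡ 1 → gcd (𝒞 c (i * a)) (𝒞 c (j * a)) ≡ 𝒞 c a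
  gcd-C c i j a coprime = begin
    gcd (𝒞 c (i * a)) (𝒞 c (j * a))             ≡⟨ cong₂ gcd (C-compose c a i) (C-compose c a j) ⟩
    gcd (d * E d i) (d * E d j)                 ≡⟨ c*gcd[m,n]≡gcd[cm,cn] d (E d i) (E d j) ⟨
    d * gcd (E d i) (E d j)                     ≡⟨ cong (d *_) (gcd-E d i j coprime) ⟩
    d * 1                                       ≡⟨ *-identityʳ d ⟩
    d                                           ∎
    where
    open ≡-Reasoning
    d = 𝒞 c a

  -- For the harder direction, d h is shown to divide gx gy = h lcm(gx, gy), and h is cancelled. The
  -- product gx gy is itself the gcd of gy x and gy z, so two divisibilities suffice. That z is
  -- nonzero makes h nonzero.
  gcd-lcm-distrib : ∀ x y z → .{{NonZero z}} → gcd (lcm x y) z ≡ lcm (gcd x z) (gcd y z)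
  gcd-lcm-distrib x y z = ∣-antisym upper lower
    where
    d = gcd (lcm x y) z
    gx = gcd x z
    gy = gcd y z
    h = gcd gx gy
    instance
      h≢0 : NonZero h
      h≢0 = ℕ.≢-nonZero λ h≡0 → ℕ.≢-nonZero⁻¹ z (gcd[m,n]≡0⇒n≡0 x (gcd[m,n]≡0⇒m≡0 {gx} {gy} h≡0))
    h∣x : h ∣ x
    h∣x = ∣-trans (gcd[m,n]∣m gx gy) (gcd[m,n]∣m x z)
    h∣y : h ∣ y
    h∣y = ∣-trans (gcd[m,n]∣n gx gy) (gcd[m,n]∣m y z)
    h∣z : h ∣ z
    h∣z = ∣-trans (gcd[m,n]∣m gx gy) (gcd[m,n]∣n x z)
    d∣z : d ∣ z
    d∣z = gcd[m,n]∣n (lcm x y) z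
    dh∣x*gy : d * h ∣ gy * x
    dh∣x*gy = subst (d * h ∣_) (trans (sym (c*gcd[m,n]≡gcd[cm,cn] x y z)) (*-comm x gy))
      (gcd-greatest
        (subst (d * h ∣_) (trans (*-comm (lcm x y) (gcd x y)) (gcd*lcm x y))
          (*-pres-∣ (gcd[m,n]∣m (lcm x y) z) (gcd-greatest h∣x h∣y)))
        (subst (_∣ x * z) (*-comm h d) (*-pres-∣ h∣x d∣z)))
    dh∣z*gy : d * h ∣ gy * z
    dh∣z*gy = subst (d * h ∣_) (trans (sym (c*gcd[m,n]≡gcd[cm,cn] z y z)) (*-comm z gy))
      (gcd-greatest (*-pres-∣ d∣z h∣y) (*-pres-∣ d∣z h∣z))
    upper : d ∣ lcm gx gy
    upper = *-cancelˡ-∣ h (subst₂ _∣_ (*-comm d h) (trans (*-comm gy gx) (sym (gcd*lcm gx gy)))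
      (subst (d * h ∣_) (sym (c*gcd[m,n]≡gcd[cm,cn] gy x z)) (gcd-greatest dh∣x*gy dh∣z*gy)))
    lower : lcm gx gy ∣ d
    lower = lcm-least
      (gcd-greatest (∣-trans (gcd[m,n]∣m x z) (m∣lcm[m,n] x y)) (gcd[m,n]∣n x z))
      (gcd-greatest (∣-trans (gcd[m,n]∣m y z) (n∣lcm[m,n] x y)) (gcd[m,n]∣n y z))

  -- Growth of C

  E≥1 : ∀ c {k} → 1 ≤ k → 1 ≤ E c k
  E≥1 c 1≤k = E-mono c 1≤k

  C≥1 : ∀ {c k} → 1 ≤ c → 1 ≤ k → 1 ≤ 𝒞 c k
  C≥1 1≤c 1≤k = *-mono-≤ 1≤c (E≥1 _ 1≤k)

  C-rec : ∀ c k → 𝒞 c (2 + k) + 𝒞 c k ≡ (2 + c) * 𝒞 c (1 + k) + 2 * c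
  C-rec c k = trans (sym (*-distribˡ-+ c (E c (2 + k)) (E c k)))
    (trans (cong (c *_) (E-rec c k)) (lemma c (E c (1 + k))))
    where
    lemma : ∀ c x → c * ((2 + c) * x + 2) ≡ (2 + c) * (c * x) + 2 * c
    lemma = solve-∀

  C-two : ∀ c → 𝒞 c 2 ≡ c * (4 + c)
  C-two c = cong (c *_) (lemma c)
    where
    lemma : ∀ c → 1 + (1 + (c * 1 + 2)) ≡ 4 + c
    lemma = solve-∀

  C-three : ∀ c → 𝒞 c 3 ≡ c * ((3 + c) * (3 + c))
  C-three c = cong (c *_) (trans (E-odd c 1) (cong (λ x → x * x) (lemma c)))
    where
    lemma : ∀ c → 1 + (c * 1 + 2) ≡ 3 + c
    lemma = solve-∀

  -- The base case C(2) = c(4 + c) is an equality, and each further index gains a factor c because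
  -- the second difference of E(k + 1) already contains C(k + 2). The one factor 4 + c, in place of
  -- c, pays for the upper bound that `lcmC-bounds` has in the denominator.
  C-lower : ∀ c k → (4 + c) * c ^ suc k ≤ 𝒞 c (2 + k)
  C-lower c zero    = ≤-reflexive (trans (lemma c) (sym (C-two c)))
    where
    lemma : ∀ c → (4 + c) * (c * 1) ≡ c * (4 + c)
    lemma = solve-∀
  C-lower c (suc k) = begin
    (4 + c) * (c * c ^ suc k)     ≡⟨ lemma (4 + c) c (c ^ suc k) ⟩
    c * ((4 + c) * c ^ suc k)     ≤⟨ *-monoʳ-≤ c (C-lower c k) ⟩
    c * 𝒞 c (2 + k)               ≤⟨ *-monoʳ-≤ c step ⟩
    𝒞 c (3 + k)                   ∎
    where
    open ≤-Reasoning
    lemma : ∀ a b d → a * (b * d) ≡ b * (a * d)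
    lemma = solve-∀
    step : 𝒞 c (2 + k) ≤ E c (3 + k)
    step = ≤-trans (m≤m+n (𝒞 c (2 + k)) 2)
      (≤-trans (m≤n+m (𝒞 c (2 + k) + 2) (e c (1 + k))) (m≤n+m (e c (2 + k)) (E c (2 + k))))

  -- Here the one factor c pays for a lower bound in the denominator. The summand 4 is present
  -- because the upper bound of `lcmC-bounds` is a power of 4 + C. At index 2 the inequality is
  -- false, since 4 + c(4 + c) exceeds c(4 + c).
  C-upper : ∀ c k → 1 ≤ c → 4 + 𝒞 c (3 + k) ≤ c * (4 + c) ^ (2 + k)
  C-upper c@(suc b) zero    1≤c = begin
    4 + 𝒞 c 3                             ≡⟨ cong (4 +_) (C-three c) ⟩
    4 + c * ((3 + c) * (3 + c))           ≤⟨ m≤m+n _ (5 + 11 * b + 2 * (b * b)) ⟩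
    4 + c * ((3 + c) * (3 + c)) + (5 + 11 * b + 2 * (b * b))   ≡⟨ lemma b ⟩
    c * (4 + c) ^ 2                       ∎
    where
    open ≤-Reasoning
    lemma : ∀ b → 4 + suc b * ((4 + b) * (4 + b)) + (5 + 11 * b + 2 * (b * b)) ≡
                  suc b * ((5 + b) * ((5 + b) * 1))
    lemma = solve-∀
  C-upper c (suc k) 1≤c = begin
    4 + 𝒞 c (4 + k)                       ≤⟨ +-monoʳ-≤ 4 (≤-trans (m≤m+n _ (𝒞 c (2 + k))) (≤-reflexive (C-rec c (2 + k)))) ⟩
    4 + ((2 + c) * 𝒞 c (3 + k) + 2 * c)   ≤⟨ m≤m+n _ (12 + 2 * x + 2 * c) ⟩
    4 + ((2 + c) * x + 2 * c) + (12 + 2 * x + 2 * c)  ≡⟨ lemma₁ c x ⟩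
    (4 + c) * (4 + x)                     ≤⟨ *-monoʳ-≤ (4 + c) (C-upper c k 1≤c) ⟩
    (4 + c) * (c * (4 + c) ^ (2 + k))     ≡⟨ lemma₂ (4 + c) c ((4 + c) ^ (2 + k)) ⟩
    c * (4 + c) ^ (3 + k)                 ∎
    where
    open ≤-Reasoning
    x = 𝒞 c (3 + k)
    lemma₁ : ∀ c x → 4 + ((2 + c) * x + 2 * c) + (12 + 2 * x + 2 * c) ≡ (4 + c) * (4 + x)
    lemma₁ = solve-∀
    lemma₂ : ∀ a b d → a * (b * d) ≡ b * (a * d)
    lemma₂ = solve-∀

  -- Least common multiples of the C(N / q), by inclusion and exclusion

  -- For a list S of pairwise coprime numbers and N = product S * a, this is the
  -- least common multiple of the C(N / q) with q in S.
  lcmC : ℕ → List ℕ → ℕ → ℕ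
  lcmC c []      a = 1
  lcmC c (q ∷ S) a = lcm (lcmC c S (q * a)) (𝒞 c (product S * a))

  private
    regroup : ∀ q Π a → q * Π * a ≡ Π * (q * a)
    regroup = solve-∀

  -- The gcd distributes over the least common multiple, and gcd(C(N/s), C(N/q)) = C(N/(qs)) for
  -- coprime q and s. What remains is the least common multiple belonging to N/q and `S`.
  lcmC-gcd : ∀ c q S a → 1 ≤ c → 1 ≤ a → All (λ s → 1 ≤ s × gcd q s ≡ 1 × s < q) S → 1 ≤ product S →
             gcd (lcmC c S (q * a)) (𝒞 c (product S * a)) ≡ lcmC c S a
  lcmC-gcd c q []      a 1≤c 1≤a [] 1≤S = gcd-zeroˡ (𝒞 c (1 * a))
  lcmC-gcd c q (s ∷ S) a 1≤c 1≤a ((1≤s , coprime , _) ∷ coprimes) 1≤sS = begin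
    gcd (lcm (lcmC c S (s * (q * a))) (𝒞 c (product S * (q * a)))) z
      ≡⟨ gcd-lcm-distrib (lcmC c S (s * (q * a))) (𝒞 c (product S * (q * a))) z ⟩
    lcm (gcd (lcmC c S (s * (q * a))) z) (gcd (𝒞 c (product S * (q * a))) z)
      ≡⟨ cong₂ lcm left right ⟩
    lcm (lcmC c S (s * a)) (𝒞 c (product S * a)) ∎
    where
    open ≡-Reasoning
    z = 𝒞 c (s * product S * a)
    instance
      z≢0 : NonZero z
      z≢0 = >-nonZero (C≥1 1≤c (*-mono-≤ 1≤sS 1≤a))
    1≤S : 1 ≤ product S
    1≤S = n≢0⇒n>0 λ S≡0 → contradiction (subst (1 ≤_) (trans (cong (s *_) S≡0) (*-zeroʳ s)) 1≤sS) λ()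
    swap : ∀ s q a → s * (q * a) ≡ q * (s * a)
    swap = solve-∀
    left : gcd (lcmC c S (s * (q * a))) z ≡ lcmC c S (s * a)
    left = trans (cong₂ (λ i j → gcd (lcmC c S i) (𝒞 c j)) (swap s q a) (regroup s (product S) a))
      (lcmC-gcd c q S (s * a) 1≤c (*-mono-≤ 1≤s 1≤a) coprimes 1≤S)
    right : gcd (𝒞 c (product S * (q * a))) z ≡ 𝒞 c (product S * a)
    right = trans (cong₂ (λ i j → gcd (𝒞 c i) (𝒞 c j)) (swap (product S) q a) (*-assoc s (product S) a))
      (gcd-C c q s (product S * a) coprime)

  -- From gcd · lcm = product. This is one step of inclusion and exclusion, written without
  -- division.
  lcmC-step : ∀ c q S a → 1 ≤ c → 1 ≤ a → All (λ s → 1 ≤ s × gcd q s ≡ 1 × s < q) S → 1 ≤ product S →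
              lcmC c (q ∷ S) a * lcmC c S a ≡ lcmC c S (q * a) * 𝒞 c (product S * a)
  lcmC-step c q S a 1≤c 1≤a coprimes 1≤S = trans (*-comm (lcmC c (q ∷ S) a) (lcmC c S a))
    (trans (cong (_* lcmC c (q ∷ S) a) (sym (lcmC-gcd c q S a 1≤c 1≤a coprimes 1≤S)))
      (gcd*lcm (lcmC c S (q * a)) (𝒞 c (product S * a))))

  lcmC-[2] : ∀ c a → lcmC c (2 ∷ []) a ≡ 𝒞 c a
  lcmC-[2] c a = trans (sym (*-identityˡ (lcm 1 (𝒞 c (1 * a)))))
    (trans (cong (_* lcm 1 (𝒞 c (1 * a))) (sym (gcd-zeroˡ (𝒞 c (1 * a)))))
      (trans (gcd*lcm 1 (𝒞 c (1 * a))) (trans (*-identityˡ _) (cong (𝒞 c) (*-identityˡ a)))))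

  -- The step from S to q ∷ S in lcmC-bounds needs both bounds for S, and its
  -- upper bound fails for q = 2, so that 2 can only be the last entry.
  data Chain : List ℕ → Set where
    []  : Chain []
    [2] : Chain (2 ∷ [])
    _∷_ : ∀ {q S} → 3 ≤ q × All (λ s → 1 ≤ s × gcd q s ≡ 1 × s < q) S → Chain S → Chain (q ∷ S)

  chain⇒product≥1 : ∀ {S} → Chain S → 1 ≤ product S
  chain⇒product≥1 []                = ≤-refl
  chain⇒product≥1 [2]               = s≤s z≤n
  chain⇒product≥1 ((3≤q , _) ∷ chain) = *-mono-≤ (≤-trans (s≤s z≤n) 3≤q) (chain⇒product≥1 chain)

  -- For a list of distinct primes, Euler's function of their product.
  φ : List ℕ → ℕ
  φ []      = 1
  φ (q ∷ S) = pred q * φ S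

  φ≥1 : ∀ {S} → Chain S → 1 ≤ φ S
  φ≥1 []                = ≤-refl
  φ≥1 [2]               = ≤-refl
  φ≥1 ((s≤s 2≤q , _) ∷ chain) = *-mono-≤ (≤-trans (s≤s z≤n) 2≤q) (φ≥1 chain)

  lcmC≥1 : ∀ c S a → 1 ≤ c → 1 ≤ a → Chain S → 1 ≤ lcmC c S a
  lcmC≥1 c []      a 1≤c 1≤a chain = ≤-refl
  lcmC≥1 c (q ∷ S) a 1≤c 1≤a chain = n≢0⇒n>0 λ l≡0 →
    let N≡0 = trans (sym (gcd*lcm (lcmC c S (q * a)) (𝒞 c (product S * a))))
                (trans (cong (gcd (lcmC c S (q * a)) (𝒞 c (product S * a)) *_) l≡0)
                       (*-zeroʳ (gcd (lcmC c S (q * a)) (𝒞 c (product S * a)))))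
    in contradiction (subst (1 ≤_) N≡0 (positive chain)) λ()
    where
    positive : Chain (q ∷ S) → 1 ≤ lcmC c S (q * a) * 𝒞 c (product S * a)
    positive [2] = *-mono-≤ (≤-refl {1}) (C≥1 1≤c (≤-trans 1≤a (≤-reflexive (sym (*-identityˡ a)))))
    positive ((3≤q , _) ∷ chain) = *-mono-≤
      (lcmC≥1 c S (q * a) 1≤c (*-mono-≤ (≤-trans (s≤s z≤n) 3≤q) 1≤a) chain)
      (C≥1 1≤c (*-mono-≤ (chain⇒product≥1 chain) 1≤a))

  private
    ^-distribʳ-* : ∀ f x y → (x * y) ^ f ≡ x ^ f * y ^ f
    ^-distribʳ-* zero    x y = refl
    ^-distribʳ-* (suc f) x y = trans (cong (x * y *_) (^-distribʳ-* f x y)) (lemma x y (x ^ f) (y ^ f))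
      where
      lemma : ∀ x y u v → x * y * (u * v) ≡ x * u * (y * v)
      lemma = solve-∀

    power-distrib : ∀ x y r f → (x * y ^ r) ^ f ≡ x ^ f * y ^ (r * f)
    power-distrib x y r f = trans (^-distribʳ-* f x (y ^ r)) (cong (x ^ f *_) (^-*-assoc y r f))

  -- The quotient of C(N) by the least common multiple behaves like a cyclotomic value of degree
  -- `φ S`. Its value for `q ∷ S` is the value for `S` at qa divided by the value for `S` at a, so
  -- each of the two bounds needs both bounds for `S`.
  lcmC-bounds : ∀ c S a → 1 ≤ c → 1 ≤ a → Chain S →
    (𝒞 c a ^ φ S * lcmC c S a ≤ 𝒞 c (product S * a)) ×
    (𝒞 c (product S * a) ≤ (4 + 𝒞 c a) ^ φ S * lcmC c S a)
  lcmC-bounds c [] a 1≤c 1≤a [] rewrite *-identityˡ a =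
    ≤-reflexive (lemma (𝒞 c a)) , ≤-trans (m≤n+m (𝒞 c a) 4) (≤-reflexive (sym (lemma (4 + 𝒞 c a))))
    where
    lemma : ∀ x → x * 1 * 1 ≡ x
    lemma = solve-∀
  lcmC-bounds c (.2 ∷ []) a 1≤c 1≤a [2] =
    subst₂ (λ l n → (d ^ 1 * l ≤ n) × (n ≤ (4 + d) ^ 1 * l)) (sym (lcmC-[2] c a)) (sym (trans (C-compose c a 2) (C-two d)))
      (≤-trans (≤-reflexive (cong (_* d) (*-identityʳ d))) (*-monoʳ-≤ d (m≤n+m d 4)) ,
       ≤-reflexive (lemma d))
    where
    d = 𝒞 c a
    lemma : ∀ d → d * (4 + d) ≡ (4 + d) * 1 * d
    lemma = solve-∀
  lcmC-bounds c (_ ∷ S) a 1≤c 1≤a ((s≤s (s≤s (s≤s (z≤n {r}))) , coprimes) ∷ chain) = lower , upper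
    where
    q = 3 + r
    open ≤-Reasoning
    d = 𝒞 c a
    d′ = 𝒞 c (q * a)
    f = φ S
    N₀ = 𝒞 c (product S * a)
    N₁ = 𝒞 c (product (q ∷ S) * a)
    l₀ = lcmC c S a
    l₁ = lcmC c S (q * a)
    l = lcmC c (q ∷ S) a
    1≤qa : 1 ≤ q * a
    1≤qa = *-mono-≤ {1} {q} (s≤s z≤n) 1≤a
    1≤d : 1 ≤ d
    1≤d = C≥1 1≤c 1≤a
    d′≡ : d′ ≡ 𝒞 d q
    d′≡ = C-compose c a q
    N₁≡ : N₁ ≡ 𝒞 c (product S * (q * a))
    N₁≡ = cong (𝒞 c) (regroup q (product S) a)
    ll₀ : l * l₀ ≡ l₁ * N₀
    ll₀ = lcmC-step c q S a 1≤c 1≤a coprimes (chain⇒product≥1 chain)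
    ih₀ = lcmC-bounds c S a 1≤c 1≤a chain
    ih₁ = subst (λ N → (d′ ^ f * l₁ ≤ N) × (N ≤ (4 + d′) ^ f * l₁)) (sym N₁≡)
            (lcmC-bounds c S (q * a) 1≤c 1≤qa chain)
    1≤l₀ : 1 ≤ l₀
    1≤l₀ = lcmC≥1 c S a 1≤c 1≤a chain
    1≤d^f : 1 ≤ d ^ f
    1≤d^f = m^n>0 d {{>-nonZero 1≤d}} f
    shuffle : ∀ x y l k → x * l * (y * k) ≡ y * x * (l * k)
    shuffle = solve-∀
    lower : d ^ (pred q * f) * l ≤ N₁
    lower = *-cancelʳ-≤ _ _ ((4 + d) ^ f * l₀)
      {{>-nonZero (*-mono-≤ (m^n>0 (4 + d) f) 1≤l₀)}} (begin
      d ^ (pred q * f) * l * ((4 + d) ^ f * l₀)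
        ≡⟨ shuffle (d ^ (pred q * f)) ((4 + d) ^ f) l l₀ ⟩
      (4 + d) ^ f * d ^ (pred q * f) * (l * l₀)
        ≡⟨ cong₂ _*_ (sym (power-distrib (4 + d) d (pred q) f)) ll₀ ⟩
      ((4 + d) * d ^ pred q) ^ f * (l₁ * N₀)
        ≤⟨ *-monoˡ-≤ (l₁ * N₀) (^-monoˡ-≤ f (≤-trans (C-lower d (suc r)) (≤-reflexive (sym d′≡)))) ⟩
      d′ ^ f * (l₁ * N₀)
        ≡⟨ *-assoc (d′ ^ f) l₁ N₀ ⟨
      d′ ^ f * l₁ * N₀
        ≤⟨ *-mono-≤ (proj₁ ih₁) (proj₂ ih₀) ⟩
      N₁ * ((4 + d) ^ f * l₀) ∎)
    upper : N₁ ≤ (4 + d) ^ (pred q * f) * l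
    upper = *-cancelʳ-≤ _ _ (d ^ f * l₀) {{>-nonZero (*-mono-≤ 1≤d^f 1≤l₀)}} (begin
      N₁ * (d ^ f * l₀)
        ≤⟨ *-mono-≤ (proj₂ ih₁) (proj₁ ih₀) ⟩
      (4 + d′) ^ f * l₁ * N₀
        ≡⟨ *-assoc ((4 + d′) ^ f) l₁ N₀ ⟩
      (4 + d′) ^ f * (l₁ * N₀)
        ≤⟨ *-monoˡ-≤ (l₁ * N₀) (^-monoˡ-≤ f (≤-trans (≤-reflexive (cong (4 +_) d′≡)) (C-upper d r 1≤d))) ⟩
      (d * (4 + d) ^ pred q) ^ f * (l₁ * N₀)
        ≡⟨ cong₂ _*_ (power-distrib d (4 + d) (pred q) f) (sym ll₀) ⟩
      d ^ f * (4 + d) ^ (pred q * f) * (l * l₀)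
        ≡⟨ shuffle ((4 + d) ^ (pred q * f)) (d ^ f) l l₀ ⟨
      (4 + d) ^ (pred q * f) * l * (d ^ f * l₀) ∎)

  lcmC-∣ : ∀ c S a → lcmC c S a ∣ 𝒞 c (product S * a)
  lcmC-∣ c []      a = 1∣ _
  lcmC-∣ c (q ∷ S) a = lcm-least
    (subst (λ k → lcmC c S (q * a) ∣ 𝒞 c k) (swap (product S) q a) (lcmC-∣ c S (q * a)))
    (C-mono-∣ c (divides q (*-assoc q (product S) a)))
    where
    swap : ∀ Π q a → Π * (q * a) ≡ q * Π * a
    swap = solve-∀

  ∣-lcmC : ∀ c {q} S a k → NonZero q → q ∈ S → product S * a ≡ q * k → 𝒞 c k ∣ lcmC c S a
  ∣-lcmC c {q} (.q ∷ S) a k q≢0 (here refl) eq =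
    subst (λ j → 𝒞 c j ∣ lcmC c (q ∷ S) a)
      (*-cancelˡ-≡ (product S * a) k q {{q≢0}} (trans (sym (*-assoc q (product S) a)) eq))
      (n∣lcm[m,n] (lcmC c S (q * a)) (𝒞 c (product S * a)))
  ∣-lcmC c {q} (s ∷ S) a k q≢0 (there q∈S) eq =
    ∣-trans (∣-lcmC c S (s * a) k q≢0 q∈S (trans (swap (product S) s a) eq))
      (m∣lcm[m,n] (lcmC c S (s * a)) (𝒞 c (product S * a)))
    where
    swap : ∀ Π q a → Π * (q * a) ≡ q * Π * a
    swap = solve-∀

  -- The list of prime divisors of N

  prime≥2 : ∀ {p} → Prime p → 2 ≤ p
  prime≥2 {0} pr = ⊥-elim (¬prime[0] pr)
  prime≥2 {1} pr = ⊥-elim (¬prime[1] pr)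
  prime≥2 {suc (suc p)} pr = s≤s (s≤s z≤n)

  prime∤product : ∀ {q} S → Prime q → All (λ s → Prime s × s < q) S → q ∤ product S
  prime∤product []      qr []              q∣1 = prime∤1 qr q∣1
  prime∤product (s ∷ S) qr ((sr , s<q) ∷ h) q∣sS with euclidsLemma s (product S) qr q∣sS
  ... | inj₁ q∣s = <-irrefl (sym (prime∣prime qr sr q∣s)) s<q
  ... | inj₂ q∣S = prime∤product S qr h q∣S

  -- The primes up to b are inserted in increasing order, each at the head, so that the largest
  -- comes first and 2, if present, comes last, as `Chain` demands. At b = N the list is complete.
  record PrimeChain (N b : ℕ) : Set where
    field
      primes   : List ℕ
      chain    : Chain primes
      all≤     : All (λ p → Prime p × p ≤ b) primes
      product∣ : product primes ∣ N
      complete : ∀ {p} → Prime p → p ≤ b → p ∣ N → p ∈ primes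

  primeChain : ∀ N b → PrimeChain N b
  primeChain N zero = record
    { primes = [] ; chain = [] ; all≤ = [] ; product∣ = 1∣ N
    ; complete = λ pr p≤0 _ → contradiction (prime≥2 pr) (<⇒≱ (s≤s (≤-trans p≤0 z≤n))) }
  primeChain N (suc b) with primeChain N b | prime? (suc b) ×-dec (suc b ∣? N)
  ... | rest | no ¬q = record
    { primes = primes ; chain = chain ; product∣ = product∣
    ; all≤ = All.map (λ (pr , p≤b) → pr , m≤n⇒m≤1+n p≤b) all≤
    ; complete = λ pr p≤1+b p∣N → [ (λ p<1+b → complete pr (≤-pred p<1+b) p∣N)
                                  , (λ p≡1+b → contradiction (subst (λ p → Prime p × p ∣ N) p≡1+b (pr , p∣N)) ¬q) ]′
                                  (m≤n⇒m<n∨m≡n p≤1+b) }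
    where open PrimeChain rest
  ... | rest | yes (qr , q∣N) = record
    { primes = suc b ∷ primes
    ; chain = extend primes chain all≤ (prime≥2 qr)
    ; all≤ = (qr , ≤-refl) ∷ All.map (λ (pr , p≤b) → pr , m≤n⇒m≤1+n p≤b) all≤
    ; product∣ = subst (_∣ N) lcm≡ (lcm-least q∣N product∣)
    ; complete = λ pr p≤1+b p∣N → [ (λ p<1+b → there (complete pr (≤-pred p<1+b) p∣N)) , here ]′ (m≤n⇒m<n∨m≡n p≤1+b) }
    where
    open PrimeChain rest
    coprime : gcd (suc b) (product primes) ≡ 1
    coprime = no-common-prime⇒gcd≡1 (suc b) (product primes) λ p pr p∣q p∣Π →
      prime∤product primes qr (All.map (λ (sr , s≤b) → sr , s≤s s≤b) all≤)
        (subst (_∣ product primes) (prime∣prime pr qr p∣q) p∣Π)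
    lcm≡ : lcm (suc b) (product primes) ≡ suc b * product primes
    lcm≡ = trans (sym (*-identityˡ _)) (trans (cong (_* lcm (suc b) (product primes)) (sym coprime))
      (gcd*lcm (suc b) (product primes)))
    below : ∀ {s} → Prime s × s ≤ b → 1 ≤ s × gcd (suc b) s ≡ 1 × s < suc b
    below (sr , s≤b) = 1≤s , coprime⇒gcd≡1 (prime⇒coprime qr {{>-nonZero 1≤s}} (s≤s s≤b)) , s≤s s≤b
      where 1≤s = ≤-trans (s≤s z≤n) (prime≥2 sr)
    extend : ∀ S → Chain S → All (λ p → Prime p × p ≤ b) S → 2 ≤ suc b → Chain (suc b ∷ S)
    extend []      chain all≤               (s≤s (s≤s {n = zero}  z≤n)) = [2]
    extend (s ∷ S) chain ((sr , s≤1) ∷ all≤) (s≤s (s≤s {n = zero} z≤n)) = contradiction (prime≥2 sr) (<⇒≱ (s≤s s≤1))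
    extend S       chain all≤               (s≤s (s≤s {n = suc n} z≤n)) =
      (s≤s (s≤s (s≤s z≤n)) , All.map below all≤) ∷ chain

  -- Powers of 2, 3 and p dividing C and E

  even-or-odd : ∀ n → ∃[ h ] (n ≡ h + h ⊎ n ≡ suc (h + h))
  even-or-odd zero = 0 , inj₁ refl
  even-or-odd (suc n) with even-or-odd n
  ... | h , inj₁ refl = h , inj₂ refl
  ... | h , inj₂ refl = suc h , inj₁ (cong suc (sym (+-suc h h)))

  prime-power-only : ∀ p k n → NonZero p → (∀ {ℓ} → Prime ℓ → ℓ ∣ n → ℓ ≡ p) → p ^ suc k ∤ n → n ∣ p ^ k
  prime-power-only p k n p≢0 only p^∤n with n ≟ 1
  ... | yes refl = 1∣ (p ^ k)
  ... | no n≢1 with prime-divisor n≢1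
  ... | ℓ , ℓr , ℓ∣n with only ℓr ℓ∣n
  prime-power-only p zero    n p≢0 only p^∤n | no _ | _ , _ , ℓ∣n | refl =
    contradiction (subst (_∣ n) (sym (*-identityʳ p)) ℓ∣n) p^∤n
  prime-power-only p (suc k) n p≢0 only p^∤n | no _ | _ , _ , divides m refl | refl =
    subst (_∣ p ^ suc k) (*-comm p m) (*-monoʳ-∣ p
      (prime-power-only p k m p≢0 (λ ℓr ℓ∣m → only ℓr (∣m⇒∣m*n p ℓ∣m))
        (λ d → p^∤n (subst (p ^ (2 + k) ∣_) (*-comm p m) (*-monoʳ-∣ p d)))))

  -- Squares are 0 or 1 modulo 4. For t = 2s this limits the power of 2 in 4 + C(1) = 4(1 + s²).
  even-square : ∀ s → 4 ∤ 1 + s * s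
  even-square s 4∣ with even-or-odd s
  ... | h , inj₁ refl = prime∤1 prime[2] (∣m+n∣m⇒∣n (subst (2 ∣_) (+-comm 1 (s * s)) (∣-trans (divides 2 refl) 4∣))
                          (∣m⇒∣m*n (h + h) (divides h (lemma h))))
    where
    lemma : ∀ h → h + h ≡ h * 2
    lemma = solve-∀
  ... | h , inj₂ refl = contradiction (∣⇒≤ (∣m+n∣m⇒∣n (subst (4 ∣_) (lemma h) 4∣) (m∣m*n (h * h + h)))) λ{ (s≤s (s≤s ())) }
    where
    lemma : ∀ h → 1 + suc (h + h) * suc (h + h) ≡ 4 * (h * h + h) + 2
    lemma = solve-∀

  private
    -- For odd t, c = t² ≡ 1 modulo 4, and the pair (E, e) runs modulo 4 through the cycle (0, 1),
    -- (1, 0), (1, 3). So E never is 2 or 3 modulo 4.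
    data State-mod4 (E e : ℕ) : Set where
      s₀ : ∀ x y → E ≡ 4 * x → e ≡ 4 * y + 1 → State-mod4 E e
      s₁ : ∀ x y → E ≡ 4 * x + 1 → e ≡ 4 * y → State-mod4 E e
      s₂ : ∀ x y → E ≡ 4 * x + 1 → e ≡ 4 * y + 3 → State-mod4 E e

    state-mod4 : ∀ u k → State-mod4 (E (4 * u + 1) k) (e (4 * u + 1) k)
    state-mod4 u zero = s₀ 0 0 refl refl
    state-mod4 u (suc k) with state-mod4 u k
    ... | s₀ x y p q = s₁ (x + y) (y + (u * (4 * (x + y) + 1) + (x + y)) + 1)
      (trans (cong₂ _+_ p q) (l₁ x y))
      (trans (cong₂ (λ E e → e + ((4 * u + 1) * (E + e) + 2)) p q) (l₂ u x y))
      where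
      l₁ : ∀ x y → 4 * x + (4 * y + 1) ≡ 4 * (x + y) + 1
      l₁ = solve-∀
      l₂ : ∀ u x y → 4 * y + 1 + ((4 * u + 1) * (4 * x + (4 * y + 1)) + 2) ≡
                     4 * (y + (u * (4 * (x + y) + 1) + (x + y)) + 1)
      l₂ = solve-∀
    ... | s₁ x y p q = s₂ (x + y) (y + (u * (4 * (x + y) + 1) + (x + y)))
      (trans (cong₂ _+_ p q) (l₁ x y))
      (trans (cong₂ (λ E e → e + ((4 * u + 1) * (E + e) + 2)) p q) (l₂ u x y))
      where
      l₁ : ∀ x y → 4 * x + 1 + (4 * y) ≡ 4 * (x + y) + 1
      l₁ = solve-∀
      l₂ : ∀ u x y → 4 * y + ((4 * u + 1) * (4 * x + 1 + (4 * y)) + 2) ≡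
                     4 * (y + (u * (4 * (x + y) + 1) + (x + y))) + 3
      l₂ = solve-∀
    ... | s₂ x y p q = s₀ (x + y + 1) (y + (4 * u + 1) * (x + y + 1) + 1)
      (trans (cong₂ _+_ p q) (l₁ x y))
      (trans (cong₂ (λ E e → e + ((4 * u + 1) * (E + e) + 2)) p q) (l₂ u x y))
      where
      l₁ : ∀ x y → 4 * x + 1 + (4 * y + 3) ≡ 4 * (x + y + 1)
      l₁ = solve-∀
      l₂ : ∀ u x y → 4 * y + 3 + ((4 * u + 1) * (4 * x + 1 + (4 * y + 3)) + 2) ≡
                     4 * (y + (4 * u + 1) * (x + y + 1) + 1) + 1
      l₂ = solve-∀

  C-mod4 : ∀ t k → ∃[ z ] (𝒞 (t * t) k ≡ 4 * z ⊎ 𝒞 (t * t) k ≡ 4 * z + 1)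
  C-mod4 t k with even-or-odd t
  ... | h , inj₁ refl = h * h * E ((h + h) * (h + h)) k , inj₁ (lemma h (E ((h + h) * (h + h)) k))
    where
    lemma : ∀ h x → (h + h) * (h + h) * x ≡ 4 * (h * h * x)
    lemma = solve-∀
  ... | h , inj₂ refl = subst (λ c → ∃[ z ] (𝒞 c k ≡ 4 * z ⊎ 𝒞 c k ≡ 4 * z + 1)) (sym (square h)) (go (state-mod4 u k))
    where
    u = h * h + h
    square : ∀ h → suc (h + h) * suc (h + h) ≡ 4 * (h * h + h) + 1
    square = solve-∀
    one : State-mod4 (E (4 * u + 1) k) (e (4 * u + 1) k) → ∃[ x ] (E (4 * u + 1) k ≡ 4 * x ⊎ E (4 * u + 1) k ≡ 4 * x + 1)
    one (s₀ x _ p _) = x , inj₁ p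
    one (s₁ x _ p _) = x , inj₂ p
    one (s₂ x _ p _) = x , inj₂ p
    l₀ : ∀ u x → (4 * u + 1) * (4 * x) ≡ 4 * ((4 * u + 1) * x)
    l₀ = solve-∀
    l₁ : ∀ u x → (4 * u + 1) * (4 * x + 1) ≡ 4 * ((4 * u + 1) * x + u) + 1
    l₁ = solve-∀
    go : State-mod4 (E (4 * u + 1) k) (e (4 * u + 1) k) → ∃[ z ] (𝒞 (4 * u + 1) k ≡ 4 * z ⊎ 𝒞 (4 * u + 1) k ≡ 4 * z + 1)
    go st with one st
    ... | x , inj₁ p = (4 * u + 1) * x , inj₁ (trans (cong ((4 * u + 1) *_) p) (l₀ u x))
    ... | x , inj₂ p = (4 * u + 1) * x + u , inj₂ (trans (cong ((4 * u + 1) *_) p) (l₁ u x))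

  2∣C⇒4∣C : ∀ t k → 2 ∣ 𝒞 (t * t) k → 4 ∣ 𝒞 (t * t) k
  2∣C⇒4∣C t k 2∣C with C-mod4 t k
  ... | z , inj₁ eq = divides z (trans eq (*-comm 4 z))
  ... | z , inj₂ eq = ⊥-elim (prime∤1 prime[2] (∣m+n∣m⇒∣n (subst (2 ∣_) eq 2∣C) (∣m⇒∣m*n z (divides 2 refl))))

  4∤1+C : ∀ t k → 4 ∤ 1 + 𝒞 (t * t) k
  4∤1+C t k 4∣ with C-mod4 t k
  ... | z , inj₁ eq = contradiction (∣⇒≤ (∣m+n∣m⇒∣n (subst (4 ∣_) (trans (cong suc eq) (+-comm 1 (4 * z))) 4∣) (m∣m*n z))) λ{ (s≤s ()) }
  ... | z , inj₂ eq = contradiction (∣⇒≤ (∣m+n∣m⇒∣n (subst (4 ∣_) (trans (cong suc eq) (lemma z)) 4∣) (m∣m*n z))) λ{ (s≤s (s≤s ())) }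
    where
    lemma : ∀ z → suc (4 * z + 1) ≡ 4 * z + 2
    lemma = solve-∀

  prime[3] : Prime 3
  prime[3] = from-yes (prime? 3)

  square-mod3 : ∀ t → 3 ∣ t ⊎ ∃[ u ] t * t ≡ 3 * u + 1
  square-mod3 0 = inj₁ (3 ∣0)
  square-mod3 1 = inj₂ (0 , refl)
  square-mod3 2 = inj₂ (1 , refl)
  square-mod3 (suc (suc (suc t))) with square-mod3 t
  ... | inj₁ d = inj₁ (∣m∣n⇒∣m+n ∣-refl d)
  ... | inj₂ (u , eq) = inj₂ (u + (2 * t + 3) , trans (l₁ t) (trans (cong (_+ 3 * (2 * t + 3)) eq) (l₂ u t)))
    where
    l₁ : ∀ t → (3 + t) * (3 + t) ≡ t * t + 3 * (2 * t + 3)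
    l₁ = solve-∀
    l₂ : ∀ u t → 3 * u + 1 + 3 * (2 * t + 3) ≡ 3 * (u + (2 * t + 3)) + 1
    l₂ = solve-∀

  C-double : ∀ c k → 𝒞 c (2 * k) ≡ 𝒞 c k * (4 + 𝒞 c k)
  C-double c k = trans (C-compose c k 2) (C-two (𝒞 c k))

  divisor-of-4 : ∀ g → g ∣ 4 → g ≡ 1 ⊎ g ≡ 2 ⊎ g ≡ 4
  divisor-of-4 0 d = contradiction (0∣⇒≡0 d) λ()
  divisor-of-4 1 d = inj₁ refl
  divisor-of-4 2 d = inj₂ (inj₁ refl)
  divisor-of-4 3 d = contradiction (prime∣prime prime[3] prime[2] (prime∣square 2 prime[3] d)) λ()
  divisor-of-4 4 d = inj₂ (inj₂ refl)
  divisor-of-4 (suc (suc (suc (suc (suc g))))) d = contradiction (∣⇒≤ d) λ{ (s≤s (s≤s (s≤s (s≤s ())))) }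

  -- If 3 does not divide t, then c ≡ 1 modulo 3, neither C(1) nor C(2) = c(4 + c) is divisible by
  -- 3, and the first multiple of 3 comes from C(4) = C(2)(2 + c)², which contains 9. It supplies
  -- the extra condition of `p³∤E` at p = 3.
  3∣C⇒9∣C : ∀ t k → 3 ∣ 𝒞 (t * t) k → 9 ∣ 𝒞 (t * t) k
  3∣C⇒9∣C t k 3∣C with square-mod3 t
  ... | inj₁ 3∣t = ∣m⇒∣m*n (E (t * t) k) (*-pres-∣ 3∣t 3∣t)
  ... | inj₂ (u , eq) = [ (λ g≡1 → ⊥-elim (3∤c (subst (3 ∣_) (trans (cong (𝒞 c) g≡1) (C-one c)) 3∣g)))
                        , [ (λ g≡2 → ⊥-elim ([ 3∤c , 3∤4+c ]′ (euclidsLemma c (4 + c) prime[3]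
                                       (subst (3 ∣_) (trans (cong (𝒞 c) g≡2) (C-two c)) 3∣g))))
                          , (λ g≡4 → ∣-trans 9∣C4 (C-mono-∣ c (subst (_∣ k) g≡4 (gcd[m,n]∣m k 4)))) ]′ ]′
                        (divisor-of-4 (gcd k 4) (gcd[m,n]∣n k 4))
    where
    c = t * t
    2+c : 3 ∣ 2 + c
    2+c = divides (u + 1) (trans (cong (2 +_) eq) (lemma u))
      where
      lemma : ∀ u → 2 + (3 * u + 1) ≡ (u + 1) * 3
      lemma = solve-∀
    3∤c : 3 ∤ c
    3∤c d = prime∤1 prime[3] (∣m+n∣m⇒∣n (subst (3 ∣_) eq d) (m∣m*n u))
    3∤4+c : 3 ∤ 4 + c
    3∤4+c d = contradiction (∣⇒≤ (∣m+n∣m⇒∣n (subst (3 ∣_) (+-comm 2 (2 + c)) d) 2+c)) λ{ (s≤s (s≤s ())) }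
    9∣C4 : 9 ∣ 𝒞 c 4
    9∣C4 = subst (9 ∣_) (sym (trans (C-double c 2) (cong (λ x → x * (4 + x)) (C-two c))))
      (∣n⇒∣m*n (c * (4 + c)) (subst (9 ∣_) (lemma c) (*-pres-∣ 2+c 2+c)))
      where
      lemma : ∀ c → (2 + c) * (2 + c) ≡ 4 + c * (4 + c)
      lemma = solve-∀
    3∣g : 3 ∣ 𝒞 c (gcd k 4)
    3∣g = prime-∣-C-gcd c k 4 prime[3] 3∣C (∣-trans (divides 3 refl) 9∣C4)

  p³∣m²⇒p²∣m : ∀ {p} m → Prime p → p ^ 3 ∣ m * m → p * p ∣ m
  p³∣m²⇒p²∣m {p} m pr p³∣ with prime∣square m pr (∣-trans (m∣m*n (p ^ 2)) p³∣)
  ... | divides f refl = subst (p * p ∣_) (*-comm p f) (*-monoʳ-∣ p (prime∣square f pr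
    (*-cancelˡ-∣ (p * p) {{m*n≢0 p p {{prime⇒nonZero pr}} {{prime⇒nonZero pr}}}} (subst₂ _∣_ (l₁ p) (l₂ f p) p³∣))))
    where
    l₁ : ∀ p → p * (p * (p * 1)) ≡ p * p * p
    l₁ = solve-∀
    l₂ : ∀ f p → f * p * (f * p) ≡ p * p * (f * f)
    l₂ = solve-∀

  -- For p = 2h + 1, E(p) = e(h)², so p³ would force p² to divide e(h), and the expansion of 6e(h)
  -- modulo c² leaves p² dividing 6p. This excludes p > 3; for p = 3, e(1) = 3 + c is not divisible
  -- by 9 when c is.
  p³∤E : ∀ {p} c → Prime p → p ≢ 2 → p ∣ c → (p ≡ 3 → 9 ∣ c) → p ^ 3 ∤ E c p
  p³∤E {p} c pr p≢2 p∣c 3-case p³∣E with even-or-odd p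
  ... | h , inj₁ eq = p≢2 (sym (prime∣prime prime[2] pr (divides h (trans eq (lemma h)))))
    where
    lemma : ∀ h → h + h ≡ h * 2
    lemma = solve-∀
  ... | h , inj₂ refl with p³∣m²⇒p²∣m (e c h) pr (subst (p ^ 3 ∣_) (E-odd c h) p³∣E) | e-mod-c² c h
  ... | p²∣e | w , eq = go ((p ≟ 3))
    where
    p²∣6p : p * p ∣ p * 6
    p²∣6p = ∣m+n∣m⇒∣n (subst (p * p ∣_) (trans eq (lemma c h w)) (∣n⇒∣m*n 6 p²∣e))
      (∣m∣n⇒∣m+n (∣n⇒∣m*n (h * (h + 1)) (*-pres-∣ p∣c ∣-refl)) (∣m⇒∣m*n w (*-pres-∣ p∣c p∣c)))
      where
      lemma : ∀ c h w → 6 * (2 * h + 1) + c * (h * (h + 1) * (2 * h + 1)) + c * c * w ≡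
                        h * (h + 1) * (c * suc (h + h)) + c * c * w + suc (h + h) * 6
      lemma = solve-∀
    p∣6 : p ∣ 6
    p∣6 = *-cancelˡ-∣ p p²∣6p
    go : Dec (p ≡ 3) → ⊥
    half : ∀ h → suc (h + h) ≡ 3 → h ≡ 1
    half 1 eq = refl
    half (suc (suc h)) eq = contradiction (suc-injective (suc-injective (suc-injective eq))) (m+1+n≢0 h)
    go (yes p≡3) = contradiction (∣⇒≤ (∣m+n∣m⇒∣n 9∣e (3-case p≡3))) λ{ (s≤s (s≤s (s≤s ()))) }
      where
      lemma : ∀ c → 1 + (c * 1 + 2) ≡ c + 3
      lemma = solve-∀
      9∣e : 9 ∣ c + 3
      9∣e = subst (9 ∣_) (lemma c)
        (subst₂ (λ n k → n * n ∣ e c k) p≡3 (half h p≡3) p²∣e)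
    go (no p≢3) = [ (λ d → p≢2 (prime∣prime pr prime[2] d)) , (λ d → p≢3 (prime∣prime pr prime[3] d)) ]′
      (euclidsLemma 2 3 pr p∣6)

  -- Primitive primes of C(N) and the quotient A

  Primitive : ℕ → ℕ → ℕ → Set
  Primitive c N p = Prime p × p ∣ 𝒞 c N × (∀ {j} → j < N → 1 ≤ j → p ∤ 𝒞 c j)

  primitive? : ∀ c N p → Dec (Primitive c N p)
  primitive? c N p =
    prime? p ×-dec (p ∣? 𝒞 c N) ×-dec allUpTo? (λ j → (1 ≤? j) →-dec ¬? (p ∣? 𝒞 c j)) N

  factor≥1 : ∀ {N} a b → 1 ≤ N → a * b ≡ N → 1 ≤ b
  factor≥1 a zero    1≤N eq = contradiction (subst (1 ≤_) (trans (sym eq) (*-zeroʳ a)) 1≤N) λ()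
  factor≥1 a (suc b) 1≤N eq = s≤s z≤n

  -- If ℓ divides C(j) with j < N, it divides C(g) for g = gcd(N, j), a proper divisor of N. For a
  -- prime q dividing N/g, the index N/q is a multiple of g.
  imprimitive⇒divides-C[N/q] : ∀ c N {ℓ} → 1 ≤ N → Prime ℓ → ℓ ∣ 𝒞 c N → ¬ Primitive c N ℓ →
    ∃[ q ] ∃[ k ] (Prime q × N ≡ q * k × ℓ ∣ 𝒞 c k)
  imprimitive⇒divides-C[N/q] c N {ℓ} 1≤N ℓr ℓ∣N ¬prim
    with anyUpTo? (λ j → (1 ≤? j) ×-dec (ℓ ∣? 𝒞 c j)) N
  ... | no none = contradiction (ℓr , ℓ∣N , λ {j} j<N 1≤j ℓ∣j → none (j , j<N , 1≤j , ℓ∣j)) ¬prim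
  ... | yes (j , j<N , 1≤j , ℓ∣j) = go (gcd[m,n]∣m N j)
    where
    g = gcd N j
    go : g ∣ N → _
    go (divides m N≡) with prime-divisor m≢1
      where
      m≢1 : m ≢ 1
      m≢1 refl = <⇒≱ j<N (subst (_≤ j) (sym (trans N≡ (*-identityˡ g))) (gcd[m,n]≤n N j {{>-nonZero 1≤j}}))
    ... | q , qr , divides m′ m≡ = q , m′ * g , qr , trans N≡ (trans (cong (_* g) m≡) (lemma m′ q g)) ,
      ∣-trans (prime-∣-C-gcd c N j ℓr ℓ∣N ℓ∣j) (C-∣ c g m′)
      where
      lemma : ∀ m q g → m * q * g ≡ q * (m * g)
      lemma = solve-∀

  quotient-∣-E : ∀ c N S a A {q k} → 1 ≤ c → 1 ≤ N → product S * a ≡ N → A * lcmC c S a ≡ 𝒞 c N →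
                 Prime q → q ∈ S → N ≡ q * k → A ∣ E (𝒞 c k) q
  quotient-∣-E c N S a A {q} {k} 1≤c 1≤N eqN eqA qr q∈S N≡
    with ∣-lcmC c S a k (prime⇒nonZero qr) q∈S (trans eqN N≡)
  ... | divides x l≡ = divides x (sym (*-cancelʳ-≡ (x * A) (E d q) d {{>-nonZero 1≤d}} (begin
    x * A * d             ≡⟨ lemma x A d ⟩
    A * (x * d)           ≡⟨ cong (A *_) l≡ ⟨
    A * lcmC c S a        ≡⟨ eqA ⟩
    𝒞 c N                 ≡⟨ cong (𝒞 c) N≡ ⟩
    𝒞 c (q * k)           ≡⟨ C-compose c k q ⟩
    d * E d q             ≡⟨ *-comm d (E d q) ⟩
    E d q * d             ∎)))
    where
    open ≡-Reasoning
    d = 𝒞 c k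
    1≤d : 1 ≤ d
    1≤d = C≥1 1≤c (factor≥1 q k 1≤N (sym N≡))
    lemma : ∀ x A d → x * A * d ≡ A * (x * d)
    lemma = solve-∀

  -- The lower bound of `lcmC-bounds` for `q ∷ S` is void when C(a) = 1. Hence only the factors
  -- coming from `S` are estimated, and C(qa) is kept exact.
  quotient-bound : ∀ c q S a A → 1 ≤ c → 1 ≤ a → 1 ≤ q → Chain (q ∷ S) → Chain S →
    All (λ s → 1 ≤ s × gcd q s ≡ 1 × s < q) S →
    A * lcmC c (q ∷ S) a ≡ 𝒞 c (product (q ∷ S) * a) →
    𝒞 c (q * a) ^ φ S ≤ A * (4 + 𝒞 c a) ^ φ S
  quotient-bound c q S a A 1≤c 1≤a 1≤q chainq chain coprimes eqA =
    *-cancelʳ-≤ _ _ (l * l₀) {{>-nonZero (*-mono-≤ (lcmC≥1 c (q ∷ S) a 1≤c 1≤a chainq) (lcmC≥1 c S a 1≤c 1≤a chain))}} (begin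
      d′ ^ f * (l * l₀)               ≡⟨ cong (d′ ^ f *_) ll₀ ⟩
      d′ ^ f * (l₁ * N₀)              ≡⟨ *-assoc (d′ ^ f) l₁ N₀ ⟨
      d′ ^ f * l₁ * N₀                ≤⟨ *-mono-≤ (proj₁ (lcmC-bounds c S (q * a) 1≤c (*-mono-≤ 1≤q 1≤a) chain))
                                                 (proj₂ (lcmC-bounds c S a 1≤c 1≤a chain)) ⟩
      𝒞 c (product S * (q * a)) * ((4 + d) ^ f * l₀)
                                      ≡⟨ cong (λ k → 𝒞 c k * ((4 + d) ^ f * l₀)) (index q (product S) a) ⟩
      𝒞 c (q * product S * a) * ((4 + d) ^ f * l₀)
                                      ≡⟨ cong (_* ((4 + d) ^ f * l₀)) eqA ⟨
      A * l * ((4 + d) ^ f * l₀)      ≡⟨ shuffle A l ((4 + d) ^ f) l₀ ⟩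
      A * (4 + d) ^ f * (l * l₀)      ∎)
    where
    open ≤-Reasoning
    d = 𝒞 c a
    d′ = 𝒞 c (q * a)
    f = φ S
    l = lcmC c (q ∷ S) a
    l₀ = lcmC c S a
    l₁ = lcmC c S (q * a)
    N₀ = 𝒞 c (product S * a)
    ll₀ : l * l₀ ≡ l₁ * N₀
    ll₀ = lcmC-step c q S a 1≤c 1≤a coprimes (chain⇒product≥1 chain)
    index : ∀ q Π a → Π * (q * a) ≡ q * Π * a
    index = solve-∀
    shuffle : ∀ x l y k → x * l * (y * k) ≡ x * y * (l * k)
    shuffle = solve-∀

  -- For y > 0, A ≥ (x/y)^f ≥ x/y > K, because x/y exceeds K ≥ 1. For y = 0 the hypothesis would
  -- make x^f zero.
  power-bound : ∀ f K x y A → 1 ≤ f → 1 ≤ K → K * y < x → x ^ f ≤ A * y ^ f → K < A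
  power-bound (suc f) K x zero A 1≤f 1≤K Ky<x h = contradiction
    (≤-trans (m^n>0 x {{>-nonZero (≤-trans (s≤s z≤n) Ky<x)}} (suc f)) (≤-trans h (≤-reflexive (*-zeroʳ A)))) λ()
  power-bound (suc f) K x y@(suc _) A 1≤f 1≤K Ky<x h = ≰⇒> λ A≤K → <⇒≱ (begin-strict
    A * y ^ suc f         ≤⟨ *-monoˡ-≤ (y ^ suc f) A≤K ⟩
    K * (y * y ^ f)       ≡⟨ *-assoc K y (y ^ f) ⟨
    K * y * y ^ f         <⟨ *-monoˡ-< (y ^ f) {{m^n≢0 y f}} Ky<x ⟩
    x * y ^ f             ≤⟨ *-monoʳ-≤ x (^-monoˡ-≤ f (≤-trans (m≤n*m y K {{>-nonZero 1≤K}}) (<⇒≤ Ky<x))) ⟩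
    x ^ suc f             ∎) h
    where open ≤-Reasoning

  square<4^ : ∀ r → (3 + r) * (3 + r) < 4 ^ (2 + r)
  square<4^ zero    = from-yes (10 ≤? 16)
  square<4^ (suc r) = begin-strict
    (4 + r) * (4 + r)             ≤⟨ m≤m+n _ (20 + 16 * r + 3 * (r * r)) ⟩
    (4 + r) * (4 + r) + (20 + 16 * r + 3 * (r * r)) ≡⟨ lemma r ⟩
    4 * ((3 + r) * (3 + r))       <⟨ *-monoʳ-< 4 (square<4^ r) ⟩
    4 ^ (3 + r)                   ∎
    where
    open ≤-Reasoning
    lemma : ∀ r → (4 + r) * (4 + r) + (20 + 16 * r + 3 * (r * r)) ≡ 4 * ((3 + r) * (3 + r))
    lemma = solve-∀

  -- The factor 5 is 4 + C(1) for t = 1. The prime 5 just fails, as 25 · 5 = 125 exceeds C(5) = 121.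
  5*square<C : ∀ r → (7 + r) * (7 + r) * 5 < 𝒞 1 (7 + r)
  5*square<C zero    = from-yes (246 ≤? 841)
  5*square<C (suc r) = begin-strict
    (8 + r) * (8 + r) * 5                 ≤⟨ m≤m+n _ (170 + 60 * r + 5 * (r * r)) ⟩
    (8 + r) * (8 + r) * 5 + (170 + 60 * r + 5 * (r * r)) ≡⟨ lemma r ⟩
    2 * ((7 + r) * (7 + r) * 5)           <⟨ *-monoʳ-< 2 (5*square<C r) ⟩
    2 * 𝒞 1 (7 + r)                       ≤⟨ double ⟩
    𝒞 1 (8 + r)                           ∎
    where
    open ≤-Reasoning
    lemma : ∀ r → (8 + r) * (8 + r) * 5 + (170 + 60 * r + 5 * (r * r)) ≡ 2 * ((7 + r) * (7 + r) * 5)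
    lemma = solve-∀
    x = 𝒞 1 (7 + r)
    y = 𝒞 1 (6 + r)
    double : 2 * x ≤ 𝒞 1 (8 + r)
    double = +-cancelʳ-≤ y (2 * x) (𝒞 1 (8 + r)) (begin
      2 * x + y             ≤⟨ +-monoʳ-≤ (2 * x) (C-mono 1 (n≤1+n (6 + r))) ⟩
      2 * x + x             ≡⟨ +-comm (2 * x) x ⟩
      3 * x                 ≤⟨ m≤m+n (3 * x) 2 ⟩
      3 * x + 2             ≡⟨ C-rec 1 (6 + r) ⟨
      𝒞 1 (8 + r) + y       ∎)

  C-dichotomy : ∀ t a → 1 ≤ t → 1 ≤ a → 4 ≤ 𝒞 (t * t) a ⊎ (t ≡ 1 × a ≡ 1)
  C-dichotomy 1 1 1≤t 1≤a = inj₂ (refl , refl)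
  C-dichotomy 1 (suc (suc a)) 1≤t 1≤a = inj₁ (≤-trans (n≤1+n 4) (C-mono 1 {2} {2 + a} (s≤s (s≤s z≤n))))
  C-dichotomy (suc (suc t)) a 1≤t 1≤a = inj₁ (≤-trans (*-mono-≤ {2} {2 + t} (s≤s (s≤s z≤n)) (s≤s (s≤s z≤n)))
    (≤-trans (≤-reflexive (sym (C-one ((2 + t) * (2 + t))))) (C-mono ((2 + t) * (2 + t)) 1≤a)))

  C≡5 : ∀ t a → 1 ≤ t → 1 ≤ a → 𝒞 (t * t) a ≡ 5 → t ≡ 1 × a ≡ 2
  C≡5 1 2 1≤t 1≤a eq = refl , refl
  C≡5 1 (suc (suc (suc a))) 1≤t 1≤a eq = contradiction (subst (16 ≤_) eq (C-mono 1 {3} {3 + a} (s≤s (s≤s (s≤s z≤n))))) (from-no (16 ≤? 5))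
  C≡5 2 (suc (suc a)) 1≤t 1≤a eq = contradiction (subst (32 ≤_) eq (C-mono 4 {2} {2 + a} (s≤s (s≤s z≤n)))) (from-no (32 ≤? 5))
  C≡5 (suc (suc (suc t))) a 1≤t 1≤a eq = contradiction (subst (9 ≤_) eq
    (≤-trans (*-mono-≤ {3} {3 + t} (s≤s (s≤s (s≤s z≤n))) (s≤s (s≤s (s≤s z≤n))))
      (≤-trans (≤-reflexive (sym (C-one ((3 + t) * (3 + t))))) (C-mono ((3 + t) * (3 + t)) 1≤a)))) (from-no (9 ≤? 5))

  -- For t = 1 the values are C(1) = 1, C(6) = 320, C(10) = 15125 and C(12) = 103680. Their primes
  -- occur earlier: 5 in C(2), 2 in C(3) = 16, 3 in C(4) = 45, 11 in C(5) = 121. For t = 2, C(2) =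
  -- 32 and C(1) = 4.
  Exceptional : ℕ → ℕ → Set
  Exceptional t N = (t ≡ 1 × (N ≡ 1 ⊎ N ≡ 6 ⊎ N ≡ 10 ⊎ N ≡ 12)) ⊎ (t ≡ 2 × N ≡ 2)

  -- The situation to be refuted, with `P ∷ S` the primes dividing N and `a` the quotient of N by
  -- its radical.
  record Obstruction (t N P a A : ℕ) (S : List ℕ) : Set where
    field
      1≤t         : 1 ≤ t
      1<N         : 1 < N
      regular     : ¬ Exceptional t N
      noPrimitive : ∀ p → ¬ Primitive (t * t) N p
      index       : product (P ∷ S) * a ≡ N
      primeP      : Prime P
      primes      : All Prime S
      complete    : ∀ {p} → Prime p → p ∣ N → p ∈ P ∷ S
      lcmC-quotient    : A * lcmC (t * t) (P ∷ S) a ≡ 𝒞 (t * t) N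
      largest     : ∀ {p} → Prime p → p ∣ N → p ≤ P

    c = t * t
    1≤c : 1 ≤ c
    1≤c = *-mono-≤ 1≤t 1≤t
    1≤N : 1 ≤ N
    1≤N = <⇒≤ 1<N
    1≤a : 1 ≤ a
    1≤a = factor≥1 (product (P ∷ S)) a 1≤N index
    P∣N : P ∣ N
    P∣N = divides (product S * a) (trans (sym index) (lemma P (product S) a))
      where
      lemma : ∀ P Π a → P * Π * a ≡ Π * a * P
      lemma = solve-∀
    A∣CN : A ∣ 𝒞 c N
    A∣CN = subst (A ∣_) lcmC-quotient (m∣m*n (lcmC c (P ∷ S) a))
    A∣E : ∀ {q k} → Prime q → N ≡ q * k → A ∣ E (𝒞 c k) q
    A∣E {q} {k} qr N≡ = quotient-∣-E c N (P ∷ S) a A 1≤c 1≤N index lcmC-quotient qr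
      (complete qr (divides k (trans N≡ (*-comm q k)))) N≡
    unique : ∀ {ℓ q k} → Prime ℓ → ℓ ∣ A → Prime q → N ≡ q * k → ℓ ∣ 𝒞 c k → ℓ ≡ q
    unique {ℓ} {q} {k} ℓr ℓ∣A qr N≡ ℓ∣k =
      prime∣prime ℓr qr (prime-∣-E⇒∣index (𝒞 c k) q ℓr ℓ∣k (∣-trans ℓ∣A (A∣E qr N≡)))
    factor : ∀ {ℓ} → Prime ℓ → ℓ ∣ A → ∃[ k ] (N ≡ ℓ * k × ℓ ∣ 𝒞 c k)
    factor {ℓ} ℓr ℓ∣A with imprimitive⇒divides-C[N/q] c N 1≤N ℓr (∣-trans ℓ∣A A∣CN) (noPrimitive ℓ)
    ... | q , k , qr , N≡ , ℓ∣k = k , trans N≡ (cong (_* k) (sym (unique ℓr ℓ∣A qr N≡ ℓ∣k))) , ℓ∣k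
    factor∣N : ∀ {ℓ} → Prime ℓ → ℓ ∣ A → ℓ ∣ N
    factor∣N {ℓ} ℓr ℓ∣A = let k , N≡ , _ = factor ℓr ℓ∣A in divides k (trans N≡ (*-comm ℓ k))
    p³∤A : ∀ {p} → Prime p → p ≢ 2 → p ^ 3 ∤ A
    p³∤A {p} pr p≢2 p³∣A =
      let k , N≡ , p∣k = factor pr (∣-trans (m∣m*n (p ^ 2)) p³∣A)
      in p³∤E (𝒞 c k) pr p≢2 p∣k (λ p≡3 → 3∣C⇒9∣C t k (subst (_∣ 𝒞 c k) p≡3 p∣k)) (∣-trans p³∣A (A∣E pr N≡))

    -- ℓ divides C(ℓ ± 1), hence C(gcd N (ℓ ± 1)), whereas it cannot divide
    -- C(N / P) unless ℓ = P.  So P divides ℓ ± 1.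
    factors : ∀ {ℓ} → Prime ℓ → ℓ ∣ A → ℓ ≡ P ⊎ (ℓ ≡ 2 × P ≡ 3)
    factors {ℓ} ℓr ℓ∣A with ℓ ≟ P
    ... | yes ℓ≡P = inj₁ ℓ≡P
    ... | no ℓ≢P with prime-∣-C[p±1] c (pred N) ℓr (subst (λ n → ℓ ∣ 𝒞 c n) (sym (suc-pred N {{>-nonZero 1≤N}})) (∣-trans ℓ∣A A∣CN))
    ... | m , m≡ , ℓ∣m = inj₂ (consecutive m≡ P∣m)
      where
      ℓ<P : ℓ < P
      ℓ<P = ≤∧≢⇒< (largest ℓr (factor∣N ℓr ℓ∣A)) ℓ≢P
      P∣m : P ∣ m
      P∣m with P ∣? m
      ... | yes P∣m = P∣m
      ... | no P∤m with P∣N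
      ... | divides k N≡ = ⊥-elim (ℓ≢P (unique ℓr ℓ∣A primeP (trans N≡ (*-comm k P))
        (∣-trans (prime-∣-C-gcd c N m ℓr (∣-trans ℓ∣A A∣CN) ℓ∣m) (C-mono-∣ c g∣k))))
        where
        g∣k : gcd N m ∣ k
        g∣k = coprime-divisor {gcd N m} {P} {k}
          (gcd≡1⇒coprime (no-common-prime⇒gcd≡1 (gcd N m) P λ p pr p∣g p∣P →
            P∤m (subst (_∣ m) (prime∣prime pr primeP p∣P) (∣-trans p∣g (gcd[m,n]∣n N m)))))
          (subst (gcd N m ∣_) (trans N≡ (*-comm k P)) (gcd[m,n]∣m N m))
      consecutive : suc m ≡ ℓ ⊎ m ≡ suc ℓ → P ∣ m → ℓ ≡ 2 × P ≡ 3
      consecutive (inj₁ refl) P∣m = contradiction (∣⇒≤ {{>-nonZero (≤-pred (prime≥2 ℓr))}} P∣m) (<⇒≱ (<-trans (n<1+n m) ℓ<P))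
      consecutive (inj₂ refl) P∣m = parity (euclidsLemma ℓ (suc ℓ) prime[2] (2∣m[1+m] ℓ))
        where
        P≡ : P ≡ suc ℓ
        P≡ = ≤-antisym (∣⇒≤ P∣m) ℓ<P
        parity : 2 ∣ ℓ ⊎ 2 ∣ suc ℓ → ℓ ≡ 2 × P ≡ 3
        parity (inj₁ 2∣ℓ) = sym ℓ≡ , trans P≡ (cong suc (sym ℓ≡))
          where ℓ≡ = prime∣prime prime[2] ℓr 2∣ℓ
        parity (inj₂ 2∣P) = contradiction (prime≥2 ℓr)
          (subst (λ x → ¬ 2 ≤ x) (suc-injective (prime∣prime prime[2] (subst Prime P≡ primeP) 2∣P)) (from-no (2 ≤? 1)))

  -- Refuting obstructions according to the primes dividing N

  -- Here A = 4 + C(a).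
  no-[2]-obstruction : ∀ {t N a A} → ¬ Obstruction t N 2 a A []
  no-[2]-obstruction {t} {N} {a} {A} o = go (a ≟ 1)
    where
    open Obstruction o
    d = 𝒞 c a
    N≡2a : N ≡ 2 * a
    N≡2a = sym index
    A≡ : A ≡ 4 + d
    A≡ = *-cancelˡ-≡ A (4 + d) d {{>-nonZero (C≥1 1≤c 1≤a)}} (begin
      d * A                   ≡⟨ *-comm d A ⟩
      A * d                   ≡⟨ cong (A *_) lcm≡ ⟨
      A * lcmC c (2 ∷ []) a   ≡⟨ lcmC-quotient ⟩
      𝒞 c N                   ≡⟨ cong (𝒞 c) N≡2a ⟩
      𝒞 c (2 * a)             ≡⟨ C-double c a ⟩
      d * (4 + d)             ∎)
      where
      open ≡-Reasoning
      lcm≡ : lcmC c (2 ∷ []) a ≡ d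
      lcm≡ = lcmC-[2] c a
    only2 : ∀ {ℓ} → Prime ℓ → ℓ ∣ 4 + d → ℓ ≡ 2
    only2 ℓr ℓ∣ with factors ℓr (subst (_ ∣_) (sym A≡) ℓ∣)
    ... | inj₁ ℓ≡2 = ℓ≡2
    2∣d : 2 ∣ d
    2∣d with prime-divisor {4 + d} (λ ())
    ... | ℓ , ℓr , ℓ∣ with only2 ℓr ℓ∣
    ... | refl = ∣m+n∣m⇒∣n ℓ∣ (divides 2 refl)
    go : Dec (a ≡ 1) → ⊥
    -- N = 2. Then t = 2s, and 4 + C(1) = 4(1 + s²) is a power of 2 not divisible by 16, hence at
    -- most 8. This leaves s = 1, the exception t = 2.
    go (yes refl) with subst (2 ∣_) (C-one c) 2∣d
    ... | 2∣tt with prime∣square t prime[2] 2∣tt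
    ... | divides zero    t≡0  = contradiction (subst (1 ≤_) t≡0 1≤t) λ()
    ... | divides 1       t≡2  = regular (inj₂ (t≡2 , N≡2a))
    ... | divides (suc (suc s)) t≡ = contradiction
      (∣⇒≤ (prime-power-only 2 3 (4 + d) _ only2 (λ h → even-square (2 + s) (*-cancelˡ-∣ 4 (subst (16 ∣_) eq h)))))
      (<⇒≱ (begin-strict
        8                 <⟨ from-yes (9 ≤? 20) ⟩
        20                ≤⟨ m≤m+n 20 (4 * s * s + 16 * s) ⟩
        20 + (4 * s * s + 16 * s) ≡⟨ lemma s ⟩
        4 * (1 + (2 + s) * (2 + s)) ≡⟨ eq ⟨
        4 + d             ∎))
      where
      open ≤-Reasoning
      lemma′ : ∀ s → 4 + (2 + s) * 2 * ((2 + s) * 2) ≡ 4 * (1 + (2 + s) * (2 + s))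
      lemma′ = solve-∀
      eq : 4 + d ≡ 4 * (1 + (2 + s) * (2 + s))
      eq = trans (cong (4 +_) (trans (C-one c) (cong (λ x → x * x) t≡))) (lemma′ s)
      lemma : ∀ s → 20 + (4 * s * s + 16 * s) ≡ 4 * (1 + (2 + s) * (2 + s))
      lemma = solve-∀
    -- N is a power of 2 and a = 2b, so C(a) = C(b)(4 + C(b)) is divisible by 16. Then 4 + C(a) is a
    -- power of 2 not divisible by 8, yet larger than 4.
    go (no a≢1) with prime-divisor a≢1
    ... | q , qr , q∣a with complete qr (∣-trans q∣a (divides 2 N≡2a))
    ... | here refl with q∣a
    ... | divides b a≡ = contradiction
      (∣⇒≤ (prime-power-only 2 2 (4 + d) _ only2 (λ 8∣ → contradiction
        (∣⇒≤ (∣m+n∣m⇒∣n (subst (8 ∣_) (+-comm 4 d) 8∣) (∣-trans (divides 2 refl) 16∣d))) (from-no (8 ≤? 4)))))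
      (<⇒≱ (m<m+n 4 (C≥1 1≤c 1≤a)))
      where
      d≡ : d ≡ 𝒞 c b * (4 + 𝒞 c b)
      d≡ = trans (cong (𝒞 c) (trans a≡ (*-comm b 2))) (C-double c b)
      2∣Cb : 2 ∣ 𝒞 c b
      2∣Cb with euclidsLemma (𝒞 c b) (4 + 𝒞 c b) prime[2] (subst (2 ∣_) d≡ 2∣d)
      ... | inj₁ h = h
      ... | inj₂ h = ∣m+n∣m⇒∣n h (divides 2 refl)
      16∣d : 16 ∣ d
      16∣d = subst (16 ∣_) (sym d≡) (*-pres-∣ 4∣ (∣m∣n⇒∣m+n ∣-refl 4∣))
        where 4∣ = 2∣C⇒4∣C t b 2∣Cb

  -- Here A = (1 + C(a))².
  no-[3,2]-obstruction : ∀ {t N a A} → ¬ Obstruction t N 3 a A (2 ∷ [])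
  no-[3,2]-obstruction {t} {N} {a} {A} o = [ large , (λ (t≡1 , a≡1) → regular (inj₁ (t≡1 , inj₂ (inj₁ (trans N≡6a (cong (6 *_) a≡1)))))) ]′
                                           (C-dichotomy t a 1≤t 1≤a)
    where
    open Obstruction o
    open ≡-Reasoning
    d = 𝒞 c a
    B = 1 + d
    d₃ = 𝒞 c (3 * a)
    N≡6a : N ≡ 6 * a
    N≡6a = sym index
    d₃≡ : d₃ ≡ d * ((3 + d) * (3 + d))
    d₃≡ = trans (C-compose c a 3) (C-three d)
    1≤d : 1 ≤ d
    1≤d = C≥1 1≤c 1≤a
    instance
      d≢0 : NonZero d
      d≢0 = >-nonZero 1≤d
      d₃≢0 : NonZero d₃
      d₃≢0 = >-nonZero (C≥1 1≤c (*-mono-≤ {1} {3} (s≤s z≤n) 1≤a))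
    -- C(6a) = d₃(4 + d₃) with d₃ = d(3 + d)², and 4 + d(3 + d)² = (4 + d)(1 + d)².
    A≡ : A ≡ B * B
    A≡ = *-cancelʳ-≡ A (B * B) (4 + d) (*-cancelʳ-≡ (A * (4 + d)) (B * B * (4 + d)) (d₃ * d) {{m*n≢0 d₃ d}} (begin
      A * (4 + d) * (d₃ * d)          ≡⟨ l₁ A d d₃ ⟩
      A * (d₃ * (d * (4 + d)))        ≡⟨ cong (λ x → A * (d₃ * x)) (C-double c a) ⟨
      A * (d₃ * 𝒞 c (2 * a))          ≡⟨ cong (λ l → A * (l * 𝒞 c (2 * a))) (lcmC-[2] c (3 * a)) ⟨
      A * (lcmC c (2 ∷ []) (3 * a) * 𝒞 c (2 * a))
        ≡⟨ cong (A *_) (lcmC-step c 3 (2 ∷ []) a 1≤c 1≤a ((s≤s z≤n , refl , ≤-refl) ∷ []) (s≤s z≤n)) ⟨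
      A * (l * lcmC c (2 ∷ []) a)     ≡⟨ *-assoc A l _ ⟨
      A * l * lcmC c (2 ∷ []) a       ≡⟨ cong₂ _*_ (trans lcmC-quotient (cong (𝒞 c) N≡2[3a])) (lcmC-[2] c a) ⟩
      𝒞 c (2 * (3 * a)) * d           ≡⟨ cong (_* d) (C-double c (3 * a)) ⟩
      d₃ * (4 + d₃) * d               ≡⟨ cong (λ x → d₃ * (4 + x) * d) d₃≡ ⟩
      d₃ * (4 + d * ((3 + d) * (3 + d))) * d
                                      ≡⟨ l₂ d d₃ ⟩
      B * B * (4 + d) * (d₃ * d)      ∎))
      where
      l = lcmC c (3 ∷ 2 ∷ []) a
      l₁ : ∀ A d d₃ → A * (4 + d) * (d₃ * d) ≡ A * (d₃ * (d * (4 + d)))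
      l₁ = solve-∀
      l₂ : ∀ d d₃ → d₃ * (4 + d * ((3 + d) * (3 + d))) * d ≡ (1 + d) * (1 + d) * (4 + d) * (d₃ * d)
      l₂ = solve-∀
      l₃ : ∀ a → 6 * a ≡ 2 * (3 * a)
      l₃ = solve-∀
      N≡2[3a] : N ≡ 2 * (3 * a)
      N≡2[3a] = trans N≡6a (l₃ a)
    primesB : ∀ {ℓ} → Prime ℓ → ℓ ∣ B → ℓ ≡ 3 ⊎ ℓ ≡ 2
    primesB ℓr ℓ∣B = [ inj₁ , inj₂ ∘ proj₁ ]′ (factors ℓr (subst (_ ∣_) (sym A≡) (∣m⇒∣m*n B ℓ∣B)))
    9∤B : 9 ∤ B
    9∤B 9∣B = p³∤A prime[3] (λ()) (subst (27 ∣_) (sym A≡) (∣-trans (divides 3 refl) (*-pres-∣ 9∣B 9∣B)))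
    -- Only 2 and 3 divide B; 9 does not, since 27 does not divide A = B², and 4 does not, since C
    -- is 0 or 1 modulo 4.
    B∣6 : B ∣ 6
    B∣6 with 2 ∣? B
    ... | no 2∤B = ∣-trans (prime-power-only 3 1 B _
      (λ ℓr ℓ∣B → [ id , (λ ℓ≡2 → contradiction (subst (_∣ B) ℓ≡2 ℓ∣B) 2∤B) ]′ (primesB ℓr ℓ∣B)) 9∤B) (divides 2 refl)
    ... | yes (divides b B≡) = subst (_∣ 6) (trans (*-comm 2 b) (sym B≡)) (*-monoʳ-∣ 2
      (prime-power-only 3 1 b _
        (λ ℓr ℓ∣b → [ id , (λ ℓ≡2 → contradiction (subst (4 ∣_) (sym B≡) (*-pres-∣ (subst (_∣ b) ℓ≡2 ℓ∣b) ∣-refl)) (4∤1+C t a)) ]′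
          (primesB ℓr (∣-trans ℓ∣b (divides 2 (trans B≡ (*-comm b 2))))))
        (λ 9∣b → 9∤B (subst (9 ∣_) (sym B≡) (∣m⇒∣m*n 2 9∣b)))))
    five : ∀ n → 4 ≤ n → 1 + n ∣ 6 → n ≡ 5
    five 4 4≤n h = contradiction h (from-no (5 ∣? 6))
    five 5 4≤n h = refl
    five 1 (s≤s ()) h
    five 2 (s≤s (s≤s ())) h
    five 3 (s≤s (s≤s (s≤s ()))) h
    five (suc (suc (suc (suc (suc (suc n)))))) 4≤n h = contradiction (∣⇒≤ h) λ{ (s≤s (s≤s (s≤s (s≤s (s≤s (s≤s ())))))) }
    large : 4 ≤ d → ⊥
    large 4≤d with C≡5 t a 1≤t 1≤a (five d 4≤d B∣6)
    ... | t≡1 , a≡2 = regular (inj₁ (t≡1 , inj₂ (inj₂ (inj₂ (trans N≡6a (cong (6 *_) a≡2))))))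

  -- With a = 1, N is the product of its distinct primes, all among 2, 3, 5 here. The product 6 is
  -- left to the case where P = 3 and N is even.
  small-chain : ∀ {N} P S → P < 7 → Prime P → 3 ≤ P → All (λ s → 1 ≤ s × gcd P s ≡ 1 × s < P) S → Chain S →
                All Prime S → product (P ∷ S) * 1 ≡ N → ¬ (P ≡ 3 × 2 ∣ N) →
                N ≡ 3 ⊎ N ≡ 5 ⊎ N ≡ 10 ⊎ N ≡ 15 ⊎ N ≡ 30
  small-chain 1 S P<7 Pr (s≤s ()) below chain primes N≡ ¬6
  small-chain 2 S P<7 Pr (s≤s (s≤s ())) below chain primes N≡ ¬6
  small-chain 3 _ P<7 Pr 3≤P below [] primes refl ¬6 = inj₁ refl
  small-chain 3 _ P<7 Pr 3≤P below [2] primes refl ¬6 = contradiction (refl , divides 3 refl) ¬6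
  small-chain 3 _ P<7 Pr 3≤P ((_ , _ , s<3) ∷ _) ((3≤s , _) ∷ _) primes N≡ ¬6 = contradiction s<3 (≤⇒≯ 3≤s)
  small-chain 4 S P<7 Pr 3≤P below chain primes N≡ ¬6 = contradiction Pr (from-no (prime? 4))
  small-chain 5 _ P<7 Pr 3≤P below [] primes refl ¬6 = inj₂ (inj₁ refl)
  small-chain 5 _ P<7 Pr 3≤P below [2] primes refl ¬6 = inj₂ (inj₂ (inj₁ refl))
  small-chain 5 (1 ∷ _) P<7 Pr 3≤P below ((s≤s () , _) ∷ _) primes N≡ ¬6
  small-chain 5 (2 ∷ _) P<7 Pr 3≤P below ((s≤s (s≤s ()) , _) ∷ _) primes N≡ ¬6
  small-chain 5 (3 ∷ _) P<7 Pr 3≤P below (_ ∷ []) primes refl ¬6 = inj₂ (inj₂ (inj₂ (inj₁ refl)))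
  small-chain 5 (3 ∷ _) P<7 Pr 3≤P below (_ ∷ [2]) primes refl ¬6 = inj₂ (inj₂ (inj₂ (inj₂ refl)))
  small-chain 5 (3 ∷ _) P<7 Pr 3≤P below ((_ , (_ , _ , s<3) ∷ _) ∷ ((3≤s , _) ∷ _)) primes N≡ ¬6 =
    contradiction s<3 (≤⇒≯ 3≤s)
  small-chain 5 (4 ∷ _) P<7 Pr 3≤P below (_ ∷ _) (sr ∷ _) N≡ ¬6 = contradiction sr (from-no (prime? 4))
  small-chain 5 (suc (suc (suc (suc (suc s)))) ∷ _) P<7 Pr 3≤P ((_ , _ , s≤s (s≤s (s≤s (s≤s (s≤s ()))))) ∷ _) (_ ∷ _) primes N≡ ¬6
  small-chain 6 S P<7 Pr 3≤P below chain primes N≡ ¬6 = contradiction Pr (from-no (prime? 6))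
  small-chain (suc (suc (suc (suc (suc (suc (suc P))))))) S
    (s≤s (s≤s (s≤s (s≤s (s≤s (s≤s (s≤s ()))))))) Pr 3≤P below chain primes N≡ ¬6

  -- P is the only prime that can divide A, so A ≤ P², which fails as soon as P²(4 + C(a)) < C(Pa).
  -- This inequality holds whenever C(a) ≥ 4, and for t = a = 1 from P = 7 on. Of the remaining N,
  -- 10 is exceptional and 3, 5, 15, 30 have the primitive primes 2, 11, 31, 61.
  no-odd-obstruction : ∀ {t N a A} P S → 3 ≤ P → All (λ s → 1 ≤ s × gcd P s ≡ 1 × s < P) S → Chain S →
                       ¬ (P ≡ 3 × 2 ∣ N) → ¬ Obstruction t N P a A S
  no-odd-obstruction {t} {N} {a} {A} P S 3≤P below chain ¬6 o = [ large , small ]′ (C-dichotomy t a 1≤t 1≤a)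
    where
    open Obstruction o
    d = 𝒞 c a
    only : ∀ {ℓ} → Prime ℓ → ℓ ∣ A → ℓ ≡ P
    only ℓr ℓ∣A = [ id , (λ (ℓ≡2 , P≡3) → contradiction (P≡3 , subst (_∣ N) ℓ≡2 (factor∣N ℓr ℓ∣A)) ¬6) ]′ (factors ℓr ℓ∣A)
    P≢2 : P ≢ 2
    P≢2 refl = contradiction 3≤P λ{ (s≤s (s≤s ())) }
    1≤P : 1 ≤ P
    1≤P = ≤-trans (s≤s z≤n) 3≤P
    instance
      P≢0 : NonZero P
      P≢0 = >-nonZero 1≤P
    A≤P² : A ≤ P * P
    A≤P² = subst (λ x → A ≤ P * x) (*-identityʳ P)
      (∣⇒≤ {{m^n≢0 P 2}} (prime-power-only P 2 A P≢0 only (p³∤A primeP P≢2)))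
    bound : P * P * (4 + d) < 𝒞 c (P * a) → ⊥
    bound h = <⇒≱ (power-bound (φ S) (P * P) (𝒞 c (P * a)) (4 + d) A (φ≥1 chain) (*-mono-≤ 1≤P 1≤P) h
      (quotient-bound c P S a A 1≤c 1≤a 1≤P ((3≤P , below) ∷ chain) chain below
        (trans lcmC-quotient (cong (𝒞 c) (sym index))))) A≤P²
    large : 4 ≤ d → ⊥
    large 4≤d with m≤n⇒∃[o]m+o≡n 3≤P
    ... | r , P≡ = bound (begin-strict
      P * P * (4 + d)               ≡⟨ *-comm (P * P) (4 + d) ⟩
      (4 + d) * (P * P)             ≡⟨ cong (λ n → (4 + d) * (n * n)) P≡ ⟨
      (4 + d) * ((3 + r) * (3 + r)) <⟨ *-monoʳ-< (4 + d) (square<4^ r) ⟩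
      (4 + d) * 4 ^ (2 + r)         ≤⟨ *-monoʳ-≤ (4 + d) (^-monoˡ-≤ (2 + r) 4≤d) ⟩
      (4 + d) * d ^ (2 + r)         ≤⟨ C-lower d (1 + r) ⟩
      𝒞 d (3 + r)                   ≡⟨ cong (𝒞 d) P≡ ⟩
      𝒞 d P                         ≡⟨ C-compose c a P ⟨
      𝒞 c (P * a)                   ∎)
      where open ≤-Reasoning
    small : t ≡ 1 × a ≡ 1 → ⊥
    small (t≡1 , a≡1) with 7 ≤? P
    ... | yes 7≤P with m≤n⇒∃[o]m+o≡n 7≤P
    ... | r , P≡ = bound (subst₂ (λ c k → P * P * (4 + 𝒞 c k) < 𝒞 c (P * k)) (cong (λ x → x * x) (sym t≡1)) (sym a≡1)
      (subst (λ n → n * n * 5 < 𝒞 1 (n * 1)) P≡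
        (subst (λ k → (7 + r) * (7 + r) * 5 < 𝒞 1 k) (sym (*-identityʳ (7 + r))) (5*square<C r))))
    small (t≡1 , a≡1) | no P≱7 = [ hit 2 3 (from-yes (primitive? 1 3 2))
      , [ hit 11 5 (from-yes (primitive? 1 5 11))
      , [ (λ N≡10 → regular (inj₁ (t≡1 , inj₂ (inj₂ (inj₁ N≡10)))))
      , [ hit 31 15 (from-yes (primitive? 1 15 31)) , hit 61 30 (from-yes (primitive? 1 30 61)) ]′ ]′ ]′ ]′
      (small-chain P S (≰⇒> P≱7) primeP 3≤P below chain primes (trans (cong (product (P ∷ S) *_) (sym a≡1)) index) ¬6)
      where
      hit : ∀ p n → Primitive 1 n p → N ≡ n → ⊥
      hit p n prim N≡n = noPrimitive p (subst₂ (λ c n → Primitive c n p) (cong (λ x → x * x) (sym t≡1)) (sym N≡n) prim)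

  no-obstruction : ∀ {t N a A} P S → Chain (P ∷ S) → ¬ Obstruction t N P a A S
  no-obstruction _ _ [2] o = no-[2]-obstruction o
  no-obstruction {t} {N} P S ((3≤P , below) ∷ chain) o = go chain below (P ≟ 3 ×-dec (2 ∣? N)) o
    where
    go : ∀ {S a A} → Chain S → All (λ s → 1 ≤ s × gcd P s ≡ 1 × s < P) S → Dec (P ≡ 3 × 2 ∣ N) → ¬ Obstruction t N P a A S
    go chain below (no ¬6) o = no-odd-obstruction P _ 3≤P below chain ¬6 o
    go [] below (yes (refl , 2∣N)) o with Obstruction.complete o prime[2] 2∣N
    ... | here ()
    ... | there ()
    go [2] below (yes (refl , 2∣N)) o = no-[3,2]-obstruction o
    go ((3≤s , _) ∷ _) ((_ , _ , s<3) ∷ _) (yes (refl , _)) o = contradiction s<3 (≤⇒≯ 3≤s)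

  -- Carmichael's theorem on primitive prime divisors, for the sequence C.
  primitive-prime : ∀ t N → 1 ≤ t → 1 ≤ N → ¬ Exceptional t N → ∃[ p ] Primitive (t * t) N p
  primitive-prime t 1 1≤t 1≤N regular with prime-divisor {t} (λ t≡1 → regular (inj₁ (t≡1 , inj₁ refl)))
  ... | p , pr , p∣t = p , pr , subst (p ∣_) (sym (C-one (t * t))) (∣m⇒∣m*n t p∣t) ,
    λ { (s≤s z≤n) () }
  -- A primitive prime is at most C(N), so its existence is decidable and its absence may be
  -- assumed.
  primitive-prime t N@(suc (suc _)) 1≤t 1≤N regular with anyUpTo? (primitive? (t * t) N) (suc (𝒞 (t * t) N))
  ... | yes (p , _ , prim) = p , prim
  ... | no none = ⊥-elim (go (primeChain N N))
    where
    c = t * t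
    noPrimitive : ∀ p → ¬ Primitive c N p
    noPrimitive p prim@(_ , p∣ , _) = none (p , s≤s (∣⇒≤ {{>-nonZero (C≥1 (*-mono-≤ 1≤t 1≤t) 1≤N)}} p∣) , prim)
    go : PrimeChain N N → ⊥
    go record { primes = [] ; complete = complete } with prime-divisor {N} (λ ())
    ... | q , qr , q∣N with complete qr (∣⇒≤ q∣N) q∣N
    ... | ()
    go record { primes = P ∷ S ; chain = chain ; all≤ = (Pr , P≤N) ∷ all≤ ; product∣ = divides a N≡ ; complete = complete }
      = no-obstruction {A = quotient lcm∣} P S chain (record
        { 1≤t = 1≤t ; 1<N = s≤s (s≤s z≤n) ; regular = regular ; noPrimitive = noPrimitive
        ; index = index
        ; primeP = Pr ; primes = All.map proj₁ all≤
        ; complete = λ pr p∣N → complete pr (∣⇒≤ p∣N) p∣N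
        ; lcmC-quotient = sym (m∣n⇒n≡quotient*m lcm∣)
        ; largest = λ pr p∣N → largest chain (complete pr (∣⇒≤ p∣N) p∣N)
        })
      where
      index : product (P ∷ S) * a ≡ N
      index = trans (*-comm (product (P ∷ S)) a) (sym N≡)
      lcm∣ : lcmC c (P ∷ S) a ∣ 𝒞 c N
      lcm∣ = subst (λ n → lcmC c (P ∷ S) a ∣ 𝒞 c n) index (lcmC-∣ c (P ∷ S) a)
      largest : ∀ {p} → Chain (P ∷ S) → p ∈ P ∷ S → p ≤ P
      largest chain             (here refl) = ≤-refl
      largest ((_ , below) ∷ _) (there p∈S) = <⇒≤ (proj₂ (proj₂ (All.lookup below p∈S)))

open import Data.Integer using (+_; -[1+_]; ∣_∣)

-- The terms of Δ and Δ′ in terms of C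

module NormSequence where

  open Arithmetic
  open import Data.Nat using (zero; suc; _+_; _*_; _≤_; _<_; z≤n; s≤s; _≟_; >-nonZero; _≤?_)
  open import Data.Nat.Properties hiding (_≟_; _≤?_)
  open import Data.Nat.Divisibility

  -- The trace of uⁿ when u has trace t and norm -1, that is, u² = tu + 1.
  traceSeq : ℕ → ℕ → ℕ
  traceSeq t 0             = 2
  traceSeq t 1             = t
  traceSeq t (suc (suc n)) = t * traceSeq t (suc n) + traceSeq t n

  normSeq : ℕ → ℤ
  normSeq zero    = + 1
  normSeq (suc n) = ℤ.- normSeq n

  -- N(x - 1) = N(x) - Tr(x) + 1 for x = uⁿ.
  Δ : ℕ → ℕ → ℤ
  Δ t n = normSeq n ℤ.- + traceSeq t n ℤ.+ + 1

  traceSeq-even-odd : ∀ t a → traceSeq t (a + a) ≡ M (t * t) a × traceSeq t (suc (a + a)) ≡ t * e (t * t) a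
  traceSeq-even-odd t zero = cong (λ x → 2 + x) (sym (*-zeroʳ (t * t))) , sym (*-identityʳ t)
  traceSeq-even-odd t (suc a) with traceSeq-even-odd t a
  ... | even , odd = even′ , odd′
    where
    c = t * t
    step : traceSeq t (suc (suc (a + a))) ≡ M c (suc a)
    step = trans (cong₂ (λ x y → t * x + y) odd even) (lemma t (e c a) (E c a))
      where
      lemma : ∀ t x y → t * (t * x) + (2 + t * t * y) ≡ 2 + t * t * (y + x)
      lemma = solve-∀
    even′ : traceSeq t (suc a + suc a) ≡ M c (suc a)
    even′ = trans (cong (traceSeq t ∘ suc) (+-suc a a)) step
    odd′ : traceSeq t (suc (suc a + suc a)) ≡ t * e c (suc a)
    odd′ = trans (cong (traceSeq t ∘ suc ∘ suc) (+-suc a a))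
      (trans (cong₂ (λ x y → t * x + y) step odd) (lemma t c (e c a) (E c (suc a))))
      where
      lemma : ∀ t c x y → t * (2 + c * y) + t * x ≡ t * (x + (c * y + 2))
      lemma = solve-∀

  normSeq-even : ∀ a → normSeq (a + a) ≡ + 1
  normSeq-even zero    = refl
  normSeq-even (suc a) = trans (cong (ℤ.-_ ∘ normSeq) (+-suc a a))
    (trans (ℤ.neg-involutive (normSeq (a + a))) (normSeq-even a))

  private
    cancel₁ : ∀ x → ∣ + 1 ℤ.- + (2 + x) ℤ.+ + 1 ∣ ≡ x
    cancel₁ zero    = refl
    cancel₁ (suc x) = refl
    cancel₂ : ∀ x → ∣ ℤ.- + 1 ℤ.- + x ℤ.+ + 1 ∣ ≡ x
    cancel₂ zero    = refl
    cancel₂ (suc x) = refl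

  ∣Δ∣-even : ∀ t a → ∣ Δ t (a + a) ∣ ≡ 𝒞 (t * t) a
  ∣Δ∣-even t a = trans (cong₂ (λ x y → ∣ x ℤ.- + y ℤ.+ + 1 ∣) (normSeq-even a) (proj₁ (traceSeq-even-odd t a)))
    (cancel₁ (𝒞 (t * t) a))

  ∣Δ∣-odd : ∀ t a → ∣ Δ t (suc (a + a)) ∣ ≡ t * e (t * t) a
  ∣Δ∣-odd t a = trans (cong₂ (λ x y → ∣ ℤ.- x ℤ.- + y ℤ.+ + 1 ∣) (normSeq-even a) (proj₂ (traceSeq-even-odd t a)))
    (cancel₂ (t * e (t * t) a))

  ∣Δ∣²-odd : ∀ t a → ∣ Δ t (suc (a + a)) ∣ * ∣ Δ t (suc (a + a)) ∣ ≡ 𝒞 (t * t) (suc (a + a))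
  ∣Δ∣²-odd t a = trans (cong (λ x → x * x) (∣Δ∣-odd t a))
    (trans (lemma t (e (t * t) a)) (cong (t * t *_) (sym (E-odd (t * t) a))))
    where
    lemma : ∀ t x → t * x * (t * x) ≡ t * t * (x * x)
    lemma = solve-∀

  -- The two shapes of n that are not 2 modulo 4. They are told apart because |Δₙ| is C(n/2) for
  -- even n, but only a square root of C(n) for odd n.
  data Kept : ℕ → Set where
    odd      : ∀ h → Kept (suc (h + h))
    fourfold : ∀ m → 1 ≤ m → Kept ((m + m) + (m + m))

  -- |Δₙ|² = C(n) for odd n, and |Δₙ| = C(n / 2) for n divisible by 4.
  order : ∀ {n} → Kept n → ℕ
  order (odd h)        = suc (h + h)
  order (fourfold m _) = m + m

  order≥1 : ∀ {n} (v : Kept n) → 1 ≤ order v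
  order≥1 (odd h)          = s≤s z≤n
  order≥1 (fourfold m 1≤m) = ≤-trans 1≤m (m≤m+n m m)

  ∣Δ⇒∣C : ∀ {n p} t (v : Kept n) → p ∣ ∣ Δ t n ∣ → p ∣ 𝒞 (t * t) (order v)
  ∣Δ⇒∣C {p = p} t (odd h)        p∣ = subst (p ∣_) (∣Δ∣²-odd t h) (∣m⇒∣m*n _ p∣)
  ∣Δ⇒∣C {p = p} t (fourfold m _) p∣ = subst (p ∣_) (∣Δ∣-even t (m + m)) p∣

  ∣C⇒∣Δ : ∀ {n p} t (v : Kept n) → Prime p → p ∣ 𝒞 (t * t) (order v) → p ∣ ∣ Δ t n ∣
  ∣C⇒∣Δ {p = p} t (odd h)        pr p∣ = prime∣square _ pr (subst (p ∣_) (sym (∣Δ∣²-odd t h)) p∣)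
  ∣C⇒∣Δ {p = p} t (fourfold m _) pr p∣ = subst (p ∣_) (sym (∣Δ∣-even t (m + m))) p∣

  m+m≢1+n+n : ∀ m n → m + m ≢ suc (n + n)
  m+m≢1+n+n m n eq = prime∤1 prime[2] (∣m+n∣m⇒∣n (divides m (trans (+-comm (n + n) 1) (trans (sym eq) (double m)))) (divides n (double n)))
    where
    double : ∀ x → x + x ≡ x * 2
    double = solve-∀

  nextKept-step : ∀ i r → (suc r % 4 ℕ.≡ᵇ 2) ≡ false → nextKept (r + i * 4) ≡ suc (r + i * 4)
  nextKept-step i r h = cong (λ b → if b then suc (suc (r + i * 4)) else suc (r + i * 4))
    (trans (cong (ℕ._≡ᵇ 2) ([m+kn]%n≡m%n (suc r) i 4)) h)

  nextKept-skip : ∀ i → nextKept (1 + i * 4) ≡ 3 + i * 4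
  nextKept-skip i = cong (λ b → if b ℕ.≡ᵇ 2 then 3 + i * 4 else 2 + i * 4) ([m+kn]%n≡m%n 2 i 4)

  keptIndex-3i : ∀ i → keptIndex (i * 3) ≡ i * 4
  keptIndex-3i+1 : ∀ i → keptIndex (1 + i * 3) ≡ 1 + i * 4
  keptIndex-3i+2 : ∀ i → keptIndex (2 + i * 3) ≡ 3 + i * 4
  keptIndex-3i zero    = refl
  keptIndex-3i (suc i) = trans (cong nextKept (keptIndex-3i+2 i)) (nextKept-step i 3 refl)
  keptIndex-3i+1 i = trans (cong nextKept (keptIndex-3i i)) (nextKept-step i 0 refl)
  keptIndex-3i+2 i = trans (cong nextKept (keptIndex-3i+1 i)) (nextKept-skip i)

  mod3-view : ∀ k → ∃[ i ] (k ≡ i * 3 ⊎ k ≡ 1 + i * 3 ⊎ k ≡ 2 + i * 3)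
  mod3-view zero = 0 , inj₁ refl
  mod3-view (suc k) with mod3-view k
  ... | i , inj₁ refl        = i , inj₂ (inj₁ refl)
  ... | i , inj₂ (inj₁ refl) = i , inj₂ (inj₂ refl)
  ... | i , inj₂ (inj₂ refl) = suc i , inj₁ refl

  kept : ∀ k → 1 ≤ k → Kept (keptIndex k)
  kept k 1≤k with mod3-view k
  ... | zero  , inj₁ refl = contradiction 1≤k λ()
  ... | suc i , inj₁ refl = subst Kept (trans (lemma (suc i)) (sym (keptIndex-3i (suc i)))) (fourfold (suc i) (s≤s z≤n))
    where
    lemma : ∀ i → (i + i) + (i + i) ≡ i * 4
    lemma = solve-∀
  ... | i , inj₂ (inj₁ refl) = subst Kept (trans (lemma i) (sym (keptIndex-3i+1 i))) (odd (i + i))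
    where
    lemma : ∀ i → suc ((i + i) + (i + i)) ≡ 1 + i * 4
    lemma = solve-∀
  ... | i , inj₂ (inj₂ refl) = subst Kept (trans (lemma i) (sym (keptIndex-3i+2 i))) (odd (suc (i + i)))
    where
    lemma : ∀ i → suc (suc (i + i) + suc (i + i)) ≡ 3 + i * 4
    lemma = solve-∀

  nextKept-< : ∀ n → n < nextKept n
  nextKept-< n with suc n % 4 ℕ.≡ᵇ 2
  ... | true  = m≤n+m (suc n) 1
  ... | false = ≤-refl

  keptIndex-< : ∀ {m n} → m < n → keptIndex m < keptIndex n
  keptIndex-< {m} {suc n} (s≤s m≤n) with m≤n⇒m<n∨m≡n m≤n
  ... | inj₁ m<n  = <-trans (keptIndex-< m<n) (nextKept-< (keptIndex n))
  ... | inj₂ refl = nextKept-< (keptIndex n)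

  keptIndex-injective : ∀ {m n} → keptIndex m ≡ keptIndex n → m ≡ n
  keptIndex-injective {m} {n} eq with <-cmp m n
  ... | tri< m<n _ _ = contradiction eq (<⇒≢ (keptIndex-< m<n))
  ... | tri≈ _ m≡n _ = m≡n
  ... | tri> _ _ n<m = contradiction (sym eq) (<⇒≢ (keptIndex-< n<m))

  -- The orders do not increase with the index: 5 has order 5, but 8 has order 4. So primitivity
  -- cannot be applied to the order of an earlier term directly; it is applied to the gcd of the two
  -- orders, and this lemma makes that gcd smaller than the later order.
  order-∤ : ∀ {m n} (v : Kept m) (w : Kept n) → m < n → order w ∤ order v
  order-∤ (odd h) (odd h′) m<n d = <⇒≱ m<n (∣⇒≤ d)
  order-∤ (fourfold m 1≤m) (odd h) m<n d =
    <⇒≱ m<n (≤-trans (∣⇒≤ {{>-nonZero (order≥1 (fourfold m 1≤m))}} d) (m≤m+n (m + m) (m + m)))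
  order-∤ (odd h) (fourfold m _) m<n d with ∣-trans (divides m (double m)) d
    where
    double : ∀ x → x + x ≡ x * 2
    double = solve-∀
  ... | divides x eq = m+m≢1+n+n x h (trans (double x) (sym eq))
    where
    double : ∀ x → x + x ≡ x * 2
    double = solve-∀
  order-∤ (fourfold m 1≤m) (fourfold m′ _) m<n d =
    <⇒≱ m<n (+-mono-≤ d≤ d≤)
    where d≤ = ∣⇒≤ {{>-nonZero (order≥1 (fourfold m 1≤m))}} d

  primitive⇒has : ∀ t {p} k (1≤k : 1 ≤ k) → Primitive (t * t) (order (kept k 1≤k)) p →
                  HasPrimitivePrimeDivisor (removeTwoMod4 (Δ t)) k
  primitive⇒has t {p} k 1≤k (pr , p∣N , first) = p , pr , ∣C⇒∣Δ t (kept k 1≤k) pr p∣N , λ m 1≤m m<k _ p∣m →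
    let N = order (kept k 1≤k)
        N′ = order (kept m 1≤m)
        g = gcd N N′
        p∣g = prime-∣-C-gcd (t * t) N N′ pr p∣N (∣Δ⇒∣C t (kept m 1≤m) p∣m)
        g≤N = ∣⇒≤ {{>-nonZero (order≥1 (kept k 1≤k))}} (gcd[m,n]∣m N N′)
        1≤g = n≢0⇒n>0 (λ g≡0 → contradiction (subst (1 ≤_) (gcd[m,n]≡0⇒m≡0 g≡0) (order≥1 (kept k 1≤k))) λ())
    in [ (λ g<N → first g<N 1≤g p∣g)
       , (λ g≡N → order-∤ (kept m 1≤m) (kept k 1≤k) (keptIndex-< m<k) (subst (_∣ N′) g≡N (gcd[m,n]∣n N N′))) ]′
       (m≤n⇒m<n∨m≡n g≤N)

  -- For t = 1 the exceptional orders 1, 6, 10, 12 belong to n = 1, 12, 20, 24, the kept indices at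
  -- k = 1, 9, 15, 18. For t = 2, order 2 belongs to n = 4 at k = 3.
  ExceptionalIndex : ℕ → ℕ → Set
  ExceptionalIndex t k = (t ≡ 1 × (k ≡ 1 ⊎ k ≡ 9 ⊎ k ≡ 15 ⊎ k ≡ 18)) ⊎ (t ≡ 2 × k ≡ 3)

  exceptional? : ∀ t N → Dec (Exceptional t N)
  exceptional? t N = (t ≟ 1 ×-dec (N ≟ 1 ⊎-dec N ≟ 6 ⊎-dec N ≟ 10 ⊎-dec N ≟ 12)) ⊎-dec (t ≟ 2 ×-dec N ≟ 2)

  order-odd : ∀ {n} (v : Kept n) h → order v ≡ suc (h + h) → n ≡ suc (h + h)
  order-odd (odd h)        _ eq = eq
  order-odd (fourfold m _) h eq = contradiction eq (m+m≢1+n+n m h)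

  order-even : ∀ {n} (v : Kept n) m → order v ≡ m + m → n ≡ (m + m) + (m + m)
  order-even (odd h)        m eq = contradiction (sym eq) (m+m≢1+n+n m h)
  order-even (fourfold _ _) m eq = cong₂ _+_ eq eq

  exceptional-index : ∀ t k (1≤k : 1 ≤ k) → Exceptional t (order (kept k 1≤k)) → ExceptionalIndex t k
  exceptional-index t k 1≤k = λ
    { (inj₁ (t≡1 , inj₁ eq))               → inj₁ (t≡1 , inj₁ (keptIndex-injective (order-odd v 0 eq)))
    ; (inj₁ (t≡1 , inj₂ (inj₁ eq)))        → inj₁ (t≡1 , inj₂ (inj₁ (keptIndex-injective (order-even v 3 eq))))
    ; (inj₁ (t≡1 , inj₂ (inj₂ (inj₁ eq)))) → inj₁ (t≡1 , inj₂ (inj₂ (inj₁ (keptIndex-injective (order-even v 5 eq)))))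
    ; (inj₁ (t≡1 , inj₂ (inj₂ (inj₂ eq)))) → inj₁ (t≡1 , inj₂ (inj₂ (inj₂ (keptIndex-injective (order-even v 6 eq)))))
    ; (inj₂ (t≡2 , eq))                    → inj₂ (t≡2 , keptIndex-injective (order-even v 1 eq))
    }
    where v = kept k 1≤k

  has-or-exceptional : ∀ t k → 1 ≤ t → 1 ≤ k →
    HasPrimitivePrimeDivisor (removeTwoMod4 (Δ t)) k ⊎ ExceptionalIndex t k
  has-or-exceptional t k 1≤t 1≤k with exceptional? t (order (kept k 1≤k))
  ... | yes exc = inj₂ (exceptional-index t k 1≤k exc)
  ... | no ¬exc with primitive-prime t (order (kept k 1≤k)) 1≤t (order≥1 (kept k 1≤k)) ¬exc
  ... | p , prim = inj₁ (primitive⇒has t k 1≤k prim)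

  -- The exceptional terms and the Zsigmondy bounds

  Seen : Sequence → ℕ → ℕ → Set
  Seen A k p = ∃[ m ] (m < k × 1 ≤ m × A m ≢ + 0 × + p ℤ.∣ A m)

  seen? : ∀ A k p → Dec (Seen A k p)
  seen? A k p = anyUpTo? (λ m → (1 ≤? m) ×-dec ¬? (A m ℤ.≟ + 0) ×-dec (p ∣? ∣ A m ∣)) k

  lacks : ∀ A k ps → ∣ A k ∣ ≡ product ps → All (λ p → Prime p × Seen A k p) ps → ¬ HasPrimitivePrimeDivisor A k
  lacks A k ps eq all (p , pr , p∣k , first) with All.lookup all
    (factorisationHasAllPrimeFactors pr (subst (p ∣_) eq p∣k) (All.map proj₁ all))
  ... | _ , m , m<k , 1≤m , m≢0 , p∣m = first m 1≤m m<k m≢0 p∣m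

  lacks-dec : ∀ A k ps → Dec (All (λ p → Prime p × Seen A k p) ps)
  lacks-dec A k = all? (λ p → prime? p ×-dec seen? A k p)

  Δ₁ Δ₂ : Sequence
  Δ₁ = removeTwoMod4 (Δ 1)
  Δ₂ = removeTwoMod4 (Δ 2)

  lacks₁ : ∀ k → k ≡ 1 ⊎ k ≡ 9 ⊎ k ≡ 15 ⊎ k ≡ 18 → ¬ HasPrimitivePrimeDivisor Δ₁ k
  -- For t = 1, Δ₁ = -1 has no prime divisor at all.
  lacks₁ _ (inj₁ refl) = lacks Δ₁ 1 [] refl []
  lacks₁ _ (inj₂ (inj₁ refl)) = lacks Δ₁ 9 ps refl (from-yes (lacks-dec Δ₁ 9 ps))
    where ps = 2 ∷ 2 ∷ 2 ∷ 2 ∷ 2 ∷ 2 ∷ 5 ∷ []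
  lacks₁ _ (inj₂ (inj₂ (inj₁ refl))) = lacks Δ₁ 15 ps refl (from-yes (lacks-dec Δ₁ 15 ps))
    where ps = 5 ∷ 5 ∷ 5 ∷ 11 ∷ 11 ∷ []
  lacks₁ _ (inj₂ (inj₂ (inj₂ refl))) = lacks Δ₁ 18 ps refl (from-yes (lacks-dec Δ₁ 18 ps))
    where ps = 2 ∷ 2 ∷ 2 ∷ 2 ∷ 2 ∷ 2 ∷ 2 ∷ 2 ∷ 3 ∷ 3 ∷ 3 ∷ 3 ∷ 5 ∷ []

  lacks₂ : ∀ k → k ≡ 3 → ¬ HasPrimitivePrimeDivisor Δ₂ k
  lacks₂ _ refl = lacks Δ₂ 3 ps refl (from-yes (lacks-dec Δ₂ 3 ps))
    where ps = 2 ∷ 2 ∷ 2 ∷ 2 ∷ 2 ∷ []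

  has₁ : ∀ k → 1 ≤ k → ¬ (k ≡ 1 ⊎ k ≡ 9 ⊎ k ≡ 15 ⊎ k ≡ 18) → HasPrimitivePrimeDivisor Δ₁ k
  has₁ k 1≤k h with has-or-exceptional 1 k ≤-refl 1≤k
  ... | inj₁ has              = has
  ... | inj₂ (inj₁ (_ , exc)) = contradiction exc h

  has₂ : ∀ k → 1 ≤ k → k ≢ 3 → HasPrimitivePrimeDivisor Δ₂ k
  has₂ k 1≤k h with has-or-exceptional 2 k (s≤s z≤n) 1≤k
  ... | inj₁ has            = has
  ... | inj₂ (inj₂ (_ , exc)) = contradiction exc h

  exactly : ∀ A (P : ℕ → Set) → (∀ k → Dec (P k)) → (∀ k → P k → ¬ HasPrimitivePrimeDivisor A k) →
            (∀ k → 1 ≤ k → ¬ P k → HasPrimitivePrimeDivisor A k) → LacksPrimitiveExactlyAt A P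
  exactly A P P? lack has k 1≤k = mk⇔ (λ ¬has → to (P? k) ¬has) (lack k)
    where
    to : Dec (P k) → ¬ HasPrimitivePrimeDivisor A k → P k
    to (yes Pk) _    = Pk
    to (no ¬Pk) ¬has = contradiction (has k 1≤k ¬Pk) ¬has

  exactly₁ : LacksPrimitiveExactlyAt Δ₁ (λ k → k ≡ 1 ⊎ k ≡ 9 ⊎ k ≡ 15 ⊎ k ≡ 18)
  exactly₁ = exactly Δ₁ _ (λ k → k ≟ 1 ⊎-dec k ≟ 9 ⊎-dec k ≟ 15 ⊎-dec k ≟ 18) lacks₁ has₁

  exactly₂ : LacksPrimitiveExactlyAt Δ₂ (λ k → k ≡ 3)
  exactly₂ = exactly Δ₂ _ (_≟ 3) lacks₂ has₂

  zsigmondy₁ : ZsigmondyBound Δ₁ 18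
  zsigmondy₁ = record
    { index    = s≤s z≤n
    ; bound    = λ k 18<k → has₁ k (≤-trans (s≤s z≤n) 18<k) λ
        { (inj₁ refl)               → contradiction 18<k (from-no (19 ≤? 1))
        ; (inj₂ (inj₁ refl))        → contradiction 18<k (from-no (19 ≤? 9))
        ; (inj₂ (inj₂ (inj₁ refl))) → contradiction 18<k (from-no (19 ≤? 15))
        ; (inj₂ (inj₂ (inj₂ refl))) → contradiction 18<k (from-no (19 ≤? 18)) }
    ; attained = inj₁ (lacks₁ 18 (inj₂ (inj₂ (inj₂ refl))))
    }

  zsigmondy₂ : ZsigmondyBound Δ₂ 3
  zsigmondy₂ = record
    { index    = s≤s z≤n
    ; bound    = λ k 3<k → has₂ k (≤-trans (s≤s z≤n) 3<k) λ { refl → contradiction 3<k (from-no (4 ≤? 3)) }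
    ; attained = inj₁ (lacks₂ 3 refl)
    }

  -- No index is exceptional, not even 1, as Δ₁ = -t has a prime divisor. The set defining Z is
  -- empty, and 1 is its supremum by convention.
  zsigmondy≥3 : ∀ t → 3 ≤ t → ZsigmondyBound (removeTwoMod4 (Δ t)) 1
  zsigmondy≥3 t 3≤t = record
    { index    = ≤-refl
    ; bound    = λ k 1<k → has k (<⇒≤ 1<k)
    ; attained = inj₂ (refl , has)
    }
    where
    has : ∀ k → 1 ≤ k → HasPrimitivePrimeDivisor (removeTwoMod4 (Δ t)) k
    has k 1≤k with has-or-exceptional t k (≤-trans (s≤s z≤n) 3≤t) 1≤k
    ... | inj₁ h                 = h
    ... | inj₂ (inj₁ (refl , _)) = contradiction 3≤t (from-no (3 ≤? 1))
    ... | inj₂ (inj₂ (refl , _)) = contradiction 3≤t (from-no (3 ≤? 2))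

-- Units of norm -1: integrality of the trace, and the norm sequence

module QuadraticField where

  open Arithmetic
  open NormSequence
  open import Defs using () renaming (_*_ to _*√_; _-_ to _-√_; _<_ to _<√_; _^_ to _^√_)
  open import Data.Nat using (zero; suc)
  open import Data.Rational hiding (∣_∣; 1ℚ; ½)
  open import Data.Rational.Properties

  private
    ι : ℤ → ℚ
    ι = ℤ→ℚ

    ιᵘ : ∀ i → toℚᵘ (ι i) ℚᵘ.≃ ℚᵘ.mkℚᵘ i 0
    ιᵘ i = toℚᵘ-fromℚᵘ (ℚᵘ.mkℚᵘ i 0)

  ι-+ : ∀ i j → ι (i ℤ.+ j) ≡ ι i + ι j
  ι-+ i j = toℚᵘ-injective (ℚᵘ.≃-trans (ιᵘ (i ℤ.+ j)) (ℚᵘ.≃-sym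
    (ℚᵘ.≃-trans (toℚᵘ-homo-+ (ι i) (ι j)) (ℚᵘ.≃-trans (ℚᵘ.+-cong (ιᵘ i) (ιᵘ j)) (ℚᵘ.*≡* (lemma i j))))))
    where
    lemma : ∀ i j → (i ℤ.* + 1 ℤ.+ j ℤ.* + 1) ℤ.* + 1 ≡ (i ℤ.+ j) ℤ.* + 1
    lemma = ℤ.solve-∀

  ι-* : ∀ i j → ι (i ℤ.* j) ≡ ι i * ι j
  ι-* i j = toℚᵘ-injective (ℚᵘ.≃-trans (ιᵘ (i ℤ.* j)) (ℚᵘ.≃-sym
    (ℚᵘ.≃-trans (toℚᵘ-homo-* (ι i) (ι j)) (ℚᵘ.≃-trans (ℚᵘ.*-cong (ιᵘ i) (ιᵘ j)) (ℚᵘ.*≡* refl)))))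

  ι-neg : ∀ i → ι (ℤ.- i) ≡ - ι i
  ι-neg (+ zero)  = refl
  ι-neg (+ suc n) = refl
  ι-neg -[1+ n ]  = lemma (ι (+ suc n))
    where
    open +-*-Solver
    lemma : ∀ x → x ≡ - (- x)
    lemma = solve 1 (λ x → x := :- (:- x)) refl

  ι-injective : ∀ {i j} → ι i ≡ ι j → i ≡ j
  ι-injective {i} {j} eq with ℚᵘ.≃-trans (ℚᵘ.≃-sym (ιᵘ i)) (ℚᵘ.≃-trans (ℚᵘ.≃-reflexive (cong toℚᵘ eq)) (ιᵘ j))
  ... | ℚᵘ.*≡* h = trans (sym (ℤ.*-identityʳ i)) (trans h (ℤ.*-identityʳ j))

  clear-denominator : ∀ q → q * ι (↧ q) ≡ ι (↥ q)
  clear-denominator q@(mkℚ n d _) = toℚᵘ-injective (ℚᵘ.≃-trans (toℚᵘ-homo-* q (ι (↧ q)))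
    (ℚᵘ.≃-trans (ℚᵘ.*-congˡ {toℚᵘ q} (ιᵘ (↧ q))) (ℚᵘ.≃-trans (ℚᵘ.*≡* (lemma n (+ suc d))) (ℚᵘ.≃-sym (ιᵘ n)))))
    where
    lemma : ∀ n k → n ℤ.* k ℤ.* + 1 ≡ n ℤ.* (k ℤ.* + 1)
    lemma = ℤ.solve-∀

  integral : ∀ q → ℚ.denominator-1 q ≡ 0 → q ≡ ι (↥ q)
  integral q@(mkℚ n .0 _) refl = sym (↥p/↧p≡p q)

  lowest-terms : ∀ q → Coprime ∣ ↥ q ∣ (↧ₙ q)
  lowest-terms (mkℚ _ _ c) {i} = recompute c {i}

  halve : ∀ x y → x + x ≡ y → x ≡ ½ * y
  halve x y eq = trans (lemma x) (cong (½ *_) eq)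
    where
    open +-*-Solver
    lemma : ∀ x → x ≡ ½ * (x + x)
    lemma = solve 1 (λ x → x := con ½ :* (x :+ x)) refl

  double-positive : ∀ x → 0ℚ < x → 0ℚ < x + x
  double-positive x 0<x = +-mono-< 0<x 0<x

  positive-integer : ∀ m → 0ℚ < ℤ→ℚ m → ∃[ n ] m ≡ + suc n
  positive-integer (+ zero)  0<m = ⊥-elim (<-irrefl refl 0<m)
  positive-integer (+ suc n) 0<m = n , refl
  positive-integer -[1+ n ] 0<m = ⊥-elim (<-asym 0<m (neg-antimono-< (positive⁻¹ (normalize (suc n) 1) {{normalize-pos (suc n) 1}})))

  square≥9 : ∀ n → 9 ℕ.≤ (3 ℕ.+ n) ℕ.* (3 ℕ.+ n)
  square≥9 n = ℕ.*-mono-≤ (ℕ.m≤m+n 3 n) (ℕ.m≤m+n 3 n)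

  square≥0 : ∀ x → 0ℚ ≤ x * x
  square≥0 x with ≤-total 0ℚ x
  ... | inj₁ 0≤x = nonNegative⁻¹ (x * x) {{nonNeg*nonNeg⇒nonNeg x {{nonNegative 0≤x}} x {{nonNegative 0≤x}}}}
  ... | inj₂ x≤0 = nonNegative⁻¹ (x * x) {{nonPos*nonPos⇒nonPos x {{nonPositive x≤0}} x {{nonPositive x≤0}}}}

  *-cancelʳ-≡0 : ∀ x y → y ≢ 0ℚ → x * y ≡ 0ℚ → x ≡ 0ℚ
  *-cancelʳ-≡0 x y y≢0 eq = begin
    x                   ≡⟨ *-identityʳ x ⟨
    x * 1ℚ              ≡⟨ cong (x *_) (*-inverseʳ y) ⟨
    x * (y * 1/ y)      ≡⟨ *-assoc x y (1/ y) ⟨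
    x * y * 1/ y        ≡⟨ cong (_* 1/ y) eq ⟩
    0ℚ * 1/ y           ≡⟨ *-zeroˡ (1/ y) ⟩
    0ℚ                  ∎
    where
    open ≡-Reasoning
    instance
      y≠0 : NonZero y
      y≠0 = ≢-nonZero y≢0

  module _ (d : ℕ) (a b : ℚ) (N≡-1 : norm {d} ⟨ a , b ⟩ ≡ - 1ℚ) where
    open +-*-Solver
    open ≡-Reasoning

    private
      D = ι (+ d)
      u : ℚ√ d
      u = ⟨ a , b ⟩

    D*b² : D * (b * b) ≡ a * a + 1ℚ
    D*b² = begin
      D * (b * b)                                 ≡⟨ lemma a (D * (b * b)) ⟩
      a * a + (- (a * a - D * (b * b)))           ≡⟨ cong (λ n → a * a + (- n)) N≡-1 ⟩
      a * a + 1ℚ                                  ∎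
      where
      lemma : ∀ a x → x ≡ a * a + (- (a * a - x))
      lemma = solve 2 (λ a x → x := a :* a :+ (:- (a :* a :- x))) refl

    norm-* : ∀ (x : ℚ√ d) → norm (u *√ x) ≡ - norm x
    norm-* ⟨ p , q ⟩ = begin
      norm (u *√ ⟨ p , q ⟩)
        ≡⟨ lemma a b p q D ⟩
      (a * a - D * (b * b)) * (p * p - D * (q * q))
        ≡⟨ cong (_* (p * p - D * (q * q))) N≡-1 ⟩
      - 1ℚ * (p * p - D * (q * q))
        ≡⟨ lemma′ (p * p - D * (q * q)) ⟩
      - (p * p - D * (q * q)) ∎
      where
      lemma : ∀ a b p q D → (a * p + D * (b * q)) * (a * p + D * (b * q)) - D * ((a * q + b * p) * (a * q + b * p)) ≡
                            (a * a - D * (b * b)) * (p * p - D * (q * q))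
      lemma = solve 5 (λ a b p q D →
        (a :* p :+ D :* (b :* q)) :* (a :* p :+ D :* (b :* q)) :- D :* ((a :* q :+ b :* p) :* (a :* q :+ b :* p)) :=
        (a :* a :- D :* (b :* b)) :* (p :* p :- D :* (q :* q))) refl
      lemma′ : ∀ x → - 1ℚ * x ≡ - x
      lemma′ = solve 1 (λ x → con (- 1ℚ) :* x := :- x) refl

    norm-^ : ∀ n → norm (u ^√ n) ≡ ι (normSeq n)
    norm-^ zero    = trans (lemma D) refl
      where
      lemma : ∀ D → 1ℚ * 1ℚ - D * (0ℚ * 0ℚ) ≡ 1ℚ
      lemma = solve 1 (λ D → con 1ℚ :* con 1ℚ :- D :* (con 0ℚ :* con 0ℚ) := con 1ℚ) refl
    norm-^ (suc n) = trans (norm-* (u ^√ n)) (trans (cong -_ (norm-^ n)) (sym (ι-neg (normSeq n))))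

    norm-minus-one : ∀ (x : ℚ√ d) → norm (x -√ 1√) ≡ norm x - (rat x + rat x) + 1ℚ
    norm-minus-one ⟨ p , q ⟩ = lemma p q D
      where
      lemma : ∀ p q D → (p - 1ℚ) * (p - 1ℚ) - D * ((q - 0ℚ) * (q - 0ℚ)) ≡ p * p - D * (q * q) - (p + p) + 1ℚ
      lemma = solve 3 (λ p q D → (p :- con 1ℚ) :* (p :- con 1ℚ) :- D :* ((q :- con 0ℚ) :* (q :- con 0ℚ)) :=
                                 p :* p :- D :* (q :* q) :- (p :+ p) :+ con 1ℚ) refl

    -- The characteristic equation u² = 2au + 1, the constant term being -N(u).
    rat-rec : ∀ (x : ℚ√ d) → rat (u *√ (u *√ x)) ≡ (a + a) * rat (u *√ x) + rat x
    rat-rec ⟨ p , q ⟩ = begin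
      a * (a * p + D * (b * q)) + D * (b * (a * q + b * p))
        ≡⟨ lemma₁ a b p q D ⟩
      (a + a) * (a * p + D * (b * q)) + (- (a * a - D * (b * b))) * p
        ≡⟨ cong (λ n → (a + a) * (a * p + D * (b * q)) + (- n) * p) N≡-1 ⟩
      (a + a) * (a * p + D * (b * q)) + 1ℚ * p
        ≡⟨ cong (λ y → (a + a) * (a * p + D * (b * q)) + y) (*-identityˡ p) ⟩
      (a + a) * (a * p + D * (b * q)) + p ∎
      where
      lemma₁ : ∀ a b p q D → a * (a * p + D * (b * q)) + D * (b * (a * q + b * p)) ≡
                             (a + a) * (a * p + D * (b * q)) + (- (a * a - D * (b * b))) * p
      lemma₁ = solve 5 (λ a b p q D → a :* (a :* p :+ D :* (b :* q)) :+ D :* (b :* (a :* q :+ b :* p)) :=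
                             (a :+ a) :* (a :* p :+ D :* (b :* q)) :+ (:- (a :* a :- D :* (b :* b))) :* p) refl

    trace-^ : ∀ t → a + a ≡ ι (+ t) → ∀ n → rat (u ^√ n) + rat (u ^√ n) ≡ ι (+ traceSeq t n)
    trace-^ t trace zero          = refl
    trace-^ t trace (suc zero)    = trans (cong (λ x → x + x) (lemma a b D)) trace
      where
      lemma : ∀ a b D → a * 1ℚ + D * (b * 0ℚ) ≡ a
      lemma = solve 3 (λ a b D → a :* con 1ℚ :+ D :* (b :* con 0ℚ) := a) refl
    trace-^ t trace (suc (suc n)) = begin
      rat (u ^√ (2 ℕ.+ n)) + rat (u ^√ (2 ℕ.+ n))
        ≡⟨ cong (λ x → x + x) (rat-rec (u ^√ n)) ⟩
      ((a + a) * r₁ + r₀) + ((a + a) * r₁ + r₀)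
        ≡⟨ lemma (a + a) r₁ r₀ ⟩
      (a + a) * (r₁ + r₁) + (r₀ + r₀)
        ≡⟨ cong₂ _+_ (cong₂ _*_ trace (trace-^ t trace (suc n))) (trace-^ t trace n) ⟩
      ι (+ t) * ι (+ traceSeq t (suc n)) + ι (+ traceSeq t n)
        ≡⟨ cong (_+ ι (+ traceSeq t n)) (ι-* (+ t) (+ traceSeq t (suc n))) ⟨
      ι (+ t ℤ.* + traceSeq t (suc n)) + ι (+ traceSeq t n)
        ≡⟨ ι-+ (+ t ℤ.* + traceSeq t (suc n)) (+ traceSeq t n) ⟨
      ι (+ t ℤ.* + traceSeq t (suc n) ℤ.+ + traceSeq t n)
        ≡⟨ cong (λ i → ι (i ℤ.+ + traceSeq t n)) (ℤ.pos-* t (traceSeq t (suc n))) ⟨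
      ι (+ traceSeq t (2 ℕ.+ n)) ∎
      where
      r₁ = rat (u ^√ suc n)
      r₀ = rat (u ^√ n)
      lemma : ∀ s x y → (s * x + y) + (s * x + y) ≡ s * (x + x) + (y + y)
      lemma = solve 3 (λ s x y → (s :* x :+ y) :+ (s :* x :+ y) := s :* (x :+ x) :+ (y :+ y)) refl

    normSequence : ∀ t → a + a ≡ ι (+ t) → IsNormSequence u (Δ t)
    normSequence t trace n _ = begin
      ι (normSeq n ℤ.- + traceSeq t n ℤ.+ + 1)
        ≡⟨ ι-+ (normSeq n ℤ.- + traceSeq t n) (+ 1) ⟩
      ι (normSeq n ℤ.- + traceSeq t n) + 1ℚ
        ≡⟨ cong (_+ 1ℚ) (trans (ι-+ (normSeq n) (ℤ.- + traceSeq t n)) (cong (λ y → ι (normSeq n) + y) (ι-neg (+ traceSeq t n)))) ⟩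
      ι (normSeq n) - ι (+ traceSeq t n) + 1ℚ
        ≡⟨ cong₂ (λ x y → x - y + 1ℚ) (norm-^ n) (trace-^ t trace n) ⟨
      norm (u ^√ n) - (rat (u ^√ n) + rat (u ^√ n)) + 1ℚ
        ≡⟨ norm-minus-one (u ^√ n) ⟨
      norm (u ^√ n -√ 1√) ∎

    -- Otherwise a² + 1 = d b² would vanish.
    irr≢0 : b ≢ 0ℚ
    irr≢0 b≡0 = from-no (1ℚ ≤? 0ℚ) (≤-trans (+-monoˡ-≤ 1ℚ (square≥0 a))
      (≤-reflexive (trans (sym D*b²) (trans (cong (λ b → D * (b * b)) b≡0) (*-zeroʳ D)))))

    -- Writing 2a = m / k in lowest terms, Horner's scheme keeps the multiple
    -- by σ = kⁿ of the value in the form x + yu with y ≡ mⁿ modulo k.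
    module _ (m : ℤ) (k : ℕ) (2a*k≡m : (a + a) * ι (+ k) ≡ ι m) where

      private
        K = ι (+ k)

      record Scaled (n : ℕ) (v : ℚ√ d) : Set where
        field
          σ x y z : ℤ
          rat≡    : ι σ * rat v ≡ ι x + ι y * a
          irr≡    : ι σ * irr v ≡ ι y * b
          power≡  : m ℤ.^ n ≡ y ℤ.+ + k ℤ.* z

      scaled : ∀ c cs → ∃[ n ] Scaled n (evalMonic (c ∷ cs) u)
      scaled c [] = 0 , record
        { σ = + 1 ; x = c ; y = + 1 ; z = + 0
        ; rat≡ = lemma₁ (ι c) a b D
        ; irr≡ = lemma₂ a b
        ; power≡ = sym (trans (cong (λ j → + 1 ℤ.+ j) (ℤ.*-zeroʳ (+ k))) refl)
        }
        where
        lemma₁ : ∀ c a b D → 1ℚ * (c + (a * 1ℚ + D * (b * 0ℚ))) ≡ c + 1ℚ * a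
        lemma₁ = solve 4 (λ c a b D → con 1ℚ :* (c :+ (a :* con 1ℚ :+ D :* (b :* con 0ℚ))) := c :+ con 1ℚ :* a) refl
        lemma₂ : ∀ a b → 1ℚ * (0ℚ + (a * 0ℚ + b * 1ℚ)) ≡ 1ℚ * b
        lemma₂ = solve 2 (λ a b → con 1ℚ :* (con 0ℚ :+ (a :* con 0ℚ :+ b :* con 1ℚ)) := con 1ℚ :* b) refl
      scaled c (c′ ∷ cs) with scaled c′ cs
      ... | n , s = suc n , record
        -- Since 2ak = m, k u² = mu + k, and therefore k u (x + yu) = ky + (kx + my)u.
        { σ = + k ℤ.* σ ; x = + k ℤ.* σ ℤ.* c ℤ.+ + k ℤ.* y ; y = + k ℤ.* x ℤ.+ m ℤ.* y ; z = m ℤ.* z ℤ.- x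
        ; rat≡ = begin
            ι (+ k ℤ.* σ) * (ι c + (a * r + D * (b * i)))
              ≡⟨ cong (_* (ι c + (a * r + D * (b * i)))) (ι-* (+ k) σ) ⟩
            K * S * (ι c + (a * r + D * (b * i)))
              ≡⟨ l₁ K S (ι c) a b r i D ⟩
            K * S * ι c + K * a * (S * r) + K * (D * b) * (S * i)
              ≡⟨ cong₂ (λ p q → K * S * ι c + K * a * p + K * (D * b) * q) rat≡ irr≡ ⟩
            K * S * ι c + K * a * (X + Y * a) + K * (D * b) * (Y * b)
              ≡⟨ l₂ K (K * S * ι c) a b X Y D ⟩
            K * S * ι c + K * a * (X + Y * a) + K * Y * (D * (b * b))
              ≡⟨ cong (λ q → K * S * ι c + K * a * (X + Y * a) + K * Y * q) D*b² ⟩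
            K * S * ι c + K * a * (X + Y * a) + K * Y * (a * a + 1ℚ)
              ≡⟨ l₃ K S (ι c) a X Y ⟩
            (K * S * ι c + K * Y) + (K * X + (a + a) * K * Y) * a
              ≡⟨ cong (λ q → (K * S * ι c + K * Y) + (K * X + q * Y) * a) 2a*k≡m ⟩
            (K * S * ι c + K * Y) + (K * X + ι m * Y) * a
              ≡⟨ cong₂ (λ p q → p + q * a) x′≡ y′≡ ⟨
            ι (+ k ℤ.* σ ℤ.* c ℤ.+ + k ℤ.* y) + ι (+ k ℤ.* x ℤ.+ m ℤ.* y) * a ∎
        ; irr≡ = begin
            ι (+ k ℤ.* σ) * (0ℚ + (a * i + b * r))
              ≡⟨ cong (_* (0ℚ + (a * i + b * r))) (ι-* (+ k) σ) ⟩
            K * S * (0ℚ + (a * i + b * r))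
              ≡⟨ l₄ K S a b r i ⟩
            K * (a * (S * i) + b * (S * r))
              ≡⟨ cong₂ (λ p q → K * (a * p + b * q)) irr≡ rat≡ ⟩
            K * (a * (Y * b) + b * (X + Y * a))
              ≡⟨ l₅ K a b X Y ⟩
            (K * X + (a + a) * K * Y) * b
              ≡⟨ cong (λ q → (K * X + q * Y) * b) 2a*k≡m ⟩
            (K * X + ι m * Y) * b
              ≡⟨ cong (_* b) y′≡ ⟨
            ι (+ k ℤ.* x ℤ.+ m ℤ.* y) * b ∎
        ; power≡ = trans (cong (m ℤ.*_) power≡) (l₆ m (+ k) x y z)
        }
        where
        open Scaled s
        v = evalMonic (c′ ∷ cs) u
        r = rat v
        i = irr v
        S = ι σ
        X = ι x
        Y = ι y
        x′≡ : ι (+ k ℤ.* σ ℤ.* c ℤ.+ + k ℤ.* y) ≡ K * S * ι c + K * Y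
        x′≡ = trans (ι-+ (+ k ℤ.* σ ℤ.* c) (+ k ℤ.* y)) (cong₂ _+_
          (trans (ι-* (+ k ℤ.* σ) c) (cong (_* ι c) (ι-* (+ k) σ))) (ι-* (+ k) y))
        y′≡ : ι (+ k ℤ.* x ℤ.+ m ℤ.* y) ≡ K * X + ι m * Y
        y′≡ = trans (ι-+ (+ k ℤ.* x) (m ℤ.* y)) (cong₂ _+_ (ι-* (+ k) x) (ι-* m y))
        l₁ : ∀ K S c a b r i D → K * S * (c + (a * r + D * (b * i))) ≡ K * S * c + K * a * (S * r) + K * (D * b) * (S * i)
        l₁ = solve 8 (λ K S c a b r i D → K :* S :* (c :+ (a :* r :+ D :* (b :* i))) :=
                                          K :* S :* c :+ K :* a :* (S :* r) :+ K :* (D :* b) :* (S :* i)) refl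
        l₂ : ∀ K s a b X Y D → s + K * a * (X + Y * a) + K * (D * b) * (Y * b) ≡
                               s + K * a * (X + Y * a) + K * Y * (D * (b * b))
        l₂ = solve 7 (λ K s a b X Y D → s :+ K :* a :* (X :+ Y :* a) :+ K :* (D :* b) :* (Y :* b) :=
                                        s :+ K :* a :* (X :+ Y :* a) :+ K :* Y :* (D :* (b :* b))) refl
        l₃ : ∀ K S c a X Y → K * S * c + K * a * (X + Y * a) + K * Y * (a * a + 1ℚ) ≡
                             (K * S * c + K * Y) + (K * X + (a + a) * K * Y) * a
        l₃ = solve 6 (λ K S c a X Y → K :* S :* c :+ K :* a :* (X :+ Y :* a) :+ K :* Y :* (a :* a :+ con 1ℚ) :=
                                      (K :* S :* c :+ K :* Y) :+ (K :* X :+ (a :+ a) :* K :* Y) :* a) refl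
        l₄ : ∀ K S a b r i → K * S * (0ℚ + (a * i + b * r)) ≡ K * (a * (S * i) + b * (S * r))
        l₄ = solve 6 (λ K S a b r i → K :* S :* (con 0ℚ :+ (a :* i :+ b :* r)) := K :* (a :* (S :* i) :+ b :* (S :* r))) refl
        l₅ : ∀ K a b X Y → K * (a * (Y * b) + b * (X + Y * a)) ≡ (K * X + (a + a) * K * Y) * b
        l₅ = solve 5 (λ K a b X Y → K :* (a :* (Y :* b) :+ b :* (X :+ Y :* a)) := (K :* X :+ (a :+ a) :* K :* Y) :* b) refl
        l₆ : ∀ m k x y z → m ℤ.* (y ℤ.+ k ℤ.* z) ≡ k ℤ.* x ℤ.+ m ℤ.* y ℤ.+ k ℤ.* (m ℤ.* z ℤ.- x)
        l₆ = ℤ.solve-∀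

      -- At a root the scaled value x + yu is zero; as b is not zero, y = 0, and k divides mⁿ. A
      -- prime dividing k would then divide m as well.
      algebraicInteger⇒denominator≡1 : IsAlgebraicInteger u → Coprime ∣ m ∣ k → k ≡ 1
      algebraicInteger⇒denominator≡1 ([] , eq) coprime = contradiction (cong rat eq) λ()
      algebraicInteger⇒denominator≡1 (c ∷ cs , eq) coprime = decidable-stable (k ℕ.≟ 1) λ k≢1 →
        let p , pr , p∣k = prime-divisor k≢1
        in prime∤1 pr (subst (p ℕ.∣_) (coprime (prime∣power pr n (p∣mⁿ p∣k) , p∣k)) ℕ.∣-refl)
        where
        n = proj₁ (scaled c cs)
        open Scaled (proj₂ (scaled c cs))
        y*b≡0 : ι y * b ≡ 0ℚ
        y*b≡0 = trans (sym irr≡) (trans (cong (λ v → ι σ * irr v) eq) (*-zeroʳ (ι σ)))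
        mⁿ≡kz : m ℤ.^ n ≡ + k ℤ.* z
        mⁿ≡kz = trans power≡ (trans (cong (ℤ._+ + k ℤ.* z) (ι-injective {y} {+ 0} (*-cancelʳ-≡0 (ι y) b irr≢0 y*b≡0)))
          (ℤ.+-identityˡ (+ k ℤ.* z)))
        p∣mⁿ : ∀ {p} → p ℕ.∣ k → p ℕ.∣ ∣ m ℤ.^ n ∣
        p∣mⁿ p∣k = subst (_ ℕ.∣_) (sym (trans (cong ∣_∣ mⁿ≡kz) (ℤ.abs-* (+ k) z))) (ℕ.∣m⇒∣m*n ∣ z ∣ p∣k)
        prime∣power : ∀ {p} → Prime p → ∀ n → p ℕ.∣ ∣ m ℤ.^ n ∣ → p ℕ.∣ ∣ m ∣
        prime∣power pr zero    h = ⊥-elim (prime∤1 pr h)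
        prime∣power pr (suc n) h = [ id , prime∣power pr n ]′ (euclidsLemma ∣ m ∣ _ pr (subst (_ ℕ.∣_) (ℤ.abs-* m (m ℤ.^ n)) h))

    trace-integral : IsAlgebraicInteger u → ∃[ m ] a + a ≡ ι m
    trace-integral integer = ↥ (a + a) , integral (a + a) (ℕ.suc-injective
      (algebraicInteger⇒denominator≡1 (↥ (a + a)) (↧ₙ (a + a)) (clear-denominator (a + a)) integer
        (λ {i} → lowest-terms (a + a) {i})))

    -- Either a > 1, or (a - 1)² < d b² = a² + 1, which amounts to a > 0.
    trace-positive : 1√ <√ u → 0ℚ < a
    trace-positive (rat-dominates 0<a-1 _) = ≰⇒> λ a≤0 →
      <-irrefl refl (<-trans (<-≤-trans 0<a-1 (+-monoˡ-≤ (- 1ℚ) a≤0)) (from-yes (0ℚ - 1ℚ <? 0ℚ)))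
    trace-positive (irr-dominates _ h) = ≰⇒> λ a≤0 → <-irrefl refl (<-≤-trans
      (subst₂ _<_ (lemma₁ a) (trans (lemma₂ b D) D*b²) h)
      (≤-trans (≤-reflexive (sym (+-identityʳ (a * a + 1ℚ))))
        (+-monoʳ-≤ (a * a + 1ℚ) (+-mono-≤ (neg-antimono-≤ a≤0) (neg-antimono-≤ a≤0)))))
      where
      lemma₁ : ∀ a → (a - 1ℚ) * (a - 1ℚ) ≡ a * a + 1ℚ + ((- a) + (- a))
      lemma₁ = solve 1 (λ a → (a :- con 1ℚ) :* (a :- con 1ℚ) := a :* a :+ con 1ℚ :+ ((:- a) :+ (:- a))) refl
      lemma₂ : ∀ b D → D * ((b - 0ℚ) * (b - 0ℚ)) ≡ D * (b * b)
      lemma₂ = solve 2 (λ b D → D :* ((b :- con 0ℚ) :* (b :- con 0ℚ)) := D :* (b :* b)) refl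

    irr-positive : a ≤ 1ℚ → 1√ <√ u → 0ℚ < b
    irr-positive a≤1 (rat-dominates 0<a-1 _) = ⊥-elim (<-irrefl refl (<-≤-trans 0<a-1 (+-monoˡ-≤ (- 1ℚ) a≤1)))
    irr-positive a≤1 (irr-dominates 0<b-0 _) = subst (0ℚ <_) (+-identityʳ b) 0<b-0

    -- The comparison with 13 would need (a - 13)² < d b² = a² + 1, that is, a > 84/13. So units of
    -- trace 1 or 2 never exceed 13.
    13≮u : a ≤ 1ℚ → a ≡ ½ ⊎ a ≡ 1ℚ → ¬ (ℤ→ℚ√ (+ 13) <√ u)
    13≮u a≤1 _ (rat-dominates 0<a-13 _) = from-no (0ℚ <? 1ℚ - ι (+ 13)) (<-≤-trans 0<a-13 (+-monoˡ-≤ (- ι (+ 13)) a≤1))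
    13≮u _ cases (irr-dominates _ h) = impossible cases (subst ((a - ι (+ 13)) * (a - ι (+ 13)) <_) (trans (lemma b D) D*b²) h)
      where
      lemma : ∀ b D → D * ((b - 0ℚ) * (b - 0ℚ)) ≡ D * (b * b)
      lemma = solve 2 (λ b D → D :* ((b :- con 0ℚ) :* (b :- con 0ℚ)) := D :* (b :* b)) refl
      impossible : ∀ {a} → a ≡ ½ ⊎ a ≡ 1ℚ → ¬ ((a - ι (+ 13)) * (a - ι (+ 13)) < a * a + 1ℚ)
      impossible (inj₁ refl) = from-no ((½ - ι (+ 13)) * (½ - ι (+ 13)) <? ½ * ½ + 1ℚ)
      impossible (inj₂ refl) = from-no ((1ℚ - ι (+ 13)) * (1ℚ - ι (+ 13)) <? 1ℚ * 1ℚ + 1ℚ)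

    -- With 2b = P / Q in lowest terms, d P² = (t² + 4) Q², so Q² divides d.
    irr-integral : ∀ t → a + a ≡ ι (+ t) → Squarefree d →
                   ∃[ p ] (b + b ≡ ι p × d ℕ.* (∣ p ∣ ℕ.* ∣ p ∣) ≡ t ℕ.* t ℕ.+ 4)
    irr-integral t trace squarefree = P , b+b≡P , trans (cong (λ q → d ℕ.* q) refl) (trans naturals
      (trans (cong (λ q → (t ℕ.* t ℕ.+ 4) ℕ.* (q ℕ.* q)) Q≡1) (ℕ.*-identityʳ _)))
      where
      β = b + b
      P = ↥ β
      Q = ↧ₙ β
      p = ∣ P ∣
      T = ι (+ t)
      rationals : D * (ι P * ι P) ≡ (T * T + ι (+ 4)) * (ι (+ Q) * ι (+ Q))
      rationals = begin
        D * (ι P * ι P)                               ≡⟨ cong (λ x → D * (x * x)) (clear-denominator β) ⟨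
        D * (β * ι (+ Q) * (β * ι (+ Q)))             ≡⟨ lemma₁ D b (ι (+ Q)) ⟩
        ι (+ 4) * (D * (b * b)) * (ι (+ Q) * ι (+ Q)) ≡⟨ cong (λ x → ι (+ 4) * x * (ι (+ Q) * ι (+ Q))) D*b² ⟩
        ι (+ 4) * (a * a + 1ℚ) * (ι (+ Q) * ι (+ Q))  ≡⟨ lemma₂ a (ι (+ Q)) ⟩
        ((a + a) * (a + a) + ι (+ 4)) * (ι (+ Q) * ι (+ Q))
          ≡⟨ cong (λ x → (x * x + ι (+ 4)) * (ι (+ Q) * ι (+ Q))) trace ⟩
        (T * T + ι (+ 4)) * (ι (+ Q) * ι (+ Q))       ∎
        where
        lemma₁ : ∀ D b q → D * ((b + b) * q * ((b + b) * q)) ≡ ι (+ 4) * (D * (b * b)) * (q * q)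
        lemma₁ = solve 3 (λ D b q → D :* ((b :+ b) :* q :* ((b :+ b) :* q)) := con (ι (+ 4)) :* (D :* (b :* b)) :* (q :* q)) refl
        lemma₂ : ∀ a q → ι (+ 4) * (a * a + 1ℚ) * (q * q) ≡ ((a + a) * (a + a) + ι (+ 4)) * (q * q)
        lemma₂ = solve 2 (λ a q → con (ι (+ 4)) :* (a :* a :+ con 1ℚ) :* (q :* q) :=
                                  ((a :+ a) :* (a :+ a) :+ con (ι (+ 4))) :* (q :* q)) refl
      integers : + d ℤ.* (P ℤ.* P) ≡ (+ t ℤ.* + t ℤ.+ + 4) ℤ.* (+ Q ℤ.* + Q)
      integers = ι-injective (trans (trans (ι-* (+ d) (P ℤ.* P)) (cong (D *_) (ι-* P P))) (trans rationals (sym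
        (trans (ι-* (+ t ℤ.* + t ℤ.+ + 4) (+ Q ℤ.* + Q)) (cong₂ _*_
          (trans (ι-+ (+ t ℤ.* + t) (+ 4)) (cong (_+ ι (+ 4)) (ι-* (+ t) (+ t)))) (ι-* (+ Q) (+ Q)))))))
      naturals : d ℕ.* (p ℕ.* p) ≡ (t ℕ.* t ℕ.+ 4) ℕ.* (Q ℕ.* Q)
      naturals = begin
        d ℕ.* (p ℕ.* p)                               ≡⟨ cong (d ℕ.*_) (ℤ.abs-* P P) ⟨
        d ℕ.* ∣ P ℤ.* P ∣                             ≡⟨ ℤ.abs-* (+ d) (P ℤ.* P) ⟨
        ∣ + d ℤ.* (P ℤ.* P) ∣                         ≡⟨ cong ∣_∣ integers ⟩
        ∣ (+ t ℤ.* + t ℤ.+ + 4) ℤ.* (+ Q ℤ.* + Q) ∣   ≡⟨ ℤ.abs-* (+ t ℤ.* + t ℤ.+ + 4) (+ Q ℤ.* + Q) ⟩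
        ∣ + t ℤ.* + t ℤ.+ + 4 ∣ ℕ.* ∣ + Q ℤ.* + Q ∣   ≡⟨ cong₂ (λ i j → ∣ i ℤ.+ + 4 ∣ ℕ.* ∣ j ∣) (ℤ.pos-* t t) (ℤ.pos-* Q Q) ⟨
        (t ℕ.* t ℕ.+ 4) ℕ.* (Q ℕ.* Q)                 ∎
      Q⊥p : Coprime (Q ℕ.* Q) (p ℕ.* p)
      Q⊥p = gcd≡1⇒coprime (no-common-prime⇒gcd≡1 (Q ℕ.* Q) (p ℕ.* p) λ r rr r∣Q² r∣p² →
        prime∤1 rr (subst (r ℕ.∣_) (lowest-terms β (prime∣square p rr r∣p² , prime∣square Q rr r∣Q²)) ℕ.∣-refl))
      Q≡1 : Q ≡ 1
      Q≡1 = squarefree Q (coprime-divisor Q⊥p (subst (Q ℕ.* Q ℕ.∣_) (trans (sym naturals) (ℕ.*-comm d (p ℕ.* p)))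
        (ℕ.n∣m*n (t ℕ.* t ℕ.+ 4))))
      b+b≡P : b + b ≡ ι P
      b+b≡P = integral β (ℕ.suc-injective Q≡1)

-- The units of trace 1 and 2, and the case distinction by the trace

open NormSequence
open QuadraticField
open Defs using (_<_; _≤_)

-- The numbers 5, here, and 8, below, are t² + 4 for t = 1 and t = 2, and P is 2b.
5≡d*P² : ∀ {d P} n → P ≡ + ℕ.suc n → d ℕ.* (∣ P ∣ ℕ.* ∣ P ∣) ≡ 5 → d ≡ 5 × P ≡ + 1
5≡d*P² {d} 0 refl eq = trans (sym (ℕ.*-identityʳ d)) eq , refl
5≡d*P² {d} 1 refl eq = contradiction (ℕ.divides d (sym eq)) (from-no (4 ℕ.∣? 5))
5≡d*P² {d} (ℕ.suc (ℕ.suc n)) refl eq = contradiction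
  (ℕ.≤-trans (square≥9 n) (ℕ.∣⇒≤ (ℕ.divides d (sym eq)))) (from-no (9 ℕ.≤? 5))

-- P = 1 would make d = 8, which is divisible by 4; this leaves 8 = 2 · 2².
8≡d*P² : ∀ {d P} n → Squarefree d → P ≡ + ℕ.suc n → d ℕ.* (∣ P ∣ ℕ.* ∣ P ∣) ≡ 8 → d ≡ 2 × P ≡ + 2
8≡d*P² {d} 0 squarefree refl eq = contradiction
  (squarefree 2 (subst (4 ℕ.∣_) (trans (sym eq) (ℕ.*-identityʳ d)) (ℕ.divides 2 refl))) λ ()
8≡d*P² {d} 1 squarefree refl eq = ℕ.*-cancelʳ-≡ d 2 4 eq , refl
8≡d*P² {d} (ℕ.suc (ℕ.suc n)) squarefree refl eq = contradiction
  (ℕ.≤-trans (square≥9 n) (ℕ.∣⇒≤ (ℕ.divides d (sym eq)))) (from-no (9 ℕ.≤? 8))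

golden-ratio : ∀ d a b → norm {d} ⟨ a , b ⟩ ≡ ℚ.- 1ℚ → Squarefree d → 1√ < ⟨ a , b ⟩ →
               a ℚ.+ a ≡ ℤ→ℚ (+ 1) → d ≡ 5 × a ≡ ½ × b ≡ ½
golden-ratio d a b N≡-1 squarefree 1<u trace =
  let a≡½ = halve a 1ℚ trace
      0<b = irr-positive d a b N≡-1 (subst (ℚ._≤ 1ℚ) (sym a≡½) (from-yes (½ ℚ.≤? 1ℚ))) 1<u
      P , 2b≡P , dP²≡5 = irr-integral d a b N≡-1 1 trace squarefree
      n , P≡1+n = positive-integer P (subst (ℚ.0ℚ ℚ.<_) 2b≡P (double-positive b 0<b))
      d≡5 , P≡1 = 5≡d*P² n P≡1+n dP²≡5
  in d≡5 , a≡½ , halve b 1ℚ (trans 2b≡P (cong ℤ→ℚ P≡1))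

silver-ratio : ∀ d a b → norm {d} ⟨ a , b ⟩ ≡ ℚ.- 1ℚ → Squarefree d → 1√ < ⟨ a , b ⟩ →
               a ℚ.+ a ≡ ℤ→ℚ (+ 2) → d ≡ 2 × a ≡ 1ℚ × b ≡ 1ℚ
silver-ratio d a b N≡-1 squarefree 1<u trace =
  let a≡1 = halve a (ℤ→ℚ (+ 2)) trace
      0<b = irr-positive d a b N≡-1 (ℚ.≤-reflexive a≡1) 1<u
      P , 2b≡P , dP²≡8 = irr-integral d a b N≡-1 2 trace squarefree
      n , P≡1+n = positive-integer P (subst (ℚ.0ℚ ℚ.<_) 2b≡P (double-positive b 0<b))
      d≡2 , P≡2 = 8≡d*P² n squarefree P≡1+n dP²≡8
  in d≡2 , a≡1 , halve b (ℤ→ℚ (+ 2)) (trans 2b≡P (cong ℤ→ℚ P≡2))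

Conclusion : (d : ℕ) → ℚ√ d → Sequence → Set
Conclusion d u Δ = IsNormSequence u Δ ×
    (ℤ→ℚ√ (+ 13) < u → ZsigmondyBound≤ (removeTwoMod4 Δ) 4) ×
    (u ≤ ℤ→ℚ√ (+ 13) →
    ((d ≡ 2 × rat u ≡ 1ℚ × irr u ≡ 1ℚ) ×
    ZsigmondyBound (removeTwoMod4 Δ) 3 ×
    LacksPrimitiveExactlyAt (removeTwoMod4 Δ) (λ k → k ≡ 3))
    ⊎
    ((d ≡ 5 × rat u ≡ ½ × irr u ≡ ½) ×
    ZsigmondyBound (removeTwoMod4 Δ) 18 ×
    LacksPrimitiveExactlyAt (removeTwoMod4 Δ)
    (λ k → k ≡ 1 ⊎ k ≡ 9 ⊎ k ≡ 15 ⊎ k ≡ 18))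
    ⊎
    ZsigmondyBound (removeTwoMod4 Δ) 1)

-- The split is by the trace, not by the size of u: traces 1 and 2 determine u, which is then below
-- 13, and from trace 3 on Z = 1 answers both ranges of u.
conclusion : ∀ d a b → Squarefree d → norm {d} ⟨ a , b ⟩ ≡ ℚ.- 1ℚ → 1√ < ⟨ a , b ⟩ →
             ∀ {m} n → m ≡ + ℕ.suc n → a ℚ.+ a ≡ ℤ→ℚ m → Conclusion d ⟨ a , b ⟩ (Δ (ℕ.suc n))
conclusion d a b squarefree N≡-1 1<u 0 refl trace =
  normSequence d a b N≡-1 1 trace ,
  (λ 13<u → contradiction 13<u (13≮u d a b N≡-1 (subst (ℚ._≤ 1ℚ) (sym a≡½) (from-yes (½ ℚ.≤? 1ℚ))) (inj₁ a≡½))) ,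
  (λ _ → inj₂ (inj₁ (golden-ratio d a b N≡-1 squarefree 1<u trace , zsigmondy₁ , exactly₁)))
  where
  a≡½ : a ≡ ½
  a≡½ = halve a 1ℚ trace
conclusion d a b squarefree N≡-1 1<u 1 refl trace =
  normSequence d a b N≡-1 2 trace ,
  (λ 13<u → contradiction 13<u (13≮u d a b N≡-1 (ℚ.≤-reflexive a≡1) (inj₂ a≡1))) ,
  (λ _ → inj₁ (silver-ratio d a b N≡-1 squarefree 1<u trace , zsigmondy₂ , exactly₂))
  where
  a≡1 : a ≡ 1ℚ
  a≡1 = halve a (ℤ→ℚ (+ 2)) trace
conclusion d a b squarefree N≡-1 1<u (ℕ.suc (ℕ.suc n)) refl trace =
  normSequence d a b N≡-1 (3 ℕ.+ n) trace ,
  (λ _ → 1 , zsigmondy , ℕ.s≤s ℕ.z≤n) ,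
  (λ _ → inj₂ (inj₂ zsigmondy))
  where
  zsigmondy : ZsigmondyBound (removeTwoMod4 (Δ (3 ℕ.+ n))) 1
  zsigmondy = zsigmondy≥3 (3 ℕ.+ n) (ℕ.m≤m+n 3 n)

theorem3p2 : (d : ℕ) → 1 ℕ.< d → Squarefree d →
    (u : ℚ√ d) → IsUnit u → norm u ≡ ℚ.- 1ℚ → 1√ < u →
    ∃[ Δ ] (IsNormSequence u Δ ×
    (ℤ→ℚ√ (+ 13) < u → ZsigmondyBound≤ (removeTwoMod4 Δ) 4) ×
    (u ≤ ℤ→ℚ√ (+ 13) →
    ((d ≡ 2 × rat u ≡ 1ℚ × irr u ≡ 1ℚ) ×
    ZsigmondyBound (removeTwoMod4 Δ) 3 ×
    LacksPrimitiveExactlyAt (removeTwoMod4 Δ) (λ k → k ≡ 3))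
    ⊎
    ((d ≡ 5 × rat u ≡ ½ × irr u ≡ ½) ×
    ZsigmondyBound (removeTwoMod4 Δ) 18 ×
    LacksPrimitiveExactlyAt (removeTwoMod4 Δ)
    (λ k → k ≡ 1 ⊎ k ≡ 9 ⊎ k ≡ 15 ⊎ k ≡ 18))
    ⊎
    ZsigmondyBound (removeTwoMod4 Δ) 1))
theorem3p2 d 1<d squarefree ⟨ a , b ⟩ (integer , _) N≡-1 1<u =
  let m , trace = trace-integral d a b N≡-1 integer
      0<m = subst (ℚ.0ℚ ℚ.<_) trace (double-positive a (trace-positive d a b N≡-1 1<u))
      n , m≡1+n = positive-integer m 0<m
  in Δ (ℕ.suc n) , conclusion d a b squarefree N≡-1 1<u n m≡1+n trace
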